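{- Let $\varphi\in\Phi$ be arbitrary. Then there exist uncountably many entire transcendental functions $f(z)=c_0+c_1z+c_2z^2+\cdots$ with all $c_j\in\mathbb{Q}\setminus\{0\}$ such that for every $s\in\{0,1,2,\ldots\}$: (i) $f^{(s)}(0)\in\mathbb{Q}$; (ii) $f^{(s)}(\mathbb{Q}\setminus\{0\})\subseteq\mathscr{L}$; (iii) $f^{(s)}(\mathscr{L}_{\varphi}^{\ast})\subseteq\mathscr{L}$.
   Context: An entire transcendental function is an entire function that is not a polynomial. $\mathscr{L}$ is the set of Liouville numbers (real irrational $\zeta$ such that for every $\eta>0$ there are infinitely many rationals $y/x$, $x\geq1$, with $|\zeta-y/x|\leq x^{ -\eta}$). $\Vert\alpha\Vert$ is the distance from $\alpha$ to the nearest integer. $\Phi$ is the set of non-decreasing $\varphi:\mathbb{R}_{\geq 2}\to\mathbb{R}_{\geq 2}$ with $\lim_{x\to\infty}\varphi(x)=\infty$. For $\varphi\in\Phi$, $\mathscr{L}_{\varphi}^{\ast}$ is the set of $\zeta\in\mathscr{L}$ for which there is $N_0(\zeta)$ such that for every integer $N\geq N_0(\zeta)$ there is an integer $q$ with $2\leq q\leq\varphi(N)$ and $\Vert q\zeta\Vert\leq q^{ -N}$. $f^{(s)}$ is the $s$-th derivative, $f^{(0)}=f$. -}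

module Defs where

open import Data.Nat.Base as ℕ using (ℕ; zero; suc)
import Data.Nat.Properties as ℕₚ
open import Data.Integer.Base as ℤ using (ℤ; +_)
import Data.Integer.Properties as ℤₚ
import Data.Integer.DivMod as ℤ
open import Data.Rational.Base as ℚ using (ℚ; 0ℚ; 1ℚ; ½; _/_; ↥_; ↧_; floor)
import Data.Rational.Properties as ℚₚ
import Data.Rational.Unnormalised.Base as ℚᵘ
import Data.Rational.Unnormalised.Properties as ℚᵘₚ
open import Data.Rational.Solver using (module +-*-Solver)
open import Data.List.Base using (List; []; _∷_)
open import Data.List.Membership.Propositional using (_∉_)
open import Data.Product.Base using (Σ; Σ-syntax; ∃; ∃₂; ∃-syntax; _×_; _,_)
open import Data.Sum.Base using (inj₁; inj₂)
open import Function.Bundles using (Func; _⟨$⟩_)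
import Function.Relation.Binary.Setoid.Equality as FuncEquality
open import Level using (0ℓ)
open import Relation.Binary.Bundles using (Setoid)
open import Relation.Binary.PropositionalEquality
  using (_≡_; _≢_; refl; sym; trans; cong; subst)
open import Relation.Nullary using (¬_; yes; no)
open import Relation.Unary using (Pred; _∈_)

dℚ : ℚ → ℚ → ℚ
dℚ a b = ℚ.∣ a ℚ.- b ∣

-- n ↦ 1/n, with the junk value 0 at n = 0.
recip : ℕ → ℚ
recip zero      = 0ℚ
recip n@(suc _) = + 1 / n

infixr 8 _^⁻_

_^⁻_ : ℕ → ℕ → ℚ
x ^⁻ n = recip (x ℕ.^ n)

-- Distance to the nearest integer, which is ⌊a⌋ or ⌊a⌋ + 1.
distℤℚ : ℚ → ℚ
distℤℚ a = dℚ a (floor a / 1) ℚ.⊓ dℚ a (ℤ.suc (floor a) / 1)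

module RationalLemmas where

  open +-*-Solver

  d-sym : ∀ a b → dℚ a b ≡ dℚ b a
  d-sym a b = trans (sym (ℚₚ.∣-p∣≡∣p∣ (a ℚ.- b)))
    (cong ℚ.∣_∣ (solve 2 (λ x y → :- (x :- y) := y :- x) refl a b))

  d-triangle : ∀ a b c → dℚ a c ℚ.≤ dℚ a b ℚ.+ dℚ b c
  d-triangle a b c = subst (λ t → ℚ.∣ t ∣ ℚ.≤ dℚ a b ℚ.+ dℚ b c)
    (solve 3 (λ x y z → (x :- y) :+ (y :- z) := x :- z) refl a b c)
    (ℚₚ.∣p+q∣≤∣p∣+∣q∣ (a ℚ.- b) (b ℚ.- c))

  d-refl : ∀ a → dℚ a a ≡ 0ℚ
  d-refl a = cong ℚ.∣_∣ (ℚₚ.+-inverseʳ a)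

  ½-pos : ∀ {ε} → 0ℚ ℚ.< ε → 0ℚ ℚ.< ½ ℚ.* ε
  ½-pos {ε} 0<ε = subst (ℚ._< ½ ℚ.* ε) (ℚₚ.*-zeroʳ ½) (ℚₚ.*-monoʳ-<-pos ½ 0<ε)

  halves : ∀ ε → ½ ℚ.* ε ℚ.+ ½ ℚ.* ε ≡ ε
  halves ε = trans (sym (ℚₚ.*-distribʳ-+ ε ½ ½)) (ℚₚ.*-identityˡ ε)

  ≤∣∣ : ∀ a → a ℚ.≤ ℚ.∣ a ∣
  ≤∣∣ a with ℚₚ.≤-total 0ℚ a
  ... | inj₁ 0≤a = ℚₚ.≤-reflexive (sym (ℚₚ.0≤p⇒∣p∣≡p 0≤a))
  ... | inj₂ a≤0 = ℚₚ.≤-trans a≤0 (ℚₚ.0≤∣p∣ a)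

  ∣∣-lub : ∀ {a b} → a ℚ.≤ b → ℚ.- a ℚ.≤ b → ℚ.∣ a ∣ ℚ.≤ b
  ∣∣-lub {a} {b} a≤b -a≤b with ℚₚ.∣p∣≡p∨∣p∣≡-p a
  ... | inj₁ eq = subst (ℚ._≤ b) (sym eq) a≤b
  ... | inj₂ eq = subst (ℚ._≤ b) (sym eq) -a≤b

  ≤-shift : ∀ {a b c} → a ℚ.≤ b ℚ.+ c → a ℚ.- b ℚ.≤ c
  ≤-shift {a} {b} {c} p = subst (a ℚ.- b ℚ.≤_)
    (solve 2 (λ x y → (x :+ y) :- x := y) refl b c)
    (ℚₚ.+-monoˡ-≤ (ℚ.- b) p)

  1-lipschitz : (f : ℚ → ℚ) → (∀ a b → f a ℚ.≤ f b ℚ.+ dℚ a b) →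
                ∀ a b → dℚ (f a) (f b) ℚ.≤ dℚ a b
  1-lipschitz f le a b = ∣∣-lub (≤-shift (le a b))
    (subst (ℚ._≤ dℚ a b) (solve 2 (λ x y → y :- x := :- (x :- y)) refl (f a) (f b))
      (≤-shift (subst (λ t → f b ℚ.≤ f a ℚ.+ t) (d-sym b a) (le b a))))

  /1-≃ : ∀ i → ℚ.toℚᵘ (i / 1) ℚᵘ.≃ ℚᵘ.mkℚᵘ i 0
  /1-≃ i = ℚₚ.toℚᵘ-fromℚᵘ (ℚᵘ.mkℚᵘ i 0)

  /1-lower : ∀ i a → i ℤ.* ↧ a ℤ.≤ ↥ a → i / 1 ℚ.≤ a
  /1-lower i a@record{} le = ℚₚ.toℚᵘ-cancel-≤ (ℚᵘₚ.≤-respˡ-≃ (ℚᵘₚ.≃-sym (/1-≃ i))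
    (ℚᵘ.*≤* (subst (i ℤ.* ↧ a ℤ.≤_) (sym (ℤₚ.*-identityʳ (↥ a))) le)))

  /1-upper : ∀ i a → ↥ a ℤ.≤ i ℤ.* ↧ a → a ℚ.≤ i / 1
  /1-upper i a@record{} le = ℚₚ.toℚᵘ-cancel-≤ (ℚᵘₚ.≤-respʳ-≃ (ℚᵘₚ.≃-sym (/1-≃ i))
    (ℚᵘ.*≤* (subst (ℤ._≤ i ℤ.* ↧ a) (sym (ℤₚ.*-identityʳ (↥ a))) le)))

  /1-mono : ∀ {i j} → i ℤ.≤ j → i / 1 ℚ.≤ j / 1
  /1-mono {i} {j} i≤j = ℚₚ.toℚᵘ-cancel-≤
    (ℚᵘₚ.≤-respʳ-≃ (ℚᵘₚ.≃-sym (/1-≃ j)) (ℚᵘₚ.≤-respˡ-≃ (ℚᵘₚ.≃-sym (/1-≃ i))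
      (ℚᵘ.*≤* (ℤₚ.*-monoʳ-≤-nonNeg (+ 1) i≤j))))

  floor-lower : ∀ a → floor a / 1 ℚ.≤ a
  floor-lower a@record{} = /1-lower (floor a) a (ℤ.[n/d]*d≤n (↥ a) (↧ a))

  floor-upper : ∀ a → a ℚ.≤ ℤ.suc (floor a) / 1
  floor-upper a@record{} = /1-upper (ℤ.suc (floor a)) a (ℤₚ.<⇒≤
    (subst (λ t → ↥ a ℤ.< ℤ.suc t ℤ.* ↧ a)
      (sym (ℤ.div-pos-is-/ℕ (↥ a) (ℚ.↧ₙ a)))
      (ℤ.n<s[n/ℕd]*d (↥ a) (ℚ.↧ₙ a))))

  d-≤ : ∀ {a b} → b ℚ.≤ a → dℚ a b ≡ a ℚ.- b
  d-≤ {a} {b} b≤a = ℚₚ.0≤p⇒∣p∣≡p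
    (subst (ℚ._≤ a ℚ.- b) (ℚₚ.+-inverseʳ b) (ℚₚ.+-monoˡ-≤ (ℚ.- b) b≤a))

  d-far-below : ∀ {a b c} → b ℚ.≤ c → c ℚ.≤ a → dℚ a c ℚ.≤ dℚ a b
  d-far-below {a} {b} {c} b≤c c≤a = subst (ℚ._≤ dℚ a b) (sym (d-≤ c≤a))
    (ℚₚ.≤-trans (ℚₚ.+-monoʳ-≤ a (ℚₚ.neg-antimono-≤ b≤c)) (≤∣∣ (a ℚ.- b)))

  d-far-above : ∀ {a b c} → a ℚ.≤ c → c ℚ.≤ b → dℚ a c ℚ.≤ dℚ a b
  d-far-above {a} {b} {c} a≤c c≤b = subst (ℚ._≤ dℚ a b) (sym (trans (d-sym a c) (d-≤ a≤c)))
    (ℚₚ.≤-trans (ℚₚ.+-monoˡ-≤ (ℚ.- a) c≤b)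
      (subst (b ℚ.- a ℚ.≤_) (d-sym b a) (≤∣∣ (b ℚ.- a))))

  distℤℚ-min : ∀ a i → distℤℚ a ℚ.≤ dℚ a (i / 1)
  distℤℚ-min a i with i ℤₚ.≤? floor a
  ... | yes i≤ = ℚₚ.≤-trans (ℚₚ.p⊓q≤p _ _) (d-far-below (/1-mono i≤) (floor-lower a))
  ... | no  i≰ = ℚₚ.≤-trans (ℚₚ.p⊓q≤q (dℚ a (floor a / 1)) _)
                   (d-far-above (floor-upper a) (/1-mono (ℤₚ.i<j⇒suc[i]≤j (ℤₚ.≰⇒> i≰))))

  distℤℚ-attained : ∀ a → ∃[ i ] distℤℚ a ≡ dℚ a (i / 1)
  distℤℚ-attained a with ℚₚ.⊓-sel (dℚ a (floor a / 1)) (dℚ a (ℤ.suc (floor a) / 1))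
  ... | inj₁ eq = floor a , eq
  ... | inj₂ eq = ℤ.suc (floor a) , eq

  distℤℚ-lip : ∀ a b → dℚ (distℤℚ a) (distℤℚ b) ℚ.≤ dℚ a b
  distℤℚ-lip = 1-lipschitz distℤℚ λ a b → let i , eq = distℤℚ-attained b in
    ℚₚ.≤-trans (distℤℚ-min a i) (ℚₚ.≤-trans (d-triangle a b (i / 1))
      (ℚₚ.≤-reflexive (trans (ℚₚ.+-comm (dℚ a b) _) (cong (ℚ._+ dℚ a b) (sym eq)))))

  neg-lip : ∀ a b → dℚ (ℚ.- a) (ℚ.- b) ℚ.≤ dℚ a b
  neg-lip a b = ℚₚ.≤-reflexive (trans
    (cong ℚ.∣_∣ (solve 2 (λ x y → (:- x) :- (:- y) := y :- x) refl a b)) (d-sym b a))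

  ∣∣-lip : ∀ a b → dℚ ℚ.∣ a ∣ ℚ.∣ b ∣ ℚ.≤ dℚ a b
  ∣∣-lip = 1-lipschitz ℚ.∣_∣ λ a b → subst (λ t → ℚ.∣ t ∣ ℚ.≤ ℚ.∣ b ∣ ℚ.+ dℚ a b)
    (solve 2 (λ x y → y :+ (x :- y) := x) refl a b) (ℚₚ.∣p+q∣≤∣p∣+∣q∣ b (a ℚ.- b))

  +-d : ∀ a b c d → dℚ (a ℚ.+ b) (c ℚ.+ d) ℚ.≤ dℚ a c ℚ.+ dℚ b d
  +-d a b c d = subst (λ t → ℚ.∣ t ∣ ℚ.≤ dℚ a c ℚ.+ dℚ b d)
    (solve 4 (λ x y z w → (x :- z) :+ (y :- w) := (x :+ y) :- (z :+ w)) refl a b c d)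
    (ℚₚ.∣p+q∣≤∣p∣+∣q∣ (a ℚ.- c) (b ℚ.- d))

  *-d : ∀ a b c d → dℚ (a ℚ.* b) (c ℚ.* d) ℚ.≤ ℚ.∣ a ∣ ℚ.* dℚ b d ℚ.+ ℚ.∣ d ∣ ℚ.* dℚ a c
  *-d a b c d = ℚₚ.≤-trans
    (subst (λ t → ℚ.∣ t ∣ ℚ.≤ ℚ.∣ a ℚ.* (b ℚ.- d) ∣ ℚ.+ ℚ.∣ d ℚ.* (a ℚ.- c) ∣)
      (solve 4 (λ x y z w → x :* (y :- w) :+ w :* (x :- z) := x :* y :- z :* w) refl a b c d)
      (ℚₚ.∣p+q∣≤∣p∣+∣q∣ (a ℚ.* (b ℚ.- d)) (d ℚ.* (a ℚ.- c))))
    (ℚₚ.+-mono-≤ (ℚₚ.≤-reflexive (ℚₚ.∣p*q∣≡∣p∣*∣q∣ a _)) (ℚₚ.≤-reflexive (ℚₚ.∣p*q∣≡∣p∣*∣q∣ d _)))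

  *-mono : ∀ {p q r s} → 0ℚ ℚ.≤ r → 0ℚ ℚ.≤ q → p ℚ.≤ q → r ℚ.≤ s → p ℚ.* r ℚ.≤ q ℚ.* s
  *-mono {p} {q} {r} {s} 0≤r 0≤q p≤q r≤s = ℚₚ.≤-trans
    (ℚₚ.*-monoʳ-≤-nonNeg r {{ℚ.nonNegative 0≤r}} p≤q)
    (ℚₚ.*-monoˡ-≤-nonNeg q {{ℚ.nonNegative 0≤q}} r≤s)

open RationalLemmas

-- Real numbers are Cauchy sequences of rationals, compared with _≃_.
IsCauchy : (ℕ → ℚ) → Set
IsCauchy x = ∀ ε → 0ℚ ℚ.< ε → ∃[ N ] ∀ m n → N ℕ.≤ m → N ℕ.≤ n → dℚ (x m) (x n) ℚ.≤ ε

record ℝ : Set where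
  constructor mkℝ
  field
    seq    : ℕ → ℚ
    cauchy : IsCauchy seq

open ℝ public

infix  4 _≃_ _≤_ _<_ _≤_^-_
infixl 6 _+_ _-_
infixl 7 _*_
infixr 8 _^_

record _≃_ (x y : ℝ) : Set where
  constructor mk≃
  field
    un≃ : ∀ ε → 0ℚ ℚ.< ε → ∃[ N ] ∀ n → N ℕ.≤ n → dℚ (seq x n) (seq y n) ℚ.≤ ε

record _≤_ (x y : ℝ) : Set where
  constructor mk≤
  field
    un≤ : ∀ ε → 0ℚ ℚ.< ε → ∃[ N ] ∀ n → N ℕ.≤ n → seq x n ℚ.≤ seq y n ℚ.+ ε

record _<_ (x y : ℝ) : Set where
  constructor mk<
  field
    un< : ∃[ ε ] (0ℚ ℚ.< ε) × ∃[ N ] ∀ n → N ℕ.≤ n → seq x n ℚ.+ ε ℚ.≤ seq y n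

open _≃_ public
open _≤_ public
open _<_ public

module CauchyLemmas where

  const-cauchy : ∀ q → IsCauchy (λ _ → q)
  const-cauchy q ε 0<ε = 0 , λ _ _ _ _ → subst (ℚ._≤ ε) (sym (d-refl q)) (ℚₚ.<⇒≤ 0<ε)

  lip-cauchy : (f : ℚ → ℚ) → (∀ a b → dℚ (f a) (f b) ℚ.≤ dℚ a b) →
               ∀ x → IsCauchy x → IsCauchy (λ n → f (x n))
  lip-cauchy f lip x cx ε 0<ε = let N , h = cx ε 0<ε in
    N , λ m n N≤m N≤n → ℚₚ.≤-trans (lip (x m) (x n)) (h m n N≤m N≤n)

  +-cauchy : ∀ x y → IsCauchy x → IsCauchy y → IsCauchy (λ n → x n ℚ.+ y n)
  +-cauchy x y cx cy ε 0<ε =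
    let M , h = cx (½ ℚ.* ε) (½-pos 0<ε) ; N , k = cy (½ ℚ.* ε) (½-pos 0<ε) in
    M ℕ.⊔ N , λ m n p q → ℚₚ.≤-trans (+-d (x m) (y m) (x n) (y n)) (ℚₚ.≤-trans
      (ℚₚ.+-mono-≤ (h m n (ℕₚ.m⊔n≤o⇒m≤o M N p) (ℕₚ.m⊔n≤o⇒m≤o M N q))
                   (k m n (ℕₚ.m⊔n≤o⇒n≤o M N p) (ℕₚ.m⊔n≤o⇒n≤o M N q)))
      (ℚₚ.≤-reflexive (halves ε)))

  cauchy-bounded : ∀ x → IsCauchy x →
                   ∃[ B ] (0ℚ ℚ.< B) × ∃[ N ] ∀ n → N ℕ.≤ n → ℚ.∣ x n ∣ ℚ.≤ B
  cauchy-bounded x cx =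
    let N , h = cx 1ℚ (ℚₚ.positive⁻¹ 1ℚ) in
    ℚ.∣ x N ∣ ℚ.+ 1ℚ ,
    ℚₚ.+-mono-≤-< (ℚₚ.0≤∣p∣ (x N)) (ℚₚ.positive⁻¹ 1ℚ) ,
    N , λ n N≤n → ℚₚ.≤-trans
      (subst (λ t → ℚ.∣ t ∣ ℚ.≤ ℚ.∣ x N ∣ ℚ.+ dℚ (x n) (x N))
        (solve 2 (λ a b → b :+ (a :- b) := a) refl (x n) (x N))
        (ℚₚ.∣p+q∣≤∣p∣+∣q∣ (x N) (x n ℚ.- x N)))
      (ℚₚ.+-monoʳ-≤ ℚ.∣ x N ∣ (h n N N≤n ℕₚ.≤-refl))
    where open +-*-Solver

  *-cauchy : ∀ x y → IsCauchy x → IsCauchy y → IsCauchy (λ n → x n ℚ.* y n)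
  *-cauchy x y cx cy ε 0<ε =
    let A , 0<A , K , bx = cauchy-bounded x cx
        B , 0<B , L , by = cauchy-bounded y cy
        0<C = ℚₚ.+-mono-< 0<A 0<B
        instance
          posC = ℚ.positive {A ℚ.+ B} 0<C
          nzC  = ℚₚ.pos⇒nonZero (A ℚ.+ B)
          pos1/C = ℚₚ.1/pos⇒pos (A ℚ.+ B)
        δ   = ε ℚ.* ℚ.1/ (A ℚ.+ B)
        0<δ = subst (ℚ._< δ) (ℚₚ.*-zeroˡ (ℚ.1/ (A ℚ.+ B)))
                (ℚₚ.*-monoˡ-<-pos (ℚ.1/ (A ℚ.+ B)) 0<ε)
        M , h = cx δ 0<δ
        N , k = cy δ 0<δ
        eq : A ℚ.* δ ℚ.+ B ℚ.* δ ≡ ε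
        eq = trans (solve 4 (λ a b e i → a :* (e :* i) :+ b :* (e :* i) := e :* ((a :+ b) :* i))
                     refl A B ε (ℚ.1/ (A ℚ.+ B)))
               (trans (cong (ε ℚ.*_) (ℚₚ.*-inverseʳ (A ℚ.+ B))) (ℚₚ.*-identityʳ ε))
    in (K ℕ.⊔ L) ℕ.⊔ (M ℕ.⊔ N) , λ m n p q →
      let p₁ = ℕₚ.m⊔n≤o⇒m≤o (K ℕ.⊔ L) (M ℕ.⊔ N) p ; p₂ = ℕₚ.m⊔n≤o⇒n≤o (K ℕ.⊔ L) (M ℕ.⊔ N) p
          q₁ = ℕₚ.m⊔n≤o⇒m≤o (K ℕ.⊔ L) (M ℕ.⊔ N) q ; q₂ = ℕₚ.m⊔n≤o⇒n≤o (K ℕ.⊔ L) (M ℕ.⊔ N) q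
      in ℚₚ.≤-trans (*-d (x m) (y m) (x n) (y n)) (ℚₚ.≤-trans
        (ℚₚ.+-mono-≤
          (*-mono (ℚₚ.0≤∣p∣ _) (ℚₚ.<⇒≤ 0<A) (bx m (ℕₚ.m⊔n≤o⇒m≤o K L p₁))
            (k m n (ℕₚ.m⊔n≤o⇒n≤o M N p₂) (ℕₚ.m⊔n≤o⇒n≤o M N q₂)))
          (*-mono (ℚₚ.0≤∣p∣ _) (ℚₚ.<⇒≤ 0<B) (by n (ℕₚ.m⊔n≤o⇒n≤o K L q₁))
            (h m n (ℕₚ.m⊔n≤o⇒m≤o M N p₂) (ℕₚ.m⊔n≤o⇒m≤o M N q₂))))
        (ℚₚ.≤-reflexive eq))
    where open +-*-Solver

  ≃-refl : ∀ {x} → x ≃ x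
  ≃-refl {x} = mk≃ λ ε 0<ε → 0 , λ n _ → subst (ℚ._≤ ε) (sym (d-refl (seq x n))) (ℚₚ.<⇒≤ 0<ε)

  ≃-sym : ∀ {x y} → x ≃ y → y ≃ x
  ≃-sym {x} {y} x≃y = mk≃ λ ε 0<ε → let N , h = un≃ x≃y ε 0<ε in
    N , λ n N≤n → subst (ℚ._≤ ε) (d-sym (seq x n) (seq y n)) (h n N≤n)

  ≃-trans : ∀ {x y z} → x ≃ y → y ≃ z → x ≃ z
  ≃-trans {x} {y} {z} x≃y y≃z = mk≃ λ ε 0<ε →
    let M , h = un≃ x≃y (½ ℚ.* ε) (½-pos 0<ε) ; N , k = un≃ y≃z (½ ℚ.* ε) (½-pos 0<ε) in
    M ℕ.⊔ N , λ n p → ℚₚ.≤-trans (d-triangle (seq x n) (seq y n) (seq z n)) (ℚₚ.≤-trans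
      (ℚₚ.+-mono-≤ (h n (ℕₚ.m⊔n≤o⇒m≤o M N p)) (k n (ℕₚ.m⊔n≤o⇒n≤o M N p)))
      (ℚₚ.≤-reflexive (halves ε)))

open CauchyLemmas

ℚ→ℝ : ℚ → ℝ
ℚ→ℝ q = mkℝ (λ _ → q) (const-cauchy q)

ℕ→ℝ : ℕ → ℝ
ℕ→ℝ n = ℚ→ℝ (+ n / 1)

_+_ : ℝ → ℝ → ℝ
x + y = mkℝ (λ n → seq x n ℚ.+ seq y n) (+-cauchy (seq x) (seq y) (cauchy x) (cauchy y))

-_ : ℝ → ℝ
- x = mkℝ (λ n → ℚ.- seq x n) (lip-cauchy ℚ.-_ neg-lip (seq x) (cauchy x))

_-_ : ℝ → ℝ → ℝ
x - y = x + (- y)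

_*_ : ℝ → ℝ → ℝ
x * y = mkℝ (λ n → seq x n ℚ.* seq y n) (*-cauchy (seq x) (seq y) (cauchy x) (cauchy y))

∣_∣ : ℝ → ℝ
∣ x ∣ = mkℝ (λ n → ℚ.∣ seq x n ∣) (lip-cauchy ℚ.∣_∣ ∣∣-lip (seq x) (cauchy x))

-- Distance to the nearest integer: the continuous extension of distℤℚ.
‖_‖ : ℝ → ℝ
‖ x ‖ = mkℝ (λ n → distℤℚ (seq x n)) (lip-cauchy distℤℚ distℤℚ-lip (seq x) (cauchy x))

_^_ : ℝ → ℕ → ℝ
x ^ zero  = ℕ→ℝ 1
x ^ suc n = x * x ^ n

-- t ≤ x^(-η) for t ≥ 0, x ≥ 1 and real η > 0.  The real power x^η is the
-- supremum of the x^(a/b) over rationals 0 ≤ a/b < η, and t ≤ x^(-a/b) says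
-- t^b ≤ x^(-a).
_≤_^-_ : ℝ → ℕ → ℝ → Set
t ≤ x ^- η = ∀ (a k : ℕ) → ℚ→ℝ (+ a / suc k) < η → t ^ suc k ≤ ℚ→ℝ (x ^⁻ a)

Infinite : Pred ℚ 0ℓ → Set
Infinite P = ∀ (xs : List ℚ) → ∃[ r ] r ∉ xs × P r

Irrational : Pred ℝ 0ℓ
Irrational ζ = ∀ (r : ℚ) → ¬ (ζ ≃ ℚ→ℝ r)

-- The fraction y/x (x = suc k) need not be in lowest terms.
𝓛 : Pred ℝ 0ℓ
𝓛 ζ = Irrational ζ ×
  (∀ (η : ℝ) → ℕ→ℝ 0 < η →
    Infinite λ r → ∃₂ λ (y : ℤ) (k : ℕ) →
      (r ≡ y / suc k) × (∣ ζ - ℚ→ℝ r ∣ ≤ suc k ^- η))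

-- Since functions on ≥2 take a proof of 2 ≤ x, monotonicity for x ≃ y also
-- makes φ independent of that proof and of the choice of Cauchy sequence.
record Φ : Set where
  field
    fun      : (x : ℝ) → ℕ→ℝ 2 ≤ x → ℝ
    2≤fun    : ∀ x 2≤x → ℕ→ℝ 2 ≤ fun x 2≤x
    mono     : ∀ x y 2≤x 2≤y → x ≤ y → fun x 2≤x ≤ fun y 2≤y
    limit-∞  : ∀ M → ∃[ X ] ∀ x 2≤x → X ≤ x → M ≤ fun x 2≤x

-- φ N only makes sense for N ≥ 2, hence the hypothesis 2≤N.
𝓛* : Φ → Pred ℝ 0ℓ
𝓛* φ ζ = (ζ ∈ 𝓛) ×
  (Σ[ N₀ ∈ ℕ ] ∀ (N : ℕ) → N₀ ℕ.≤ N → (2≤N : ℕ→ℝ 2 ≤ ℕ→ℝ N) →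
    Σ[ q ∈ ℕ ] (2 ℕ.≤ q) × (ℕ→ℝ q ≤ Φ.fun φ (ℕ→ℝ N) 2≤N) ×
               (‖ ℕ→ℝ q * ζ ‖ ≤ ℚ→ℝ (q ^⁻ N)))

record ℂ : Set where
  constructor _+i_
  field
    re im : ℝ

open ℂ public

infix  4 _≃ᶜ_
infixl 6 _+ᶜ_ _-ᶜ_
infixl 7 _*ᶜ_
infixr 8 _^ᶜ_

_≃ᶜ_ : ℂ → ℂ → Set
z ≃ᶜ w = (re z ≃ re w) × (im z ≃ im w)

ℂ-setoid : Setoid 0ℓ 0ℓ
ℂ-setoid = record
  { Carrier       = ℂ
  ; _≈_           = _≃ᶜ_
  ; isEquivalence = record
    { refl  = ≃-refl , ≃-refl
    ; sym   = λ (p , q) → ≃-sym p , ≃-sym q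
    ; trans = λ (p , q) (p′ , q′) → ≃-trans p p′ , ≃-trans q q′
    }
  }

ℝ→ℂ : ℝ → ℂ
ℝ→ℂ x = x +i ℕ→ℝ 0

ℚ→ℂ : ℚ → ℂ
ℚ→ℂ q = ℝ→ℂ (ℚ→ℝ q)

_+ᶜ_ _-ᶜ_ _*ᶜ_ : ℂ → ℂ → ℂ
z +ᶜ w = (re z + re w) +i (im z + im w)
z -ᶜ w = (re z - re w) +i (im z - im w)
z *ᶜ w = (re z * re w - im z * im w) +i (re z * im w + im z * re w)

_^ᶜ_ : ℂ → ℕ → ℂ
z ^ᶜ zero  = ℚ→ℂ 1ℚ
z ^ᶜ suc n = z *ᶜ z ^ᶜ n

-- The squared modulus; below, |z| ≤ r is written ∣ z ∣² ≤ r², for r ≥ 0.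
∣_∣² : ℂ → ℝ
∣ z ∣² = re z * re z + im z * im z

ℂ-functions : Setoid 0ℓ 0ℓ
ℂ-functions = FuncEquality.setoid ℂ-setoid ℂ-setoid

ℂ⟶ℂ : Set
ℂ⟶ℂ = Setoid.Carrier ℂ-functions

HasDerivativeAt : ℂ⟶ℂ → ℂ → ℂ → Set
HasDerivativeAt f z w =
  ∀ (ε : ℚ) → 0ℚ ℚ.< ε → Σ[ δ ∈ ℚ ] (0ℚ ℚ.< δ) ×
    (∀ (h : ℂ) → ∣ h ∣² ≤ ℚ→ℝ (δ ℚ.* δ) →
      ∣ (f ⟨$⟩ (z +ᶜ h)) -ᶜ (f ⟨$⟩ z) -ᶜ w *ᶜ h ∣² ≤ ℚ→ℝ (ε ℚ.* ε) * ∣ h ∣²)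

Entire : Pred ℂ⟶ℂ 0ℓ
Entire f = ∀ z → ∃[ w ] HasDerivativeAt f z w

-- g = f⁽ˢ⁾
IsDerivative : ℕ → ℂ⟶ℂ → ℂ⟶ℂ → Set
IsDerivative zero    f g = ∀ z → (f ⟨$⟩ z) ≃ᶜ (g ⟨$⟩ z)
IsDerivative (suc s) f g =
  Σ[ g′ ∈ ℂ⟶ℂ ] IsDerivative s f g′ × (∀ z → HasDerivativeAt g′ z (g ⟨$⟩ z))

-- Coefficients are listed from the constant term upwards.
evalPoly : List ℂ → ℂ → ℂ
evalPoly []       z = ℚ→ℂ 0ℚ
evalPoly (a ∷ as) z = a +ᶜ z *ᶜ evalPoly as z

IsPolynomial : Pred ℂ⟶ℂ 0ℓ
IsPolynomial f = Σ[ as ∈ List ℂ ] ∀ z → (f ⟨$⟩ z) ≃ᶜ evalPoly as z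

EntireTranscendental : Pred ℂ⟶ℂ 0ℓ
EntireTranscendental f = Entire f × ¬ IsPolynomial f

-- c₀ + c₁ z + ⋯ + cₙ₋₁ zⁿ⁻¹
partialSum : (ℕ → ℂ) → ℕ → ℂ → ℂ
partialSum c zero    z = ℚ→ℂ 0ℚ
partialSum c (suc n) z = partialSum c n z +ᶜ c n *ᶜ z ^ᶜ n

_ConvergesTo_ : (ℕ → ℂ) → ℂ → Set
u ConvergesTo l = ∀ (ε : ℚ) → 0ℚ ℚ.< ε →
  ∃[ N ] ∀ n → N ℕ.≤ n → ∣ u n -ᶜ l ∣² ≤ ℚ→ℝ (ε ℚ.* ε)

HasPowerSeries : ℂ⟶ℂ → (ℕ → ℂ) → Set
HasPowerSeries f c = ∀ z → (λ n → partialSum c n z) ConvergesTo (f ⟨$⟩ z)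

IsRational : Pred ℂ 0ℓ
IsRational w = Σ[ r ∈ ℚ ] w ≃ᶜ ℚ→ℂ r

IsLiouville : Pred ℂ 0ℓ
IsLiouville w = Σ[ ξ ∈ ℝ ] (ξ ∈ 𝓛) × (w ≃ᶜ ℝ→ℂ ξ)

-- No sequence in the ambient setoid exhausts P.  The terms
-- need not lie in P, so the empty set is not vacuously uncountable.

Uncountable : (X : Setoid 0ℓ 0ℓ) → Pred (Setoid.Carrier X) 0ℓ → Set
Uncountable X P = ∀ (e : ℕ → Carrier) → ∃[ x ] x ∈ P × (∀ k → ¬ (x ≈ e k))
  where open Setoid X

{-# OPTIONS --safe #-}
module Submission where

-- Take f = Σ zʲ/dⱼ with d₀ ∣ d₁ ∣ ⋯ growing fast.  If q ≤ φ(N) and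
-- |ζ − p/q| ≤ q⁻ᴺ with N chosen after dₘ, then the truncation of f⁽ˢ⁾(ζ) after
-- the term with denominator dₘ, evaluated at p/q, is a rational of denominator
-- at most dₘ φ(N)ᵐ; it is close to f⁽ˢ⁾(ζ) compared with any fixed power of that
-- denominator, because dₘ₊₁ is chosen after φ(N).
--
-- To be constructive, irrationality is not argued by contradiction: it suffices
-- that for every B some such approximations lie outside (1/B)ℤ.  For ζ ∈ 𝓛* this
-- follows from the rational root theorem, since dₘ₊₁ is a multiple of (m+1)! dₘ:
-- if the truncation at p/q lies in (1/B)ℤ, then so does p/q, while a Liouville
-- number has positive distance from (1/B)ℤ.  For ζ rational two consecutive
-- truncations differ by less than 1/B, but not by 0.
--
-- Choosing each dₘ₊₁ among A and 8A keeps f(1) away from the value at 1 of the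
-- m-th function of a given enumeration.
open import Defs using (dℚ; recip; module RationalLemmas)
open import Algebra.Bundles using (CommutativeRing)
open import Algebra.Structures using (IsCommutativeRing)
import Algebra.Properties.CommutativeSemiring.Exp
import Algebra.Solver.Ring.AlmostCommutativeRing as ACR
import Algebra.Solver.Ring.Simple
open import Data.Empty using (⊥; ⊥-elim)
import Data.Integer.Properties as ℤₚ
open import Data.Nat.Base as ℕ using (ℕ; zero; suc; z≤n; s≤s)
import Data.Nat.Coprimality as Coprimality
import Data.Nat.Divisibility as ℕ∣
import Data.Nat.Properties as ℕₚ
open import Data.Nat.Solver using () renaming (module +-*-Solver to ℕ-Solver)
open import Data.Product.Base using (Σ-syntax; ∃₂; ∃-syntax; _×_; _,_; proj₁; proj₂)
open import Data.Rational.Base as ℚ using (ℚ; 0ℚ; 1ℚ; ½; ↥_; ↧ₙ_)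
import Data.Rational.Properties as ℚₚ
open import Data.Rational.Solver using (module +-*-Solver)
import Data.Rational.Unnormalised.Base as ℚᵘ
import Data.Rational.Unnormalised.Properties as ℚᵘₚ
open import Data.Sum.Base using (inj₁; inj₂)
open import Level using (0ℓ)
open import Relation.Binary.PropositionalEquality
  using (_≡_; _≢_; refl; sym; trans; cong; cong₂; subst; subst₂; isEquivalence; module ≡-Reasoning)
open import Relation.Nullary using (¬_; Dec; yes; no; contradiction)
open import Relation.Nullary.Decidable using (map′; _×-dec_)

-- The denominators are fixed once, while s, ζ, a radius R, a Lipschitz constant C and B are
-- arbitrary. Each requirement on these is therefore replaced by one in m alone that implies it once
-- m is large: (m+1)^(m+1) dominates powers of R, 2m dominates 2C, and the m-th power of a
-- denominator dominates every fixed power of it.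
--
-- Lying outside (1/B)ℤ serves both halves of being Liouville. A number ρ of denominator B is at
-- distance at least 1/(BD) from any fraction of denominator D outside (1/B)ℤ, too far for a good
-- approximation. And every finite list of rationals is contained in some (1/B)ℤ, so an
-- approximation outside it is new.
--
-- A number is accessible only through the terms of a sequence, so f is evaluated diagonally: the
-- n-th term of f(z) is a partial sum at the n-th term of z. The analysis then concerns polynomials
-- at Gaussian rationals only, with constants that do not depend on the number of terms.

-- Rational arithmetic: naturals, reciprocals and integrality in ℚ

module Rationals where

  open import Data.Integer.Base as ℤ using (ℤ; +_; -[1+_])
  open import Data.Rational.Base using (_+_; _*_; _-_; -_; _≤_; _<_; ∣_∣; _/_)
  open RationalLemmas
  open +-*-Solver

  ι : ℕ → ℚ
  ι n = + n / 1

  /1-distrib-+ : ∀ i j → (i ℤ.+ j) / 1 ≡ i / 1 + j / 1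
  /1-distrib-+ i j = ℚₚ.toℚᵘ-injective (ℚᵘₚ.≃-trans (/1-≃ (i ℤ.+ j))
    (ℚᵘₚ.≃-trans (ℚᵘ.*≡* (cong (ℤ._* + 1) (cong₂ ℤ._+_ (sym (ℤₚ.*-identityʳ i)) (sym (ℤₚ.*-identityʳ j)))))
    (ℚᵘₚ.≃-sym (ℚᵘₚ.≃-trans (ℚₚ.toℚᵘ-homo-+ (i / 1) (j / 1)) (ℚᵘₚ.+-cong (/1-≃ i) (/1-≃ j))))))

  /1-distrib-* : ∀ i j → (i ℤ.* j) / 1 ≡ i / 1 * (j / 1)
  /1-distrib-* i j = ℚₚ.toℚᵘ-injective (ℚᵘₚ.≃-trans (/1-≃ (i ℤ.* j))
    (ℚᵘₚ.≃-trans (ℚᵘ.*≡* refl)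
    (ℚᵘₚ.≃-sym (ℚᵘₚ.≃-trans (ℚₚ.toℚᵘ-homo-* (i / 1) (j / 1)) (ℚᵘₚ.*-cong (/1-≃ i) (/1-≃ j))))))

  /1-distrib-neg : ∀ i → (ℤ.- i) / 1 ≡ - (i / 1)
  /1-distrib-neg i = ℚₚ.toℚᵘ-injective (ℚᵘₚ.≃-trans (/1-≃ (ℤ.- i))
    (ℚᵘₚ.≃-sym (ℚᵘₚ.≃-trans (ℚₚ.toℚᵘ-homo‿- (i / 1)) (ℚᵘₚ.-‿cong (/1-≃ i)))))

  /1-cancel-≤ : ∀ {i j} → i / 1 ≤ j / 1 → i ℤ.≤ j
  /1-cancel-≤ {i} {j} le = subst₂ ℤ._≤_ (ℤₚ.*-identityʳ i) (ℤₚ.*-identityʳ j)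
    (ℚᵘₚ.drop-*≤* (ℚᵘₚ.≤-respʳ-≃ (/1-≃ j) (ℚᵘₚ.≤-respˡ-≃ (/1-≃ i) (ℚₚ.toℚᵘ-mono-≤ le))))

  /1-injective : ∀ {i j} → i / 1 ≡ j / 1 → i ≡ j
  /1-injective eq = ℤₚ.≤-antisym (/1-cancel-≤ (ℚₚ.≤-reflexive eq)) (/1-cancel-≤ (ℚₚ.≤-reflexive (sym eq)))

  /1-≡-mkℚ : ∀ i → i / 1 ≡ ℚ.mkℚ i 0 (Coprimality.sym (Coprimality.1-coprimeTo ℤ.∣ i ∣))
  /1-≡-mkℚ i = ℚₚ.toℚᵘ-injective
    {x = i / 1} {y = ℚ.mkℚ i 0 (Coprimality.sym (Coprimality.1-coprimeTo ℤ.∣ i ∣))} (/1-≃ i)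

  ι-+ : ∀ m n → ι (m ℕ.+ n) ≡ ι m + ι n
  ι-+ m n = trans (cong (_/ 1) (ℤₚ.pos-+ m n)) (/1-distrib-+ (+ m) (+ n))

  ι-* : ∀ m n → ι (m ℕ.* n) ≡ ι m * ι n
  ι-* m n = trans (cong (_/ 1) (ℤₚ.pos-* m n)) (/1-distrib-* (+ m) (+ n))

  ι-suc : ∀ n → ι (suc n) ≡ 1ℚ + ι n
  ι-suc n = ι-+ 1 n

  ι-mono-≤ : ∀ {m n} → m ℕ.≤ n → ι m ≤ ι n
  ι-mono-≤ m≤n = /1-mono (ℤ.+≤+ m≤n)

  ι-cancel-≤ : ∀ {m n} → ι m ≤ ι n → m ℕ.≤ n
  ι-cancel-≤ le = ℤₚ.drop‿+≤+ (/1-cancel-≤ le)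

  0≤ι : ∀ n → 0ℚ ≤ ι n
  0≤ι n = ι-mono-≤ {0} {n} z≤n

  0<1 : 0ℚ < 1ℚ
  0<1 = ℚₚ.positive⁻¹ 1ℚ

  0<ι : ∀ {n} → 0 ℕ.< n → 0ℚ < ι n
  0<ι 0<n = ℚₚ.<-≤-trans 0<1 (ι-mono-≤ 0<n)

  *-nonNeg : ∀ {p q} → 0ℚ ≤ p → 0ℚ ≤ q → 0ℚ ≤ p * q
  *-nonNeg {p} {q} 0≤p 0≤q = ℚₚ.nonNegative⁻¹ (p * q)
    {{ℚₚ.nonNeg*nonNeg⇒nonNeg p {{ℚ.nonNegative 0≤p}} q {{ℚ.nonNegative 0≤q}}}}

  *-pos : ∀ {p q} → 0ℚ < p → 0ℚ < q → 0ℚ < p * q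
  *-pos {p} {q} 0<p 0<q = ℚₚ.positive⁻¹ (p * q)
    {{ℚₚ.pos*pos⇒pos p {{ℚ.positive 0<p}} q {{ℚ.positive 0<q}}}}

  +-nonNeg : ∀ {p q} → 0ℚ ≤ p → 0ℚ ≤ q → 0ℚ ≤ p + q
  +-nonNeg 0≤p 0≤q = ℚₚ.+-mono-≤ 0≤p 0≤q

  *-monoˡ : ∀ r {p q} → 0ℚ ≤ r → p ≤ q → r * p ≤ r * q
  *-monoˡ r 0≤r = ℚₚ.*-monoˡ-≤-nonNeg r {{ℚ.nonNegative 0≤r}}

  *-monoʳ : ∀ r {p q} → 0ℚ ≤ r → p ≤ q → p * r ≤ q * r
  *-monoʳ r 0≤r = ℚₚ.*-monoʳ-≤-nonNeg r {{ℚ.nonNegative 0≤r}}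

  *-cancelʳ-≤ : ∀ r {p q} → 0ℚ < r → p * r ≤ q * r → p ≤ q
  *-cancelʳ-≤ r 0<r = ℚₚ.*-cancelʳ-≤-pos r {{ℚ.positive 0<r}}

  *-cancelʳ-≡ : ∀ r {p q} → 0ℚ < r → p * r ≡ q * r → p ≡ q
  *-cancelʳ-≡ r 0<r eq = ℚₚ.≤-antisym (*-cancelʳ-≤ r 0<r (ℚₚ.≤-reflexive eq))
    (*-cancelʳ-≤ r 0<r (ℚₚ.≤-reflexive (sym eq)))

  -- Turns an inequality into a ring identity with an explicit nonnegative remainder, which the
  -- solver can check.
  ≤-by-slack : ∀ {p q r} → 0ℚ ≤ r → q ≡ p + r → p ≤ q
  ≤-by-slack {p} {q} {r} 0≤r eq = subst₂ _≤_ (ℚₚ.+-identityʳ p) (sym eq) (ℚₚ.+-monoʳ-≤ p 0≤r)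

  +-cancelʳ-≤ : ∀ r {p q} → p + r ≤ q + r → p ≤ q
  +-cancelʳ-≤ r {p} {q} le = subst₂ _≤_ (eq p) (eq q) (ℚₚ.+-monoˡ-≤ (- r) le)
    where eq : ∀ s → s + r + - r ≡ s
          eq s = solve 2 (λ s r → s :+ r :+ (:- r) := s) refl s r

  -- A certificate for linear arithmetic: two known inequalities are added, and what remains is an
  -- identity for the ring solver.
  combine-≤ : ∀ {p q x₁ y₁ x₂ y₂} → x₁ ≤ y₁ → x₂ ≤ y₂ → q + (x₁ + x₂) ≡ p + (y₁ + y₂) → p ≤ q
  combine-≤ {p} {q} {x₁} {y₁} {x₂} {y₂} le₁ le₂ eq = +-cancelʳ-≤ (x₁ + x₂)
    (ℚₚ.≤-trans (ℚₚ.+-monoʳ-≤ p (ℚₚ.+-mono-≤ le₁ le₂)) (ℚₚ.≤-reflexive (sym eq)))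

  -- Inequalities between reals bound their terms only up to every ε. The order of ℚ is decidable,
  -- so half of a supposed gap p - q refutes p > q.
  ≤-by-ε : ∀ {p q} → (∀ ε → 0ℚ < ε → p ≤ q + ε) → p ≤ q
  ≤-by-ε {p} {q} h with p ℚₚ.≤? q
  ... | yes p≤q = p≤q
  ... | no  p≰q = ⊥-elim (ℚₚ.<-irrefl refl (ℚₚ.<-≤-trans mid (h δ 0<δ)))
    where
    0<p-q : 0ℚ < p - q
    0<p-q = subst (_< p - q) (ℚₚ.+-inverseʳ q) (ℚₚ.+-monoˡ-< (- q) (ℚₚ.≰⇒> p≰q))
    δ = ½ * (p - q)
    0<δ = ½-pos 0<p-q
    mid : q + δ < p
    mid = subst₂ _<_ (ℚₚ.+-identityʳ (q + δ))
      (trans (ℚₚ.+-assoc q δ δ) (trans (cong (ℚ._+_ q) (halves (p - q)))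
        (solve 2 (λ p q → q :+ (p :- q) := p) refl p q)))
      (ℚₚ.+-monoʳ-< (q + δ) 0<δ)

  square-cancel-≤ : ∀ {p q} → 0ℚ ≤ q → p * p ≤ q * q → p ≤ q
  square-cancel-≤ {p} {q} 0≤q le with p ℚₚ.≤? q
  ... | yes p≤q = p≤q
  ... | no  p≰q = ⊥-elim (ℚₚ.<-irrefl refl (ℚₚ.<-≤-trans
      (ℚₚ.≤-<-trans (*-monoˡ q 0≤q (ℚₚ.<⇒≤ q<p))
        (ℚₚ.*-monoˡ-<-pos p {{ℚ.positive (ℚₚ.≤-<-trans 0≤q q<p)}} q<p)) le))
    where q<p = ℚₚ.≰⇒> p≰q

  square-mono-≤ : ∀ {p q} → 0ℚ ≤ p → p ≤ q → p * p ≤ q * q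
  square-mono-≤ 0≤p p≤q = *-mono 0≤p (ℚₚ.≤-trans 0≤p p≤q) p≤q p≤q

  ∣∣-square : ∀ p → ∣ p ∣ * ∣ p ∣ ≡ p * p
  ∣∣-square p with ℚₚ.∣p∣≡p∨∣p∣≡-p p
  ... | inj₁ eq = cong₂ _*_ eq eq
  ... | inj₂ eq = trans (cong₂ _*_ eq eq) (solve 1 (λ p → (:- p) :* (:- p) := p :* p) refl p)

  recip-inverse : ∀ {n} → 0 ℕ.< n → recip n * ι n ≡ 1ℚ
  recip-inverse {suc n} _ = ℚₚ.toℚᵘ-injective (ℚᵘₚ.≃-trans (ℚₚ.toℚᵘ-homo-* (+ 1 / suc n) (ι (suc n)))
    (ℚᵘₚ.≃-trans (ℚᵘₚ.*-cong (ℚₚ.toℚᵘ-fromℚᵘ (ℚᵘ.mkℚᵘ (+ 1) n)) (/1-≃ (+ suc n)))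
     (ℚᵘ.*≡* (trans (ℤₚ.*-identityʳ _) (trans (ℤₚ.*-identityˡ (+ suc n))
       (sym (trans (ℤₚ.*-identityˡ _) (cong +_ (ℕₚ.*-identityʳ (suc n))))))))))

  /-≡-* : ∀ i n → i / suc n ≡ i / 1 * recip (suc n)
  /-≡-* i n = ℚₚ.toℚᵘ-injective (ℚᵘₚ.≃-trans (ℚₚ.toℚᵘ-fromℚᵘ (ℚᵘ.mkℚᵘ i n))
    (ℚᵘₚ.≃-sym (ℚᵘₚ.≃-trans (ℚₚ.toℚᵘ-homo-* (i / 1) (recip (suc n)))
      (ℚᵘₚ.≃-trans (ℚᵘₚ.*-cong (/1-≃ i) (ℚₚ.toℚᵘ-fromℚᵘ (ℚᵘ.mkℚᵘ (+ 1) n)))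
        (ℚᵘ.*≡* (cong₂ ℤ._*_ (ℤₚ.*-identityʳ i) (cong +_ (sym (ℕₚ.+-identityʳ (suc n))))))))))

  recip-pos : ∀ {n} → 0 ℕ.< n → 0ℚ < recip n
  recip-pos {n} 0<n = ℚₚ.*-cancelʳ-<-nonNeg (ι n) {{ℚ.nonNegative (0≤ι n)}}
    (subst₂ _<_ (sym (ℚₚ.*-zeroˡ (ι n))) (sym (recip-inverse 0<n)) 0<1)

  recip-nonNeg : ∀ n → 0ℚ ≤ recip n
  recip-nonNeg zero    = ℚₚ.≤-refl
  recip-nonNeg (suc n) = ℚₚ.<⇒≤ (recip-pos {suc n} (s≤s z≤n))

  recip-* : ∀ m n → recip (m ℕ.* n) ≡ recip m * recip n
  recip-* zero    n       = sym (ℚₚ.*-zeroˡ (recip n))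
  recip-* (suc m) zero    = trans (cong recip (ℕₚ.*-zeroʳ m)) (sym (ℚₚ.*-zeroʳ (recip (suc m))))
  recip-* (suc m) (suc n) = *-cancelʳ-≡ (ι (suc m ℕ.* suc n)) (0<ι {suc m ℕ.* suc n} (s≤s z≤n)) (begin
    recip (suc m ℕ.* suc n) * ι (suc m ℕ.* suc n)  ≡⟨ recip-inverse {suc m ℕ.* suc n} (s≤s z≤n) ⟩
    1ℚ * 1ℚ                                        ≡⟨ sym (cong₂ _*_ (recip-inverse {suc m} (s≤s z≤n)) (recip-inverse {suc n} (s≤s z≤n))) ⟩
    recip (suc m) * ι (suc m) * (recip (suc n) * ι (suc n))
      ≡⟨ solve 4 (λ a b c d → a :* b :* (c :* d) := a :* c :* (b :* d)) refl (recip (suc m)) (ι (suc m)) (recip (suc n)) (ι (suc n)) ⟩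
    recip (suc m) * recip (suc n) * (ι (suc m) * ι (suc n))
      ≡⟨ cong (recip (suc m) * recip (suc n) *_) (sym (ι-* (suc m) (suc n))) ⟩
    recip (suc m) * recip (suc n) * ι (suc m ℕ.* suc n) ∎)
    where open ≡-Reasoning

  frac-≤ : ∀ {a b c} → 0 ℕ.< b → 0 ℕ.< c → a ℕ.* c ℕ.≤ b → ι a * recip b ≤ recip c
  frac-≤ {a} {b} {c} 0<b 0<c ac≤b = *-cancelʳ-≤ (ι b * ι c) (*-pos (0<ι 0<b) (0<ι 0<c)) (subst₂ _≤_ lhs rhs (ι-mono-≤ ac≤b))
    where
    lhs : ι (a ℕ.* c) ≡ ι a * recip b * (ι b * ι c)
    lhs = trans (ι-* a c) (sym (trans
      (solve 4 (λ a r b c → a :* r :* (b :* c) := a :* c :* (r :* b)) refl (ι a) (recip b) (ι b) (ι c))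
      (trans (cong (ι a * ι c *_) (recip-inverse 0<b)) (ℚₚ.*-identityʳ _))))
    rhs : ι b ≡ recip c * (ι b * ι c)
    rhs = sym (trans (solve 3 (λ r b c → r :* (b :* c) := b :* (r :* c)) refl (recip c) (ι b) (ι c))
      (trans (cong (ι b *_) (recip-inverse 0<c)) (ℚₚ.*-identityʳ _)))

  recip-anti-≤ : ∀ {m n} → 0 ℕ.< m → m ℕ.≤ n → recip n ≤ recip m
  recip-anti-≤ {m} {n} 0<m m≤n = subst (_≤ recip m) (ℚₚ.*-identityˡ (recip n))
    (frac-≤ {1} (ℕₚ.<-≤-trans 0<m m≤n) 0<m (subst (ℕ._≤ n) (sym (ℕₚ.+-identityʳ m)) m≤n))

  recip-≤-1 : ∀ n → recip n ≤ 1ℚ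
  recip-≤-1 zero    = ℚₚ.<⇒≤ 0<1
  recip-≤-1 (suc n) = recip-anti-≤ {1} {suc n} (s≤s z≤n) (s≤s z≤n)

  ι-unbounded : ∀ p → ∃[ n ] p ≤ ι n
  ι-unbounded p = bound (ℤ.suc (ℚ.floor p)) (floor-upper p)
    where
    bound : ∀ i → p ≤ i / 1 → ∃[ n ] p ≤ ι n
    bound (+ n)    le = n , le
    bound -[1+ n ] le = 0 , ℚₚ.≤-trans le (/1-mono { -[1+ n ]} {+ 0} ℤ.-≤+)

  archimedean : ∀ p {ε} → 0ℚ < ε → ∃[ n ] (0 ℕ.< n × p ≤ ι n * ε)
  archimedean p {ε} 0<ε = suc n , s≤s z≤n , subst (_≤ ι (suc n) * ε) eq
      (*-monoʳ ε (ℚₚ.<⇒≤ 0<ε) (ℚₚ.≤-trans h (ι-mono-≤ (ℕₚ.n≤1+n n))))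
    where
    instance nz = ℚ.>-nonZero 0<ε
    n = proj₁ (ι-unbounded (p * ℚ.1/ ε))
    h = proj₂ (ι-unbounded (p * ℚ.1/ ε))
    eq : p * ℚ.1/ ε * ε ≡ p
    eq = trans (ℚₚ.*-assoc p (ℚ.1/ ε) ε) (trans (cong (p *_) (ℚₚ.*-inverseˡ ε)) (ℚₚ.*-identityʳ p))

  archimedean-recip : ∀ p {ε} → 0ℚ < ε → ∃[ n ] (∀ k → n ℕ.≤ k → 0 ℕ.< k × p * recip k ≤ ε)
  archimedean-recip p {ε} 0<ε with archimedean p 0<ε
  ... | n , 0<n , le = n , λ k n≤k → let 0<k = ℕₚ.<-≤-trans 0<n n≤k in 0<k ,
    *-cancelʳ-≤ (ι k) (0<ι 0<k) (subst₂ _≤_ (eq k 0<k) (ℚₚ.*-comm (ι k) ε)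
      (ℚₚ.≤-trans le (*-monoʳ ε (ℚₚ.<⇒≤ 0<ε) (ι-mono-≤ n≤k))))
    where
    eq : ∀ k → 0 ℕ.< k → p ≡ p * recip k * ι k
    eq k 0<k = sym (trans (ℚₚ.*-assoc p (recip k) (ι k))
      (trans (cong (p *_) (recip-inverse 0<k)) (ℚₚ.*-identityʳ p)))

  Integral : ℚ → Set
  Integral p = ∃[ i ] p ≡ i / 1

  Integral-ι : ∀ n → Integral (ι n)
  Integral-ι n = + n , refl

  Integral-+ : ∀ {p q} → Integral p → Integral q → Integral (p + q)
  Integral-+ (i , refl) (j , refl) = i ℤ.+ j , sym (/1-distrib-+ i j)

  Integral-* : ∀ {p q} → Integral p → Integral q → Integral (p * q)
  Integral-* (i , refl) (j , refl) = i ℤ.* j , sym (/1-distrib-* i j)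

  Integral-neg : ∀ {p} → Integral p → Integral (- p)
  Integral-neg (i , refl) = ℤ.- i , sym (/1-distrib-neg i)

  Integral-∣∣≥1 : ∀ {p} → Integral p → p ≢ 0ℚ → 1ℚ ≤ ∣ p ∣
  Integral-∣∣≥1 {p} (+ zero , eq) p≢0 = contradiction eq p≢0
  Integral-∣∣≥1 {p} (+ suc n , refl) _ = ℚₚ.≤-trans (ι-mono-≤ {1} {suc n} (s≤s z≤n)) (≤∣∣ p)
  Integral-∣∣≥1 {p} (-[1+ n ] , refl) _ = ℚₚ.≤-trans (ι-mono-≤ {1} {suc n} (s≤s z≤n))
    (subst₂ _≤_ (sym (/1-distrib-neg -[1+ n ])) (ℚₚ.∣-p∣≡∣p∣ p) (≤∣∣ (- p)))

  -- Rationals are in lowest terms, so the test is whether the denominator is 1. It allows the case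
  -- distinction in `rational-value` without excluded middle.
  integral? : ∀ p → Dec (Integral p)
  integral? p with ↧ₙ p ℕₚ.≟ 1
  ... | yes eq = yes (↥ p , trans (sym (ℚₚ.↥p/↧p≡p p)) (ℚₚ./-cong {↥ p} {↧ₙ p} {↥ p} {1} refl eq))
  ... | no neq = no λ (i , eq) → neq (trans (cong ℚ.denominatorℕ (trans eq (/1-≡-mkℚ i))) refl)

  ↧-*-integral : ∀ p → Integral (ι (↧ₙ p) * p)
  ↧-*-integral p@(ℚ.mkℚ i n _) = i , (begin
    ι (suc n) * p                        ≡⟨ cong (ι (suc n) *_) (sym (ℚₚ.↥p/↧p≡p p)) ⟩
    ι (suc n) * (i / suc n)              ≡⟨ cong (ι (suc n) *_) (/-≡-* i n) ⟩
    ι (suc n) * (i / 1 * recip (suc n))  ≡⟨ solve 3 (λ a b c → a :* (b :* c) := b :* (c :* a)) refl (ι (suc n)) (i / 1) (recip (suc n)) ⟩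
    i / 1 * (recip (suc n) * ι (suc n))  ≡⟨ cong (i / 1 *_) (recip-inverse {suc n} (s≤s z≤n)) ⟩
    i / 1 * 1ℚ                           ≡⟨ ℚₚ.*-identityʳ (i / 1) ⟩
    i / 1 ∎)
    where open ≡-Reasoning

  Integral-∣ : ∀ {m n p} → m ℕ∣.∣ n → Integral (ι m * p) → Integral (ι n * p)
  Integral-∣ {m} {n} {p} (ℕ∣.divides k refl) int = subst Integral
    (trans (sym (ℚₚ.*-assoc (ι k) (ι m) p)) (cong (_* p) (sym (ι-* k m)))) (Integral-* (Integral-ι k) int)

-- Gaussian rationals, their ℓ¹ norm, and estimates for powers

module GaussianRationals where

  open Rationals
  open import Data.Rational.Base using (_+_; _*_; _-_; -_; _≤_; _<_; ∣_∣; _/_)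
  open RationalLemmas
  open +-*-Solver
  open Algebra.Properties.CommutativeSemiring.Exp (CommutativeRing.commutativeSemiring ℚₚ.+-*-commutativeRing) public
    using (_^_; ^-homo-*; ^-distrib-*)

  record ℚ[i] : Set where
    constructor ⟨_,_⟩
    field
      Re Im : ℚ

  open ℚ[i] public

  infixl 6 _⊕_ _⊖_
  infixl 7 _⊗_
  infixr 8 _⊛_

  _⊕_ _⊗_ _⊖_ : ℚ[i] → ℚ[i] → ℚ[i]
  z ⊕ w = ⟨ Re z + Re w , Im z + Im w ⟩
  z ⊗ w = ⟨ Re z * Re w - Im z * Im w , Re z * Im w + Im z * Re w ⟩
  z ⊖ w = ⟨ Re z - Re w , Im z - Im w ⟩

  ⊝_ : ℚ[i] → ℚ[i]
  ⊝ z = ⟨ - Re z , - Im z ⟩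

  real : ℚ → ℚ[i]
  real p = ⟨ p , 0ℚ ⟩

  _⊛_ : ℚ[i] → ℕ → ℚ[i]
  z ⊛ zero  = real 1ℚ
  z ⊛ suc n = z ⊗ z ⊛ n

  ℚ[i]-isCommutativeRing : IsCommutativeRing _≡_ _⊕_ _⊗_ ⊝_ (real 0ℚ) (real 1ℚ)
  ℚ[i]-isCommutativeRing = record
    { isRing = record
      { +-isAbelianGroup = record
        { isGroup = record
          { isMonoid = record
            { isSemigroup = record
              { isMagma = record { isEquivalence = isEquivalence ; ∙-cong = cong₂ _⊕_ }
              ; assoc = λ x y z → cong₂ ⟨_,_⟩ (ℚₚ.+-assoc (Re x) (Re y) (Re z)) (ℚₚ.+-assoc (Im x) (Im y) (Im z))
              }
            ; identity = (λ x → cong₂ ⟨_,_⟩ (ℚₚ.+-identityˡ (Re x)) (ℚₚ.+-identityˡ (Im x)))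
                       , (λ x → cong₂ ⟨_,_⟩ (ℚₚ.+-identityʳ (Re x)) (ℚₚ.+-identityʳ (Im x)))
            }
          ; inverse = (λ x → cong₂ ⟨_,_⟩ (ℚₚ.+-inverseˡ (Re x)) (ℚₚ.+-inverseˡ (Im x)))
                    , (λ x → cong₂ ⟨_,_⟩ (ℚₚ.+-inverseʳ (Re x)) (ℚₚ.+-inverseʳ (Im x)))
          ; ⁻¹-cong = cong ⊝_
          }
        ; comm = λ x y → cong₂ ⟨_,_⟩ (ℚₚ.+-comm (Re x) (Re y)) (ℚₚ.+-comm (Im x) (Im y))
        }
      ; *-cong = cong₂ _⊗_
      ; *-assoc = λ x y z → cong₂ ⟨_,_⟩
          (solve 6 (λ a b c d e f → (a :* c :- b :* d) :* e :- (a :* d :+ b :* c) :* f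
            := a :* (c :* e :- d :* f) :- b :* (c :* f :+ d :* e)) refl (Re x) (Im x) (Re y) (Im y) (Re z) (Im z))
          (solve 6 (λ a b c d e f → (a :* c :- b :* d) :* f :+ (a :* d :+ b :* c) :* e
            := a :* (c :* f :+ d :* e) :+ b :* (c :* e :- d :* f)) refl (Re x) (Im x) (Re y) (Im y) (Re z) (Im z))
      ; *-identity = (λ x → cong₂ ⟨_,_⟩
            (solve 2 (λ a b → con 1ℚ :* a :- con 0ℚ :* b := a) refl (Re x) (Im x))
            (solve 2 (λ a b → con 1ℚ :* b :+ con 0ℚ :* a := b) refl (Re x) (Im x)))
          , (λ x → cong₂ ⟨_,_⟩
            (solve 2 (λ a b → a :* con 1ℚ :- b :* con 0ℚ := a) refl (Re x) (Im x))
            (solve 2 (λ a b → a :* con 0ℚ :+ b :* con 1ℚ := b) refl (Re x) (Im x)))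
      ; distrib = (λ x y z → cong₂ ⟨_,_⟩
            (solve 6 (λ a b c d e f → a :* (c :+ e) :- b :* (d :+ f)
              := (a :* c :- b :* d) :+ (a :* e :- b :* f)) refl (Re x) (Im x) (Re y) (Im y) (Re z) (Im z))
            (solve 6 (λ a b c d e f → a :* (d :+ f) :+ b :* (c :+ e)
              := (a :* d :+ b :* c) :+ (a :* f :+ b :* e)) refl (Re x) (Im x) (Re y) (Im y) (Re z) (Im z)))
          , (λ x y z → cong₂ ⟨_,_⟩
            (solve 6 (λ a b c d e f → (c :+ e) :* a :- (d :+ f) :* b
              := (c :* a :- d :* b) :+ (e :* a :- f :* b)) refl (Re x) (Im x) (Re y) (Im y) (Re z) (Im z))
            (solve 6 (λ a b c d e f → (c :+ e) :* b :+ (d :+ f) :* a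
              := (c :* b :+ d :* a) :+ (e :* b :+ f :* a)) refl (Re x) (Im x) (Re y) (Im y) (Re z) (Im z)))
      }
    ; *-comm = λ x y → cong₂ ⟨_,_⟩
        (solve 4 (λ a b c d → a :* c :- b :* d := c :* a :- d :* b) refl (Re x) (Im x) (Re y) (Im y))
        (solve 4 (λ a b c d → a :* d :+ b :* c := c :* b :+ d :* a) refl (Re x) (Im x) (Re y) (Im y))
    }

  ℚ[i]-commutativeRing : CommutativeRing 0ℓ 0ℓ
  ℚ[i]-commutativeRing = record { isCommutativeRing = ℚ[i]-isCommutativeRing }

  _≟_ : (z w : ℚ[i]) → Dec (z ≡ w)
  z ≟ w = map′ (λ (p , q) → cong₂ ⟨_,_⟩ p q) (λ eq → cong Re eq , cong Im eq)
    (Re z ℚₚ.≟ Re w ×-dec Im z ℚₚ.≟ Im w)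

  module ℚ[i]-Solver = Algebra.Solver.Ring.Simple (ACR.fromCommutativeRing ℚ[i]-commutativeRing) _≟_

  -- The ℓ¹ norm, submultiplicative and, unlike the modulus, rational.
  ‖_‖₁ : ℚ[i] → ℚ
  ‖ z ‖₁ = ∣ Re z ∣ + ∣ Im z ∣

  modulus² : ℚ[i] → ℚ
  modulus² z = Re z * Re z + Im z * Im z

  0≤‖‖ : ∀ z → 0ℚ ≤ ‖ z ‖₁
  0≤‖‖ z = +-nonNeg (ℚₚ.0≤∣p∣ (Re z)) (ℚₚ.0≤∣p∣ (Im z))

  ‖real‖ : ∀ p → ‖ real p ‖₁ ≡ ∣ p ∣
  ‖real‖ p = ℚₚ.+-identityʳ ∣ p ∣

  ∣Re∣≤‖‖ : ∀ z → ∣ Re z ∣ ≤ ‖ z ‖₁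
  ∣Re∣≤‖‖ z = ≤-by-slack (ℚₚ.0≤∣p∣ (Im z)) refl

  ∣Im∣≤‖‖ : ∀ z → ∣ Im z ∣ ≤ ‖ z ‖₁
  ∣Im∣≤‖‖ z = ≤-by-slack (ℚₚ.0≤∣p∣ (Re z)) (ℚₚ.+-comm ∣ Re z ∣ ∣ Im z ∣)

  ‖⊕‖ : ∀ z w → ‖ z ⊕ w ‖₁ ≤ ‖ z ‖₁ + ‖ w ‖₁
  ‖⊕‖ z w = ℚₚ.≤-trans (ℚₚ.+-mono-≤ (ℚₚ.∣p+q∣≤∣p∣+∣q∣ (Re z) (Re w)) (ℚₚ.∣p+q∣≤∣p∣+∣q∣ (Im z) (Im w)))
    (ℚₚ.≤-reflexive (solve 4 (λ a b c d → (a :+ c) :+ (b :+ d) := (a :+ b) :+ (c :+ d)) refl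
      (∣ Re z ∣) (∣ Im z ∣) (∣ Re w ∣) (∣ Im w ∣)))

  ‖⊗‖ : ∀ z w → ‖ z ⊗ w ‖₁ ≤ ‖ z ‖₁ * ‖ w ‖₁
  ‖⊗‖ z w = ℚₚ.≤-trans (ℚₚ.+-mono-≤
      (ℚₚ.≤-trans (ℚₚ.∣p-q∣≤∣p∣+∣q∣ (Re z * Re w) (Im z * Im w)) (ℚₚ.≤-reflexive (cong₂ _+_ (abs* (Re z) (Re w)) (abs* (Im z) (Im w)))))
      (ℚₚ.≤-trans (ℚₚ.∣p+q∣≤∣p∣+∣q∣ (Re z * Im w) (Im z * Re w)) (ℚₚ.≤-reflexive (cong₂ _+_ (abs* (Re z) (Im w)) (abs* (Im z) (Re w))))))
    (ℚₚ.≤-reflexive (solve 4 (λ a b c d → (a :* c :+ b :* d) :+ (a :* d :+ b :* c) := (a :+ b) :* (c :+ d)) refl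
      (∣ Re z ∣) (∣ Im z ∣) (∣ Re w ∣) (∣ Im w ∣)))
    where abs* = ℚₚ.∣p*q∣≡∣p∣*∣q∣

  ‖⊗‖-≤ : ∀ {z w p q} → ‖ z ‖₁ ≤ p → ‖ w ‖₁ ≤ q → ‖ z ⊗ w ‖₁ ≤ p * q
  ‖⊗‖-≤ {z} {w} z≤p w≤q = ℚₚ.≤-trans (‖⊗‖ z w) (*-mono (0≤‖‖ w) (ℚₚ.≤-trans (0≤‖‖ z) z≤p) z≤p w≤q)

  ‖⊕‖-≤ : ∀ {z w p q} → ‖ z ‖₁ ≤ p → ‖ w ‖₁ ≤ q → ‖ z ⊕ w ‖₁ ≤ p + q
  ‖⊕‖-≤ {z} {w} z≤p w≤q = ℚₚ.≤-trans (‖⊕‖ z w) (ℚₚ.+-mono-≤ z≤p w≤q)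

  ‖⊖‖-sym : ∀ z w → ‖ z ⊖ w ‖₁ ≡ ‖ w ⊖ z ‖₁
  ‖⊖‖-sym z w = cong₂ _+_ (d-sym (Re z) (Re w)) (d-sym (Im z) (Im w))

  ‖⊖‖-triangle : ∀ x y z → ‖ x ⊖ z ‖₁ ≤ ‖ x ⊖ y ‖₁ + ‖ y ⊖ z ‖₁
  ‖⊖‖-triangle x y z = subst (λ t → ‖ t ‖₁ ≤ ‖ x ⊖ y ‖₁ + ‖ y ⊖ z ‖₁)
    (cong₂ ⟨_,_⟩ (eq (Re x) (Re y) (Re z)) (eq (Im x) (Im y) (Im z))) (‖⊕‖ (x ⊖ y) (y ⊖ z))
    where eq = solve 3 (λ x y z → (x :- y) :+ (y :- z) := x :- z) refl

  modulus²≤‖‖² : ∀ z → modulus² z ≤ ‖ z ‖₁ * ‖ z ‖₁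
  modulus²≤‖‖² z = ≤-by-slack {r = p * q + p * q} (+-nonNeg 0≤pq 0≤pq) (trans
    (solve 2 (λ p q → (p :+ q) :* (p :+ q) := (p :* p :+ q :* q) :+ (p :* q :+ p :* q)) refl p q)
    (cong (ℚ._+ (p * q + p * q)) (cong₂ _+_ (∣∣-square (Re z)) (∣∣-square (Im z)))))
    where
    p = ∣ Re z ∣
    q = ∣ Im z ∣
    0≤pq = *-nonNeg (ℚₚ.0≤∣p∣ (Re z)) (ℚₚ.0≤∣p∣ (Im z))

  square-nonNeg : ∀ p → 0ℚ ≤ p * p
  square-nonNeg p = subst (0ℚ ≤_) (∣∣-square p) (*-nonNeg (ℚₚ.0≤∣p∣ p) (ℚₚ.0≤∣p∣ p))

  -- The slack is the square of |Re z| - |Im z|. Together with `modulus²≤‖‖²` this links the ℓ¹ norm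
  -- with the squared modulus in the definition of the derivative.
  ‖‖²≤2modulus² : ∀ z → ‖ z ‖₁ * ‖ z ‖₁ ≤ ι 2 * modulus² z
  ‖‖²≤2modulus² z = ≤-by-slack {r = (p - q) * (p - q)} (square-nonNeg (p - q)) (trans
    (cong (ι 2 *_) (sym (cong₂ _+_ (∣∣-square (Re z)) (∣∣-square (Im z)))))
    (solve 2 (λ p q → con (ι 2) :* (p :* p :+ q :* q) := (p :+ q) :* (p :+ q) :+ (p :- q) :* (p :- q)) refl p q))
    where
    p = ∣ Re z ∣
    q = ∣ Im z ∣

  psum : (ℕ → ℚ) → ℕ → ℚ[i] → ℚ[i]
  psum a zero    z = real 0ℚ
  psum a (suc n) z = psum a n z ⊕ real (a n) ⊗ z ⊛ n

  psumℚ : (ℕ → ℚ) → ℕ → ℚ → ℚ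
  psumℚ a zero    x = 0ℚ
  psumℚ a (suc n) x = psumℚ a n x + a n * x ^ n

  ⊛-real : ∀ x n → real x ⊛ n ≡ real (x ^ n)
  ⊛-real x zero    = refl
  ⊛-real x (suc n) = trans (cong (real x ⊗_) (⊛-real x n)) (cong₂ ⟨_,_⟩
    (solve 2 (λ x y → x :* y :- con 0ℚ :* con 0ℚ := x :* y) refl x (x ^ n))
    (solve 2 (λ x y → x :* con 0ℚ :+ con 0ℚ :* y := con 0ℚ) refl x (x ^ n)))

  psum-real : ∀ a n x → psum a n (real x) ≡ real (psumℚ a n x)
  psum-real a zero    x = refl
  psum-real a (suc n) x = trans (cong₂ (λ s t → s ⊕ real (a n) ⊗ t) (psum-real a n x) (⊛-real x n)) (cong₂ ⟨_,_⟩
    (solve 3 (λ s a y → s :+ (a :* y :- con 0ℚ :* con 0ℚ) := s :+ a :* y) refl (psumℚ a n x) (a n) (x ^ n))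
    (solve 2 (λ a y → con 0ℚ :+ (a :* con 0ℚ :+ con 0ℚ :* y) := con 0ℚ) refl (a n) (x ^ n)))

  -- The derivative of the n-th power, given by the product rule so that the induction in `⊛-taylor`
  -- is a ring identity; `⊛-deriv-suc` recovers the closed form.
  ⊛-deriv : ℚ[i] → ℕ → ℚ[i]
  ⊛-deriv z zero    = real 0ℚ
  ⊛-deriv z (suc n) = z ⊗ ⊛-deriv z n ⊕ z ⊛ n

  deriv : (ℕ → ℚ) → ℕ → ℚ
  deriv a n = ι (suc n) * a (suc n)

  ⊛-deriv-suc : ∀ z n → ⊛-deriv z (suc n) ≡ real (ι (suc n)) ⊗ z ⊛ n
  ⊛-deriv-suc z zero    = ℚ[i]S.solve 1 (λ z → z ℚ[i]S.:* ℚ[i]S.con (real 0ℚ) ℚ[i]S.:+ ℚ[i]S.con (real 1ℚ)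
    ℚ[i]S.:= ℚ[i]S.con (real (ι 1)) ℚ[i]S.:* ℚ[i]S.con (real 1ℚ)) refl z
    where module ℚ[i]S = ℚ[i]-Solver
  ⊛-deriv-suc z (suc n) = trans (cong (λ t → z ⊗ t ⊕ z ⊛ suc n) (⊛-deriv-suc z n))
    (trans (S.solve 3 (λ z w k → z S.:* (k S.:* w) S.:+ z S.:* w S.:= (S.con (real 1ℚ) S.:+ k) S.:* (z S.:* w)) refl
      z (z ⊛ n) (real (ι (suc n))))
      (cong (λ t → ⟨ t , 0ℚ ⟩ ⊗ z ⊛ suc n) (sym (ι-suc (suc n)))))
    where module S = ℚ[i]-Solver

  0≤^ : ∀ {p} n → 0ℚ ≤ p → 0ℚ ≤ p ^ n
  0≤^ zero    0≤p = ℚₚ.<⇒≤ 0<1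
  0≤^ (suc n) 0≤p = *-nonNeg 0≤p (0≤^ n 0≤p)

  0<^ : ∀ {p} n → 0ℚ < p → 0ℚ < p ^ n
  0<^ zero    0<p = 0<1
  0<^ (suc n) 0<p = *-pos 0<p (0<^ n 0<p)

  ^-mono-≤ : ∀ {p q} n → 0ℚ ≤ p → p ≤ q → p ^ n ≤ q ^ n
  ^-mono-≤ zero    0≤p p≤q = ℚₚ.≤-refl
  ^-mono-≤ (suc n) 0≤p p≤q = *-mono (0≤^ n 0≤p) (ℚₚ.≤-trans 0≤p p≤q) p≤q (^-mono-≤ n 0≤p p≤q)

  ι-^ : ∀ m n → ι (m ℕ.^ n) ≡ ι m ^ n
  ι-^ m zero    = refl
  ι-^ m (suc n) = trans (ι-* m (m ℕ.^ n)) (cong (ι m *_) (ι-^ m n))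

  recip-^ : ∀ m n → recip (m ℕ.^ n) ≡ recip m ^ n
  recip-^ m zero    = refl
  recip-^ m (suc n) = trans (recip-* m (m ℕ.^ n)) (cong (recip m *_) (recip-^ m n))

  ∣∣-^ : ∀ p n → ∣ p ^ n ∣ ≡ ∣ p ∣ ^ n
  ∣∣-^ p zero    = refl
  ∣∣-^ p (suc n) = trans (ℚₚ.∣p*q∣≡∣p∣*∣q∣ p (p ^ n)) (cong (∣ p ∣ *_) (∣∣-^ p n))

  0≤½ : 0ℚ ≤ ½
  0≤½ = ℚₚ.nonNegative⁻¹ ½

  -- X(2 - 2·2⁻ⁿ) bounds the n-th partial sum of a series dominated by X 2⁻ⁱ.
  geometric : ℚ → ℕ → ℚ
  geometric X n = ι 2 * X - ι 2 * (X * ½ ^ n)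

  geometric-step : ∀ X n → geometric X n + X * ½ ^ n ≡ geometric X (suc n)
  geometric-step X n = solve 2 (λ X h → con (ι 2) :* X :- con (ι 2) :* (X :* h) :+ X :* h
    := con (ι 2) :* X :- con (ι 2) :* (X :* (con ½ :* h))) refl X (½ ^ n)

  geometric-≤ : ∀ {X} n → 0ℚ ≤ X → geometric X n ≤ ι 2 * X
  geometric-≤ {X} n 0≤X = ≤-by-slack {r = ι 2 * (X * ½ ^ n)} (*-nonNeg (0≤ι 2) (*-nonNeg 0≤X (0≤^ n 0≤½)))
    (solve 2 (λ a b → a := (a :- b) :+ b) refl (ι 2 * X) (ι 2 * (X * ½ ^ n)))

  geometric-0 : ∀ X → geometric X 0 ≡ 0ℚ
  geometric-0 X = solve 1 (λ X → con (ι 2) :* X :- con (ι 2) :* (X :* con 1ℚ) := con 0ℚ) refl X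

  -- Stated for any sequence with given increments, so that one summation serves tails, Lipschitz
  -- differences and Taylor remainders alike.
  series-bound : ∀ (u : ℕ → ℚ[i]) (t : ℕ → ℚ[i]) {X} → 0ℚ ≤ X → u 0 ≡ real 0ℚ →
    (∀ n → u (suc n) ≡ u n ⊕ t n) → (∀ n → ‖ t n ‖₁ ≤ X * ½ ^ n) → ∀ n → ‖ u n ‖₁ ≤ ι 2 * X
  series-bound u t {X} 0≤X u0 us ts n = ℚₚ.≤-trans (bound n) (geometric-≤ n 0≤X)
    where
    bound : ∀ n → ‖ u n ‖₁ ≤ geometric X n
    bound zero    = ℚₚ.≤-reflexive (trans (cong ‖_‖₁ u0) (sym (geometric-0 X)))
    bound (suc n) = subst₂ _≤_ (cong ‖_‖₁ (sym (us n))) (geometric-step X n) (‖⊕‖-≤ {u n} {t n} (bound n) (ts n))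

  ‖⊛‖-≤ : ∀ {z R} n → ‖ z ‖₁ ≤ R → ‖ z ⊛ n ‖₁ ≤ R ^ n
  ‖⊛‖-≤ zero    z≤R = ℚₚ.≤-refl
  ‖⊛‖-≤ {z} (suc n) z≤R = ‖⊗‖-≤ {z} {z ⊛ n} z≤R (‖⊛‖-≤ n z≤R)

  module _ {z w : ℚ[i]} {R : ℚ} (1≤R : 1ℚ ≤ R) (z≤R : ‖ z ‖₁ ≤ R) (w≤R : ‖ w ‖₁ ≤ R) where
    private
      0≤R : 0ℚ ≤ R
      0≤R = ℚₚ.≤-trans (ℚₚ.<⇒≤ 0<1) 1≤R
      R≤2R : R ≤ ι 2 * R
      R≤2R = ≤-by-slack 0≤R (solve 1 (λ r → con (ι 2) :* r := r :+ r) refl R)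
      0≤2R : 0ℚ ≤ ι 2 * R
      0≤2R = ℚₚ.≤-trans 0≤R R≤2R
      2R≤4R : ι 2 * R ≤ ι 4 * R
      2R≤4R = ≤-by-slack 0≤2R (solve 1 (λ r → con (ι 4) :* r := con (ι 2) :* r :+ con (ι 2) :* r) refl R)
      0≤4R : 0ℚ ≤ ι 4 * R
      0≤4R = ℚₚ.≤-trans 0≤2R 2R≤4R

    -- Uses w^(n+1) - z^(n+1) = w (w^n - z^n) + (w - z) z^n. The sharp constant n R^(n-1) is relaxed
    -- to (2R)^n: a pure power is absorbed by enlarging the radius in `Decay`.
    ⊛-lipschitz : ∀ n → ‖ w ⊛ n ⊖ z ⊛ n ‖₁ ≤ (ι 2 * R) ^ n * ‖ w ⊖ z ‖₁
    ⊛-lipschitz zero    = subst (0ℚ ≤_) (sym (ℚₚ.*-identityˡ ‖ w ⊖ z ‖₁)) (0≤‖‖ (w ⊖ z))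
    ⊛-lipschitz (suc n) = subst (λ t → ‖ t ‖₁ ≤ (ι 2 * R) ^ suc n * d) eq (ℚₚ.≤-trans
      (‖⊕‖-≤ {w ⊗ (w ⊛ n ⊖ z ⊛ n)} {(w ⊖ z) ⊗ z ⊛ n}
        (‖⊗‖-≤ {w} {w ⊛ n ⊖ z ⊛ n} w≤R (⊛-lipschitz n))
        (‖⊗‖-≤ {w ⊖ z} {z ⊛ n} ℚₚ.≤-refl (ℚₚ.≤-trans (‖⊛‖-≤ n z≤R) (^-mono-≤ n 0≤R R≤2R))))
      (≤-by-slack {r = (R - 1ℚ) * (D * d)}
        (*-nonNeg (subst (_≤ R - 1ℚ) (ℚₚ.+-inverseʳ 1ℚ) (ℚₚ.+-monoˡ-≤ (- 1ℚ) 1≤R)) (*-nonNeg (0≤^ n 0≤2R) (0≤‖‖ (w ⊖ z))))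
        (solve 3 (λ R D d → con (ι 2) :* R :* D :* d := R :* (D :* d) :+ d :* D :+ (R :- con 1ℚ) :* (D :* d)) refl R D d)))
      where
      d = ‖ w ⊖ z ‖₁
      D = (ι 2 * R) ^ n
      module S = ℚ[i]-Solver
      eq : w ⊗ (w ⊛ n ⊖ z ⊛ n) ⊕ (w ⊖ z) ⊗ z ⊛ n ≡ w ⊗ w ⊛ n ⊖ z ⊗ z ⊛ n
      eq = S.solve 4 (λ w z W Z → w S.:* (W S.:- Z) S.:+ (w S.:- z) S.:* Z S.:= w S.:* W S.:- z S.:* Z) refl
        w z (w ⊛ n) (z ⊛ n)

    -- If E is the remainder for n, that for n+1 is z E + (w - z)(w^n - z^n). The two summands cost
    -- R (4R)^n and, by `⊛-lipschitz`, at most (4R)^n, and R + 1 ≤ 4R because R ≥ 1.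
    ⊛-taylor : ∀ n → ‖ w ⊛ n ⊖ z ⊛ n ⊖ ⊛-deriv z n ⊗ (w ⊖ z) ‖₁ ≤ (ι 4 * R) ^ n * (‖ w ⊖ z ‖₁ * ‖ w ⊖ z ‖₁)
    ⊛-taylor zero    = subst₂ _≤_ (cong ‖_‖₁ (sym eq)) (sym (ℚₚ.*-identityˡ (d * d))) (*-nonNeg (0≤‖‖ (w ⊖ z)) (0≤‖‖ (w ⊖ z)))
      where
      d = ‖ w ⊖ z ‖₁
      module S = ℚ[i]-Solver
      eq : real 1ℚ ⊖ real 1ℚ ⊖ real 0ℚ ⊗ (w ⊖ z) ≡ real 0ℚ
      eq = S.solve 1 (λ h → S.con (real 1ℚ) S.:- S.con (real 1ℚ) S.:- S.con (real 0ℚ) S.:* h S.:= S.con (real 0ℚ)) refl (w ⊖ z)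
    ⊛-taylor (suc n) = subst (λ t → ‖ t ‖₁ ≤ (ι 4 * R) ^ suc n * (d * d)) eq (ℚₚ.≤-trans
      (‖⊕‖-≤ {z ⊗ E} {(w ⊖ z) ⊗ (w ⊛ n ⊖ z ⊛ n)}
        (‖⊗‖-≤ {z} {E} z≤R (⊛-taylor n))
        (‖⊗‖-≤ {w ⊖ z} {w ⊛ n ⊖ z ⊛ n} ℚₚ.≤-refl (ℚₚ.≤-trans (⊛-lipschitz n) (*-monoʳ d (0≤‖‖ (w ⊖ z)) (^-mono-≤ n 0≤2R 2R≤4R)))))
      (≤-by-slack {r = (ι 3 * R - 1ℚ) * (D * (d * d))}
        (*-nonNeg 0≤3R-1 (*-nonNeg (0≤^ n 0≤4R) (*-nonNeg (0≤‖‖ (w ⊖ z)) (0≤‖‖ (w ⊖ z)))))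
        (solve 3 (λ R D d → con (ι 4) :* R :* D :* (d :* d) := R :* (D :* (d :* d)) :+ d :* (D :* d)
          :+ (con (ι 3) :* R :- con 1ℚ) :* (D :* (d :* d))) refl R D d)))
      where
      d = ‖ w ⊖ z ‖₁
      D = (ι 4 * R) ^ n
      E = w ⊛ n ⊖ z ⊛ n ⊖ ⊛-deriv z n ⊗ (w ⊖ z)
      0≤3R-1 : 0ℚ ≤ ι 3 * R - 1ℚ
      0≤3R-1 = combine-≤ 1≤R (*-monoˡ (ι 2) (0≤ι 2) 0≤R)
        (solve 1 (λ R → (con (ι 3) :* R :- con 1ℚ) :+ (con 1ℚ :+ con (ι 2) :* con 0ℚ) := con 0ℚ :+ (R :+ con (ι 2) :* R)) refl R)
      module S = ℚ[i]-Solver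
      eq : z ⊗ E ⊕ (w ⊖ z) ⊗ (w ⊛ n ⊖ z ⊛ n) ≡ w ⊗ w ⊛ n ⊖ z ⊗ z ⊛ n ⊖ (z ⊗ ⊛-deriv z n ⊕ z ⊛ n) ⊗ (w ⊖ z)
      eq = S.solve 5 (λ w z W Z T → z S.:* (W S.:- Z S.:- T S.:* (w S.:- z)) S.:+ (w S.:- z) S.:* (W S.:- Z)
        S.:= w S.:* W S.:- z S.:* Z S.:- (z S.:* T S.:+ Z) S.:* (w S.:- z)) refl
        w z (w ⊛ n) (z ⊛ n) (⊛-deriv z n)

-- Uniform estimates for partial sums of everywhere convergent series

module PowerSeries where

  open Rationals
  open GaussianRationals
  open import Data.Rational.Base using (_+_; _*_; _-_; -_; _≤_; _<_; ∣_∣; _/_)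
  open RationalLemmas
  open +-*-Solver

  -- Infinite radius of convergence as a bound on single terms; passing from `R` to 2R yields
  -- geometric decay and hence summability.
  Decay : (ℕ → ℚ) → Set
  Decay a = ∀ (R : ℕ) → ∃[ C ] ∀ j → ∣ a j ∣ * ι R ^ j ≤ ι C

  n≤2^n : ∀ n → n ℕ.≤ 2 ℕ.^ n
  n≤2^n zero    = z≤n
  n≤2^n (suc n) = ℕₚ.+-mono-≤ (ℕₚ.m^n>0 2 n) (ℕₚ.≤-trans (n≤2^n n) (ℕₚ.≤-reflexive (sym (ℕₚ.+-identityʳ _))))

  abstract
    -- The new factor j+1 is at most 2^(j+1), so doubling the radius absorbs it. Using R+1 in place
    -- of R gives R^j ≤ (R+1)^(j+1) also for R = 0.
    decay-deriv : ∀ a → Decay a → Decay (deriv a)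
    decay-deriv a decay R = let C , h = decay (2 ℕ.* suc R) in C , λ j → ℚₚ.≤-trans
      (subst₂ _≤_
        (cong (_* ι R ^ j) (sym (trans (ℚₚ.∣p*q∣≡∣p∣*∣q∣ (ι (suc j)) (a (suc j)))
          (cong (_* ∣ a (suc j) ∣) (ℚₚ.0≤p⇒∣p∣≡p (0≤ι (suc j)))))))
        (trans (solve 3 (λ p a q → p :* a :* q := a :* (p :* q)) refl (ι 2 ^ suc j) (∣ a (suc j) ∣) (ι (suc R) ^ suc j))
          (cong (∣ a (suc j) ∣ *_) (trans (sym (^-distrib-* (ι 2) (ι (suc R)) (suc j))) (cong (_^ suc j) (sym (ι-* 2 (suc R)))))))
        (*-mono (0≤^ j (0≤ι R)) (*-nonNeg (0≤^ (suc j) (0≤ι 2)) (ℚₚ.0≤∣p∣ (a (suc j))))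
          (*-monoʳ (∣ a (suc j) ∣) (ℚₚ.0≤∣p∣ (a (suc j)))
            (subst (ι (suc j) ≤_) (ι-^ 2 (suc j)) (ι-mono-≤ (n≤2^n (suc j)))))
          (subst₂ _≤_ (ℚₚ.*-identityˡ (ι R ^ j)) refl
            (*-mono (0≤^ j (0≤ι R)) (0≤ι (suc R)) (ι-mono-≤ {1} {suc R} (s≤s z≤n))
              (^-mono-≤ j (0≤ι R) (ι-mono-≤ (ℕₚ.n≤1+n R)))))))
      (h (suc j))

  ½^*2^ : ∀ j → ½ ^ j * ι 2 ^ j ≡ 1ℚ
  ½^*2^ zero    = refl
  ½^*2^ (suc j) = trans (solve 2 (λ h p → con ½ :* h :* (con (ι 2) :* p) := h :* p) refl (½ ^ j) (ι 2 ^ j)) (½^*2^ j)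

  ½^≡recip : ∀ j → ½ ^ j ≡ recip (2 ℕ.^ j)
  ½^≡recip j = sym (recip-^ 2 j)

  decay-geometric : ∀ a → Decay a → ∀ R → ∃[ C ] ∀ j → ∣ a j ∣ * ι R ^ j ≤ ι C * ½ ^ j
  decay-geometric a decay R = let C , h = decay (2 ℕ.* R) in C , λ j →
    subst (_≤ ι C * ½ ^ j) (trans
      (cong (λ t → ∣ a j ∣ * t * ½ ^ j) (trans (cong (_^ j) (ι-* 2 R)) (^-distrib-* (ι 2) (ι R) j)))
      (trans (solve 4 (λ a p r h → a :* (p :* r) :* h := a :* r :* (h :* p)) refl (∣ a j ∣) (ι 2 ^ j) (ι R ^ j) (½ ^ j))
        (trans (cong (∣ a j ∣ * ι R ^ j *_) (½^*2^ j)) (ℚₚ.*-identityʳ _))))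
      (*-monoʳ (½ ^ j) (0≤^ j 0≤½) (h j))

  ‖real⊗‖-≤ : ∀ p {z q} → ‖ z ‖₁ ≤ q → ‖ real p ⊗ z ‖₁ ≤ ∣ p ∣ * q
  ‖real⊗‖-≤ p {z} z≤q = ‖⊗‖-≤ {real p} {z} (ℚₚ.≤-reflexive (‖real‖ p)) z≤q

  psum-tail : ∀ a m {z R X} → ‖ z ‖₁ ≤ R → 0ℚ ≤ X → (∀ i → ∣ a (i ℕ.+ m) ∣ * R ^ (i ℕ.+ m) ≤ X * ½ ^ i) →
    ∀ k → ‖ psum a (k ℕ.+ m) z ⊖ psum a m z ‖₁ ≤ ι 2 * X
  psum-tail a m {z} {R} {X} z≤R 0≤X h = series-bound (λ k → psum a (k ℕ.+ m) z ⊖ psum a m z)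
    (λ k → real (a (k ℕ.+ m)) ⊗ z ⊛ (k ℕ.+ m)) 0≤X
    (S.solve 1 (λ s → s S.:- s S.:= S.con (real 0ℚ)) refl (psum a m z))
    (λ k → S.solve 3 (λ s t u → s S.:+ t S.:- u S.:= s S.:- u S.:+ t) refl
      (psum a (k ℕ.+ m) z) (real (a (k ℕ.+ m)) ⊗ z ⊛ (k ℕ.+ m)) (psum a m z))
    (λ k → ℚₚ.≤-trans (‖real⊗‖-≤ (a (k ℕ.+ m)) {z ⊛ (k ℕ.+ m)} (‖⊛‖-≤ (k ℕ.+ m) z≤R)) (h k))
    where module S = ℚ[i]-Solver

  psum-deriv : (ℕ → ℚ) → ℕ → ℚ[i] → ℚ[i]
  psum-deriv a zero    z = real 0ℚ
  psum-deriv a (suc n) z = psum-deriv a n z ⊕ real (a n) ⊗ ⊛-deriv z n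

  -- The constant term drops out, so n terms leave `pred n` terms of the derivative. The truncation
  -- at `n ∸ s` in `series-value` matches this shift.
  psum-deriv-≡ : ∀ a n z → psum-deriv a n z ≡ psum (deriv a) (ℕ.pred n) z
  psum-deriv-≡ a zero          z = refl
  psum-deriv-≡ a (suc zero)    z = S.solve 1 (λ c → S.con (real 0ℚ) S.:+ c S.:* S.con (real 0ℚ) S.:= S.con (real 0ℚ)) refl (real (a 0))
    where module S = ℚ[i]-Solver
  psum-deriv-≡ a (suc (suc n)) z = cong₂ _⊕_ (psum-deriv-≡ a (suc n) z) (begin
    real (a (suc n)) ⊗ ⊛-deriv z (suc n)            ≡⟨ cong (real (a (suc n)) ⊗_) (⊛-deriv-suc z n) ⟩
    real (a (suc n)) ⊗ (real (ι (suc n)) ⊗ z ⊛ n)   ≡⟨ S.solve 3 (λ c k w → c S.:* (k S.:* w) S.:= k S.:* c S.:* w) refl (real (a (suc n))) (real (ι (suc n))) (z ⊛ n) ⟩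
    real (ι (suc n)) ⊗ real (a (suc n)) ⊗ z ⊛ n     ≡⟨ cong (_⊗ z ⊛ n) (cong₂ ⟨_,_⟩
      (solve 2 (λ k c → k :* c :- con 0ℚ :* con 0ℚ := k :* c) refl (ι (suc n)) (a (suc n)))
      (solve 2 (λ k c → k :* con 0ℚ :+ con 0ℚ :* c := con 0ℚ) refl (ι (suc n)) (a (suc n)))) ⟩
    real (deriv a n) ⊗ z ⊛ n ∎)
    where
    open ≡-Reasoning
    module S = ℚ[i]-Solver

  -- One constant serves all truncations and all points of the ball, so the estimates survive the
  -- diagonal limit, where the number of terms and the point vary together.
  record UniformEstimates (a : ℕ → ℚ) (R C : ℚ) : Set where
    field
      cauchy    : ∀ {m n z} → m ℕ.≤ n → ‖ z ‖₁ ≤ R → ‖ psum a n z ⊖ psum a m z ‖₁ ≤ C * ½ ^ m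
      lipschitz : ∀ n {z w} → ‖ z ‖₁ ≤ R → ‖ w ‖₁ ≤ R → ‖ psum a n w ⊖ psum a n z ‖₁ ≤ C * ‖ w ⊖ z ‖₁
      taylor    : ∀ n {z w} → ‖ z ‖₁ ≤ R → ‖ w ‖₁ ≤ R →
        ‖ psum a n w ⊖ psum a n z ⊖ psum (deriv a) (ℕ.pred n) z ⊗ (w ⊖ z) ‖₁ ≤ C * (‖ w ⊖ z ‖₁ * ‖ w ⊖ z ‖₁)

  abstract
    uniformEstimates : ∀ a → Decay a → ∀ R → 0 ℕ.< R → ∃[ C ] UniformEstimates a (ι R) (ι C)
    -- `C` belongs to the radius 4R, which covers the rates R, 2R and 4R of the tail, `⊛-lipschitz`
    -- and `⊛-taylor`; the factor 2 is the sum of the geometric series.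
    uniformEstimates a decay R 0<R = 2 ℕ.* C , record
      { cauchy    = λ {m} {n} {z} m≤n z≤R → subst₂ _≤_
          (cong (λ t → ‖ psum a t z ⊖ psum a m z ‖₁) (ℕₚ.m∸n+n≡m m≤n))
          (trans (sym (ℚₚ.*-assoc (ι 2) (ι C) (½ ^ m))) (cong (_* ½ ^ m) (sym (ι-* 2 C))))
          (psum-tail a m {z} z≤R (*-nonNeg (0≤ι C) (0≤^ m 0≤½))
            (λ i → ℚₚ.≤-trans (weaken (0≤ι R) 1≤4 (i ℕ.+ m)) (ℚₚ.≤-reflexive
              (trans (cong (ι C *_) (^-homo-* ½ i m))
                (solve 3 (λ c x y → c :* (x :* y) := c :* y :* x) refl (ι C) (½ ^ i) (½ ^ m)))))
            (n ℕ.∸ m))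
      ; lipschitz = λ n {z} {w} z≤R w≤R → ℚₚ.≤-trans
          (series-bound (λ n → psum a n w ⊖ psum a n z) (λ n → real (a n) ⊗ (w ⊛ n ⊖ z ⊛ n))
            (*-nonNeg (0≤ι C) (0≤‖‖ (w ⊖ z)))
            (S.solve 0 (S.con (real 0ℚ) S.:- S.con (real 0ℚ) S.:= S.con (real 0ℚ)) refl)
            (λ n → S.solve 5 (λ s t c x y → s S.:+ c S.:* x S.:- (t S.:+ c S.:* y) S.:= s S.:- t S.:+ c S.:* (x S.:- y)) refl
              (psum a n w) (psum a n z) (real (a n)) (w ⊛ n) (z ⊛ n))
            (λ n → ℚₚ.≤-trans (‖real⊗‖-≤ (a n) {w ⊛ n ⊖ z ⊛ n} (⊛-lipschitz {z} {w} 1≤R z≤R w≤R n))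
              (scale (‖ w ⊖ z ‖₁) (∣ a n ∣) ((ι 2 * ι R) ^ n) (½ ^ n) (0≤‖‖ (w ⊖ z)) (weaken (*-nonNeg (0≤ι 2) (0≤ι R)) 2≤4 n))) n)
          (ℚₚ.≤-reflexive (twice (‖ w ⊖ z ‖₁)))
      ; taylor    = λ n {z} {w} z≤R w≤R → ℚₚ.≤-trans
          (series-bound (λ n → psum a n w ⊖ psum a n z ⊖ psum (deriv a) (ℕ.pred n) z ⊗ (w ⊖ z))
            (λ n → real (a n) ⊗ (w ⊛ n ⊖ z ⊛ n ⊖ ⊛-deriv z n ⊗ (w ⊖ z)))
            (*-nonNeg (0≤ι C) (*-nonNeg (0≤‖‖ (w ⊖ z)) (0≤‖‖ (w ⊖ z))))
            (S.solve 1 (λ h → S.con (real 0ℚ) S.:- S.con (real 0ℚ) S.:- S.con (real 0ℚ) S.:* h S.:= S.con (real 0ℚ)) refl (w ⊖ z))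
            (λ n → taylor-step n z w)
            (λ n → ℚₚ.≤-trans (‖real⊗‖-≤ (a n) {w ⊛ n ⊖ z ⊛ n ⊖ ⊛-deriv z n ⊗ (w ⊖ z)} (⊛-taylor {z} {w} 1≤R z≤R w≤R n))
              (scale (‖ w ⊖ z ‖₁ * ‖ w ⊖ z ‖₁) (∣ a n ∣) ((ι 4 * ι R) ^ n) (½ ^ n) (*-nonNeg (0≤‖‖ (w ⊖ z)) (0≤‖‖ (w ⊖ z))) (weaken (*-nonNeg (0≤ι 4) (0≤ι R)) 4≤4 n))) n)
          (ℚₚ.≤-reflexive (twice (‖ w ⊖ z ‖₁ * ‖ w ⊖ z ‖₁)))
      }
      where
      module S = ℚ[i]-Solver
      C : ℕ
      C = proj₁ (decay-geometric a decay (4 ℕ.* R))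
      h : ∀ j → ∣ a j ∣ * ι (4 ℕ.* R) ^ j ≤ ι C * ½ ^ j
      h = proj₂ (decay-geometric a decay (4 ℕ.* R))
      1≤R : 1ℚ ≤ ι R
      1≤R = ι-mono-≤ {1} {R} 0<R
      1≤4 : ι R ≤ ι 4 * ι R
      1≤4 = subst (_≤ ι 4 * ι R) (ℚₚ.*-identityˡ (ι R)) (*-monoʳ (ι R) (0≤ι R) (ι-mono-≤ {1} {4} (s≤s z≤n)))
      2≤4 : ι 2 * ι R ≤ ι 4 * ι R
      2≤4 = *-monoʳ (ι R) (0≤ι R) (ι-mono-≤ {2} {4} (s≤s (s≤s z≤n)))
      4≤4 : ι 4 * ι R ≤ ι 4 * ι R
      4≤4 = ℚₚ.≤-refl
      weaken : ∀ {r} → 0ℚ ≤ r → r ≤ ι 4 * ι R → ∀ n → ∣ a n ∣ * r ^ n ≤ ι C * ½ ^ n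
      weaken {r} 0≤r r≤ n = ℚₚ.≤-trans
        (*-monoˡ (∣ a n ∣) (ℚₚ.0≤∣p∣ (a n)) (^-mono-≤ n 0≤r (ℚₚ.≤-trans r≤ (ℚₚ.≤-reflexive (sym (ι-* 4 R)))))) (h n)
      scale : ∀ d A P Q → 0ℚ ≤ d → A * P ≤ ι C * Q → A * (P * d) ≤ ι C * d * Q
      scale d A P Q 0≤d le = subst₂ _≤_ (ℚₚ.*-assoc A P d)
        (solve 3 (λ c q d → c :* q :* d := c :* d :* q) refl (ι C) Q d) (*-monoʳ d 0≤d le)
      twice : ∀ d → ι 2 * (ι C * d) ≡ ι (2 ℕ.* C) * d
      twice d = trans (sym (ℚₚ.*-assoc (ι 2) (ι C) d)) (cong (_* d) (sym (ι-* 2 C)))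
      taylor-step : ∀ n z w → psum a (suc n) w ⊖ psum a (suc n) z ⊖ psum (deriv a) n z ⊗ (w ⊖ z) ≡
        psum a n w ⊖ psum a n z ⊖ psum (deriv a) (ℕ.pred n) z ⊗ (w ⊖ z) ⊕ real (a n) ⊗ (w ⊛ n ⊖ z ⊛ n ⊖ ⊛-deriv z n ⊗ (w ⊖ z))
      taylor-step n z w = trans
        (cong (λ t → psum a (suc n) w ⊖ psum a (suc n) z ⊖ t ⊗ (w ⊖ z)) (sym (psum-deriv-≡ a (suc n) z)))
        (trans (S.solve 8 (λ s t g c x y d e → s S.:+ c S.:* x S.:- (t S.:+ c S.:* y) S.:- (g S.:+ c S.:* d) S.:* e
            S.:= s S.:- t S.:- g S.:* e S.:+ c S.:* (x S.:- y S.:- d S.:* e)) refl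
            (psum a n w) (psum a n z) (psum-deriv a n z) (real (a n)) (w ⊛ n) (z ⊛ n) (⊛-deriv z n) (w ⊖ z))
          (cong (λ t → psum a n w ⊖ psum a n z ⊖ t ⊗ (w ⊖ z) ⊕ real (a n) ⊗ (w ⊛ n ⊖ z ⊛ n ⊖ ⊛-deriv z n ⊗ (w ⊖ z)))
            (psum-deriv-≡ a n z)))

-- The entire functions defined by such series and their derivatives

module EntireFunctions where

  open Rationals
  open GaussianRationals renaming (_^_ to _^ℚ_)
  open PowerSeries
  open import Defs hiding (_^_; _<_; _-_; -_; ∣_∣; ‖_‖; _+_; _*_)
  open RationalLemmas
  open CauchyLemmas
  open +-*-Solver
  open import Function.Bundles using (_⟨$⟩_)

  at : ℂ → ℕ → ℚ[i]
  at z n = ⟨ seq (re z) n , seq (im z) n ⟩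

  at-^ᶜ : ∀ z n m → at (z ^ᶜ n) m ≡ at z m ⊛ n
  at-^ᶜ z zero    m = refl
  at-^ᶜ z (suc n) m = cong (at z m ⊗_) (at-^ᶜ z n m)

  at-partialSum : ∀ a n z m → at (partialSum (λ j → ℚ→ℂ (a j)) n z) m ≡ psum a n (at z m)
  at-partialSum a zero    z m = refl
  at-partialSum a (suc n) z m = cong₂ (λ s t → s ⊕ real (a n) ⊗ t) (at-partialSum a n z m) (at-^ᶜ z n m)

  IsCauchyᶜ : (ℕ → ℚ[i]) → Set
  IsCauchyᶜ u = ∀ ε → 0ℚ ℚ.< ε → ∃[ N ] ∀ m n → N ℕ.≤ m → N ℕ.≤ n → ‖ u m ⊖ u n ‖₁ ℚ.≤ ε

  limit : (u : ℕ → ℚ[i]) → IsCauchyᶜ u → ℂ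
  limit u cu = mkℝ (λ n → Re (u n)) (λ ε 0<ε → let N , h = cu ε 0<ε in
      N , λ m n p q → ℚₚ.≤-trans (∣Re∣≤‖‖ (u m ⊖ u n)) (h m n p q))
    +i mkℝ (λ n → Im (u n)) (λ ε 0<ε → let N , h = cu ε 0<ε in
      N , λ m n p q → ℚₚ.≤-trans (∣Im∣≤‖‖ (u m ⊖ u n)) (h m n p q))

  at-cauchy : ∀ z → IsCauchyᶜ (at z)
  at-cauchy z ε 0<ε =
    let M , h = cauchy (re z) (½ ℚ.* ε) (½-pos 0<ε)
        N , k = cauchy (im z) (½ ℚ.* ε) (½-pos 0<ε)
    in M ℕ.⊔ N , λ m n p q → ℚₚ.≤-trans
      (ℚₚ.+-mono-≤ (h m n (ℕₚ.m⊔n≤o⇒m≤o M N p) (ℕₚ.m⊔n≤o⇒m≤o M N q))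
                   (k m n (ℕₚ.m⊔n≤o⇒n≤o M N p) (ℕₚ.m⊔n≤o⇒n≤o M N q)))
      (ℚₚ.≤-reflexive (halves ε))

  at-cong : ∀ {z w} → z ≃ᶜ w → ∀ ε → 0ℚ ℚ.< ε → ∃[ N ] ∀ n → N ℕ.≤ n → ‖ at z n ⊖ at w n ‖₁ ℚ.≤ ε
  at-cong (p , q) ε 0<ε =
    let M , h = un≃ p (½ ℚ.* ε) (½-pos 0<ε)
        N , k = un≃ q (½ ℚ.* ε) (½-pos 0<ε)
    in M ℕ.⊔ N , λ n r → ℚₚ.≤-trans
      (ℚₚ.+-mono-≤ (h n (ℕₚ.m⊔n≤o⇒m≤o M N r)) (k n (ℕₚ.m⊔n≤o⇒n≤o M N r)))
      (ℚₚ.≤-reflexive (halves ε))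

  ≃ᶜ-from-at : ∀ {z w} → (∀ ε → 0ℚ ℚ.< ε → ∃[ N ] ∀ n → N ℕ.≤ n → ‖ at z n ⊖ at w n ‖₁ ℚ.≤ ε) → z ≃ᶜ w
  ≃ᶜ-from-at {z} {w} h =
    mk≃ (λ ε 0<ε → let N , k = h ε 0<ε in N , λ n p → ℚₚ.≤-trans (∣Re∣≤‖‖ (at z n ⊖ at w n)) (k n p)) ,
    mk≃ (λ ε 0<ε → let N , k = h ε 0<ε in N , λ n p → ℚₚ.≤-trans (∣Im∣≤‖‖ (at z n ⊖ at w n)) (k n p))

  -- The extra unit leaves room for a perturbation of z.
  at-bounded : ∀ z → ∃[ R ] (0 ℕ.< R) × ∃[ N ] ∀ n → N ℕ.≤ n → ‖ at z n ‖₁ ℚ.+ 1ℚ ℚ.≤ ι R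
  at-bounded z =
    let A , _ , M , h = cauchy-bounded (seq (re z)) (cauchy (re z))
        B , _ , N , k = cauchy-bounded (seq (im z)) (cauchy (im z))
        R , le = ι-unbounded (A ℚ.+ B ℚ.+ 1ℚ)
    in suc R , s≤s z≤n , M ℕ.⊔ N , λ n p → ℚₚ.≤-trans
      (ℚₚ.+-monoˡ-≤ 1ℚ (ℚₚ.+-mono-≤ (h n (ℕₚ.m⊔n≤o⇒m≤o M N p)) (k n (ℕₚ.m⊔n≤o⇒n≤o M N p))))
      (ℚₚ.≤-trans le (ι-mono-≤ (ℕₚ.n≤1+n R)))

  p≤p+1 : ∀ p → p ℚ.≤ p ℚ.+ 1ℚ
  p≤p+1 p = ≤-by-slack (ℚₚ.<⇒≤ 0<1) refl

  -- The same k has two uses: `recip k` is the tolerance for the argument in a Lipschitz bound, and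
  -- k itself a number of terms after which the tail is small.
  geometric-small : ∀ C {ε} → 0ℚ ℚ.< ε → ∃[ k ] (0 ℕ.< k × ι C ℚ.* recip k ℚ.≤ ε × ∀ n → k ℕ.≤ n → ι C ℚ.* ½ ^ℚ n ℚ.≤ ε)
  geometric-small C {ε} 0<ε =
    let k , h = archimedean-recip (ι C) 0<ε
    in k , proj₁ (h k ℕₚ.≤-refl) , proj₂ (h k ℕₚ.≤-refl) , λ n k≤n →
      subst (λ t → ι C ℚ.* t ℚ.≤ ε) (sym (½^≡recip n)) (proj₂ (h (2 ℕ.^ n) (ℕₚ.≤-trans k≤n (n≤2^n n))))

  ½^-anti : ∀ {m n} → m ℕ.≤ n → ½ ^ℚ n ℚ.≤ ½ ^ℚ m
  ½^-anti {m} {n} m≤n = subst₂ ℚ._≤_ (sym (½^≡recip n)) (sym (½^≡recip m))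
    (recip-anti-≤ (ℕₚ.m^n>0 2 m) (ℕₚ.^-monoʳ-≤ 2 m≤n))

  psum-close : ∀ {a R} C → UniformEstimates a R (ι C) → ∀ {k m n z} → k ℕ.≤ m → k ℕ.≤ n → ‖ z ‖₁ ℚ.≤ R →
    ‖ psum a m z ⊖ psum a n z ‖₁ ℚ.≤ ι C ℚ.* ½ ^ℚ k
  psum-close {a} {R} C est {k} {m} {n} {z} k≤m k≤n z≤R with ℕₚ.≤-total m n
  ... | inj₁ m≤n = subst (ℚ._≤ ι C ℚ.* ½ ^ℚ k) (‖⊖‖-sym (psum a n z) (psum a m z))
    (ℚₚ.≤-trans (UniformEstimates.cauchy est {m} {n} {z} m≤n z≤R) (*-monoˡ (ι C) (0≤ι C) (½^-anti k≤m)))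
  ... | inj₂ n≤m = ℚₚ.≤-trans (UniformEstimates.cauchy est {n} {m} {z} n≤m z≤R) (*-monoˡ (ι C) (0≤ι C) (½^-anti k≤n))

  abstract
    -- Truncation and argument both move with n. They are changed one at a time: first the
    -- truncation at a fixed point, by the tail estimate, then the point, by the Lipschitz estimate.
    psum-cauchy : ∀ a → Decay a → ∀ s z → IsCauchyᶜ (λ n → psum a (n ℕ.∸ s) (at z n))
    psum-cauchy a decay s z ε 0<ε =
      let R , 0<R , N₁ , z≤R = at-bounded z
          C , est = uniformEstimates a decay R 0<R
          k , 0<k , Ck≤ε , C½≤ε = geometric-small C (½-pos 0<ε)
          N₂ , close = at-cauchy z (recip k) (recip-pos 0<k)
          N = N₁ ℕ.⊔ N₂ ℕ.⊔ (k ℕ.+ s)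
          N₁≤ = λ {n} (p : N ℕ.≤ n) → ℕₚ.m⊔n≤o⇒m≤o N₁ N₂ (ℕₚ.m⊔n≤o⇒m≤o (N₁ ℕ.⊔ N₂) (k ℕ.+ s) p)
          N₂≤ = λ {n} (p : N ℕ.≤ n) → ℕₚ.m⊔n≤o⇒n≤o N₁ N₂ (ℕₚ.m⊔n≤o⇒m≤o (N₁ ℕ.⊔ N₂) (k ℕ.+ s) p)
          k≤ = λ {n} (p : N ℕ.≤ n) → subst (ℕ._≤ n ℕ.∸ s) (ℕₚ.m+n∸n≡m k s)
                 (ℕₚ.∸-monoˡ-≤ s (ℕₚ.m⊔n≤o⇒n≤o (N₁ ℕ.⊔ N₂) (k ℕ.+ s) p))
          z≤ = λ {n} (p : N ℕ.≤ n) → ℚₚ.≤-trans (p≤p+1 (‖ at z n ‖₁)) (z≤R n (N₁≤ p))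
      in N , λ m n p q → ℚₚ.≤-trans
        (‖⊖‖-triangle (psum a (m ℕ.∸ s) (at z m)) (psum a (n ℕ.∸ s) (at z m)) (psum a (n ℕ.∸ s) (at z n)))
        (ℚₚ.≤-trans (ℚₚ.+-mono-≤
            (ℚₚ.≤-trans (psum-close C est {k} {m ℕ.∸ s} {n ℕ.∸ s} {at z m} (k≤ p) (k≤ q) (z≤ p)) (C½≤ε k ℕₚ.≤-refl))
            (ℚₚ.≤-trans (UniformEstimates.lipschitz est (n ℕ.∸ s) {at z n} {at z m} (z≤ q) (z≤ p))
              (ℚₚ.≤-trans (*-monoˡ (ι C) (0≤ι C) (close m n (N₂≤ p) (N₂≤ q))) Ck≤ε)))
          (ℚₚ.≤-reflexive (halves ε)))

    psum-cong : ∀ a → Decay a → ∀ s {z w} → z ≃ᶜ w → ∀ ε → 0ℚ ℚ.< ε →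
      ∃[ N ] ∀ n → N ℕ.≤ n → ‖ psum a (n ℕ.∸ s) (at z n) ⊖ psum a (n ℕ.∸ s) (at w n) ‖₁ ℚ.≤ ε
    psum-cong a decay s {z} {w} z≃w ε 0<ε =
      let R , 0<R , N₁ , z≤R = at-bounded z
          R′ , 0<R′ , N₂ , w≤R = at-bounded w
          C , est = uniformEstimates a decay (R ℕ.+ R′) (ℕₚ.<-≤-trans 0<R (ℕₚ.m≤m+n R R′))
          k , 0<k , Ck≤ε , _ = geometric-small C 0<ε
          N₃ , close = at-cong {z} {w} z≃w (recip k) (recip-pos 0<k)
      in N₁ ℕ.⊔ N₂ ℕ.⊔ N₃ , λ n p →
        let p₁₂ = ℕₚ.m⊔n≤o⇒m≤o (N₁ ℕ.⊔ N₂) N₃ p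
        in ℚₚ.≤-trans (UniformEstimates.lipschitz est (n ℕ.∸ s) {at w n} {at z n}
            (ℚₚ.≤-trans (p≤p+1 (‖ at w n ‖₁)) (ℚₚ.≤-trans (w≤R n (ℕₚ.m⊔n≤o⇒n≤o N₁ N₂ p₁₂)) (ι-mono-≤ (ℕₚ.m≤n+m R′ R))))
            (ℚₚ.≤-trans (p≤p+1 (‖ at z n ‖₁)) (ℚₚ.≤-trans (z≤R n (ℕₚ.m⊔n≤o⇒m≤o N₁ N₂ p₁₂)) (ι-mono-≤ (ℕₚ.m≤m+n R R′)))))
          (ℚₚ.≤-trans (*-monoˡ (ι C) (0≤ι C) (close n (ℕₚ.m⊔n≤o⇒n≤o (N₁ ℕ.⊔ N₂) N₃ p))) Ck≤ε)

  -- Truncating at n ∸ s makes the approximations of the s-th derivative the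
  -- exact derivatives of those of the function.
  series-value : ∀ a → Decay a → ℕ → ℂ → ℂ
  series-value a decay s z = limit (λ n → psum a (n ℕ.∸ s) (at z n)) (psum-cauchy a decay s z)

  deriv^ : ℕ → (ℕ → ℚ) → ℕ → ℚ
  deriv^ zero    a = a
  deriv^ (suc s) a = deriv (deriv^ s a)

  decay-deriv^ : ∀ s a → Decay a → Decay (deriv^ s a)
  decay-deriv^ zero    a decay = decay
  decay-deriv^ (suc s) a decay = decay-deriv (deriv^ s a) (decay-deriv^ s a decay)

  opaque
    derivative : ∀ a → Decay a → ℕ → ℂ⟶ℂ
    derivative a decay s = record
      { to   = series-value (deriv^ s a) (decay-deriv^ s a decay) s
      ; cong = λ {z} {w} z≃w → ≃ᶜ-from-at
          {series-value (deriv^ s a) (decay-deriv^ s a decay) s z} {series-value (deriv^ s a) (decay-deriv^ s a decay) s w}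
          (psum-cong (deriv^ s a) (decay-deriv^ s a decay) s z≃w)
      }

    at-derivative : ∀ a (decay : Decay a) s z n → at (derivative a decay s ⟨$⟩ z) n ≡ psum (deriv^ s a) (n ℕ.∸ s) (at z n)
    at-derivative a decay s z n = refl

  opaque
    unfolding derivative

    derivative-hasPowerSeries : ∀ a (decay : Decay a) → HasPowerSeries (derivative a decay 0) (λ j → ℚ→ℂ (a j))
    derivative-hasPowerSeries a decay z ε 0<ε =
      let R , 0<R , N₁ , z≤R = at-bounded z
          C , est = uniformEstimates a decay R 0<R
          k , _ , _ , C½≤ε = geometric-small C 0<ε
      in k , λ n k≤n → mk≤ λ ε′ 0<ε′ → N₁ ℕ.⊔ n , λ m p →
        let n≤m = ℕₚ.m⊔n≤o⇒n≤o N₁ n p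
            d = psum a n (at z m) ⊖ psum a m (at z m)
        in ℚₚ.≤-trans
          (subst (λ t → modulus² (t ⊖ psum a m (at z m)) ℚ.≤ ε ℚ.* ε) (sym (at-partialSum a n z m))
            (ℚₚ.≤-trans (modulus²≤‖‖² d) (square-mono-≤ (0≤‖‖ d)
              (ℚₚ.≤-trans (psum-close C est {k} {n} {m} {at z m} k≤n (ℕₚ.≤-trans k≤n n≤m)
                (ℚₚ.≤-trans (p≤p+1 (‖ at z m ‖₁)) (z≤R m (ℕₚ.m⊔n≤o⇒m≤o N₁ n p))))
                (C½≤ε k ℕₚ.≤-refl)))))
          (≤-by-slack (ℚₚ.<⇒≤ 0<ε′) refl)

  -- From ‖h‖₁² ≤ 2|h|² ≤ 4δ² one gets ‖h‖₁ ≤ 2δ ≤ 1, and C (4δ) ≤ ε then turns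
  -- the quadratic remainder C ‖h‖₁² into at most ε |h|.
  remainder-small : ∀ {C ε δ H E M} → 0ℚ ℚ.≤ C → 0ℚ ℚ.≤ δ → 0ℚ ℚ.≤ H → 0ℚ ℚ.≤ E → 0ℚ ℚ.≤ M → C ℚ.* ι 4 ℚ.* δ ℚ.≤ ε →
    H ℚ.≤ ι 2 ℚ.* δ → H ℚ.* H ℚ.≤ ι 2 ℚ.* M → E ℚ.≤ C ℚ.* (H ℚ.* H) → E ℚ.* E ℚ.≤ ε ℚ.* ε ℚ.* M
  remainder-small {C} {ε} {δ} {H} {E} {M} 0≤C 0≤δ 0≤H 0≤E 0≤M Cδ≤ε H≤2δ HH≤2M E≤ = begin
    E ℚ.* E                                        ≤⟨ square-mono-≤ 0≤E E≤ ⟩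
    C ℚ.* (H ℚ.* H) ℚ.* (C ℚ.* (H ℚ.* H))          ≡⟨ solve 2 (λ c h → c :* (h :* h) :* (c :* (h :* h)) := c :* c :* (h :* h) :* (h :* h)) refl C H ⟩
    C ℚ.* C ℚ.* (H ℚ.* H) ℚ.* (H ℚ.* H)            ≤⟨ *-mono (*-nonNeg 0≤H 0≤H) (*-nonNeg 0≤CC (*-nonNeg 0≤2δ 0≤2δ))
                                                        (*-monoˡ (C ℚ.* C) 0≤CC (square-mono-≤ 0≤H H≤2δ)) HH≤2M ⟩
    C ℚ.* C ℚ.* (ι 2 ℚ.* δ ℚ.* (ι 2 ℚ.* δ)) ℚ.* (ι 2 ℚ.* M)
      ≤⟨ ≤-by-slack {r = ι 8 ℚ.* (C ℚ.* C ℚ.* (δ ℚ.* δ) ℚ.* M)} (*-nonNeg (0≤ι 8) (*-nonNeg (*-nonNeg 0≤CC (*-nonNeg 0≤δ 0≤δ)) 0≤M))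
          (solve 3 (λ c d m → c :* con (ι 4) :* d :* (c :* con (ι 4) :* d) :* m
            := c :* c :* (con (ι 2) :* d :* (con (ι 2) :* d)) :* (con (ι 2) :* m) :+ con (ι 8) :* (c :* c :* (d :* d) :* m)) refl C δ M) ⟩
    C ℚ.* ι 4 ℚ.* δ ℚ.* (C ℚ.* ι 4 ℚ.* δ) ℚ.* M    ≤⟨ *-monoʳ M 0≤M (square-mono-≤ (*-nonNeg (*-nonNeg 0≤C (0≤ι 4)) 0≤δ) Cδ≤ε) ⟩
    ε ℚ.* ε ℚ.* M                                  ∎
    where
    open ℚₚ.≤-Reasoning
    0≤CC = *-nonNeg 0≤C 0≤C
    0≤2δ = *-nonNeg (0≤ι 2) 0≤δ

  0≤modulus² : ∀ z → 0ℚ ℚ.≤ modulus² z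
  0≤modulus² z = +-nonNeg (square-nonNeg (Re z)) (square-nonNeg (Im z))

  opaque
    unfolding derivative

    derivative-suc : ∀ a₀ (decay : Decay a₀) s z →
      HasDerivativeAt (derivative a₀ decay s) z (derivative a₀ decay (suc s) ⟨$⟩ z)
    derivative-suc a₀ decay₀ s z ε 0<ε =
      let a = deriv^ s a₀
          decay = decay-deriv^ s a₀ decay₀
          R , 0<R , N₁ , z≤R = at-bounded z
          C , est = uniformEstimates a decay R 0<R
          k₀ , small = archimedean-recip (ι C ℚ.* ι 4) 0<ε
          -- Adding 2 gives 2δ ≤ 1, so z + h stays within the unit of room that `at-bounded` leaves.
          k = k₀ ℕ.+ 2
          0<k , Cδ≤ε = small k (ℕₚ.m≤m+n k₀ 2)
          δ = recip k
          0<δ = recip-pos 0<k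
          0≤δ = ℚₚ.<⇒≤ 0<δ
          2δ≤1 : ι 2 ℚ.* δ ℚ.≤ 1ℚ
          2δ≤1 = frac-≤ {2} {k} {1} 0<k (s≤s z≤n) (ℕₚ.m≤n+m 2 k₀)
      in δ , 0<δ , λ h h≤δ → mk≤ λ ε′ 0<ε′ →
        -- The bound on h holds for its terms only up to a slack; the slack δ² gives a squared
        -- modulus of at most 2δ².
        let N₂ , hδ = un≤ h≤δ (δ ℚ.* δ) (*-pos 0<δ 0<δ)
        in N₁ ℕ.⊔ N₂ , λ n p →
          let zn = at z n
              hn = at h n
              H = ‖ hn ‖₁
              M = modulus² hn
              HH≤2M : H ℚ.* H ℚ.≤ ι 2 ℚ.* M
              HH≤2M = ‖‖²≤2modulus² hn
              H≤2δ : H ℚ.≤ ι 2 ℚ.* δ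
              H≤2δ = square-cancel-≤ (*-nonNeg (0≤ι 2) 0≤δ) (ℚₚ.≤-trans HH≤2M (subst (ι 2 ℚ.* M ℚ.≤_)
                (solve 1 (λ d → con (ι 2) :* (d :* d :+ d :* d) := con (ι 2) :* d :* (con (ι 2) :* d)) refl δ)
                (*-monoˡ (ι 2) (0≤ι 2) (hδ n (ℕₚ.m⊔n≤o⇒n≤o N₁ N₂ p)))))
              z≤ = z≤R n (ℕₚ.m⊔n≤o⇒m≤o N₁ N₂ p)
              z+h⊖z : zn ⊕ hn ⊖ zn ≡ hn
              z+h⊖z = S.solve 2 (λ z h → z S.:+ h S.:- z S.:= h) refl zn hn
              E = psum a (n ℕ.∸ s) (zn ⊕ hn) ⊖ psum a (n ℕ.∸ s) zn ⊖ psum (deriv a) (n ℕ.∸ suc s) zn ⊗ hn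
              E≤ : ‖ E ‖₁ ℚ.≤ ι C ℚ.* (H ℚ.* H)
              E≤ = subst₂ (λ t u → ‖ psum a (n ℕ.∸ s) (zn ⊕ hn) ⊖ psum a (n ℕ.∸ s) zn ⊖ psum (deriv a) t zn ⊗ u ‖₁ ℚ.≤ ι C ℚ.* (‖ u ‖₁ ℚ.* ‖ u ‖₁))
                (ℕₚ.pred[m∸n]≡m∸[1+n] n s) z+h⊖z
                (UniformEstimates.taylor est (n ℕ.∸ s) {zn} {zn ⊕ hn} (ℚₚ.≤-trans (p≤p+1 (‖ zn ‖₁)) z≤)
                  (ℚₚ.≤-trans (‖⊕‖-≤ {zn} {hn} ℚₚ.≤-refl (ℚₚ.≤-trans H≤2δ 2δ≤1)) z≤))
          in ℚₚ.≤-trans (modulus²≤‖‖² E) (ℚₚ.≤-trans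
              (remainder-small {ι C} {ε} {δ} {H} {‖ E ‖₁} {M} (0≤ι C) 0≤δ (0≤‖‖ hn) (0≤‖‖ E) (0≤modulus² hn) Cδ≤ε H≤2δ HH≤2M E≤)
              (≤-by-slack (ℚₚ.<⇒≤ 0<ε′) refl))
      where module S = ℚ[i]-Solver

  derivative-isDerivative : ∀ a (decay : Decay a) s → IsDerivative s (derivative a decay 0) (derivative a decay s)
  derivative-isDerivative a decay zero    z =
    ≃-refl {re (derivative a decay 0 ⟨$⟩ z)} , ≃-refl {im (derivative a decay 0 ⟨$⟩ z)}
  derivative-isDerivative a decay (suc s) = derivative a decay s , derivative-isDerivative a decay s ,
    derivative-suc a decay s

  derivative-entire : ∀ a (decay : Decay a) → Entire (derivative a decay 0)
  derivative-entire a decay z = derivative a decay (suc 0) ⟨$⟩ z , derivative-suc a decay 0 z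

  derivative-at-0 : ∀ a₀ (decay : Decay a₀) s → IsRational (derivative a₀ decay s ⟨$⟩ ℚ→ℂ 0ℚ)
  derivative-at-0 a₀ decay s = deriv^ s a₀ 0 , ≃ᶜ-from-at {derivative a₀ decay s ⟨$⟩ ℚ→ℂ 0ℚ} {ℚ→ℂ (deriv^ s a₀ 0)} λ ε 0<ε →
    suc s , λ n s<n → ℚₚ.≤-trans (ℚₚ.≤-reflexive (trans (cong (λ t → ‖ t ⊖ real (deriv^ s a₀ 0) ‖₁) (at-derivative a₀ decay s (ℚ→ℂ 0ℚ) n)) (eq n s<n))) (ℚₚ.<⇒≤ 0<ε)
    where
    a : ℕ → ℚ
    a = deriv^ s a₀
    module S = ℚ[i]-Solver
    psum-at-0 : ∀ n → psum a (suc n) (real 0ℚ) ≡ real (a 0)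
    psum-at-0 zero    = S.solve 1 (λ c → S.con (real 0ℚ) S.:+ c S.:* S.con (real 1ℚ) S.:= c) refl (real (a 0))
    psum-at-0 (suc n) = trans (cong (_⊕ real (a (suc n)) ⊗ real 0ℚ ⊛ suc n) (psum-at-0 n))
      (S.solve 3 (λ c d p → c S.:+ d S.:* (S.con (real 0ℚ) S.:* p) S.:= c) refl (real (a 0)) (real (a (suc n))) (real 0ℚ ⊛ n))
    eq : ∀ n → s ℕ.< n → ‖ psum a (n ℕ.∸ s) (real 0ℚ) ⊖ real (a 0) ‖₁ ≡ 0ℚ
    eq n s<n = trans (cong (λ t → ‖ t ⊖ real (a 0) ‖₁)
        (trans (cong (λ t → psum a t (real 0ℚ)) (sym (ℕₚ.suc-pred (n ℕ.∸ s) {{ℕ.>-nonZero (ℕₚ.m<n⇒0<n∸m s<n)}})))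
          (psum-at-0 (ℕ.pred (n ℕ.∸ s)))))
      (cong ‖_‖₁ {real (a 0) ⊖ real (a 0)} {real 0ℚ} (S.solve 1 (λ c → c S.:- c S.:= S.con (real 0ℚ)) refl (real (a 0))))

  derivative-real : ∀ a (decay : Decay a) s ζ n → at (derivative a decay s ⟨$⟩ ℝ→ℂ ζ) n ≡ real (psumℚ (deriv^ s a) (n ℕ.∸ s) (seq ζ n))
  derivative-real a decay s ζ n = trans (at-derivative a decay s (ℝ→ℂ ζ) n) (psum-real (deriv^ s a) (n ℕ.∸ s) (seq ζ n))

-- A constructive criterion for Liouville numbers

module LiouvilleCriterion where

  open Rationals
  open GaussianRationals renaming (_^_ to _^ℚ_)
  open import Defs hiding (_^_; -_; _+_; _*_)
  open RationalLemmas
  open CauchyLemmas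
  open +-*-Solver
  open import Data.Integer.Base as ℤ using (ℤ; +_)
  open import Data.List.Base using (List; []; _∷_)
  open import Data.List.Membership.Propositional using (_∈_; _∉_)
  open import Data.List.Relation.Unary.Any using (here; there)

  seq-^ : ∀ t n i → seq (t Defs.^ n) i ≡ seq t i ^ℚ n
  seq-^ t zero    i = refl
  seq-^ t (suc n) i = cong (seq t i ℚ.*_) (seq-^ t n i)

  commonDenominator : List ℚ → ℕ
  commonDenominator []       = 1
  commonDenominator (p ∷ ps) = ↧ₙ p ℕ.* commonDenominator ps

  0<↧ₙ : ∀ p → 0 ℕ.< ↧ₙ p
  0<↧ₙ (ℚ.mkℚ _ _ _) = s≤s z≤n

  commonDenominator-pos : ∀ ps → 0 ℕ.< commonDenominator ps
  commonDenominator-pos []       = s≤s z≤n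
  commonDenominator-pos (p ∷ ps) = ℕₚ.*-mono-≤ (0<↧ₙ p) (commonDenominator-pos ps)

  commonDenominator-integral : ∀ {p} ps → p ∈ ps → Integral (ι (commonDenominator ps) ℚ.* p)
  commonDenominator-integral {p} (_ ∷ ps) (here refl) =
    Integral-∣ {↧ₙ p} {↧ₙ p ℕ.* commonDenominator ps} (ℕ∣.m∣m*n (commonDenominator ps)) (↧-*-integral p)
  commonDenominator-integral {p} (q ∷ ps) (there p∈ps) =
    Integral-∣ {commonDenominator ps} {↧ₙ q ℕ.* commonDenominator ps} (ℕ∣.n∣m*n (↧ₙ q)) (commonDenominator-integral ps p∈ps)

  -- `n` is both the exponent and a lower bound for the denominator, which need not be reduced. `B`
  -- is later either the denominator of a supposed rational value of x or a common denominator of a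
  -- list to be avoided; `non-integral` separates the approximation from both.
  record Approximation (x : ℝ) (n B : ℕ) : Set where
    field
      denominator  : ℕ
      value        : ℚ
      large        : n ℕ.< denominator
      integral     : Integral (ι denominator ℚ.* value)
      close        : ∃[ N ] ∀ i → N ℕ.≤ i → dℚ (seq x i) value ℚ.≤ recip (denominator ℕ.^ n)
      non-integral : ¬ Integral (ι B ℚ.* value)

  integral-apart : ∀ {p} B → 0 ℕ.< B → Integral (ι B ℚ.* p) → p ≢ 0ℚ → 1ℚ ℚ.≤ ι B ℚ.* ℚ.∣ p ∣
  integral-apart {p} B 0<B int p≢0 = subst (1ℚ ℚ.≤_)
    (trans (ℚₚ.∣p*q∣≡∣p∣*∣q∣ (ι B) p) (cong (ℚ._* ℚ.∣ p ∣) (ℚₚ.0≤p⇒∣p∣≡p (0≤ι B))))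
    (Integral-∣∣≥1 int λ eq → p≢0 (*-cancelʳ-≡ (ι B) (0<ι 0<B)
      (trans (ℚₚ.*-comm p (ι B)) (trans eq (sym (ℚₚ.*-zeroˡ (ι B)))))))

  minus-≢0 : ∀ {p q} → p ≢ q → p ℚ.- q ≢ 0ℚ
  minus-≢0 {p} {q} p≢q eq = p≢q (begin
    p              ≡⟨ solve 2 (λ p q → p := p :- q :+ q) refl p q ⟩
    p ℚ.- q ℚ.+ q  ≡⟨ cong (ℚ._+ q) eq ⟩
    0ℚ ℚ.+ q       ≡⟨ ℚₚ.+-identityˡ q ⟩
    q              ∎)
    where open ≡-Reasoning

  limit-close : ∀ x ρ {r c} → x ≃ ℚ→ℝ ρ → ∃[ N ] (∀ i → N ℕ.≤ i → dℚ (seq x i) r ℚ.≤ c) → dℚ ρ r ℚ.≤ c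
  limit-close x ρ {r} {c} x≃ρ (N , close) = ≤-by-ε λ ε 0<ε →
    let M , h = un≃ x≃ρ ε 0<ε
        i = M ℕ.⊔ N
    in ℚₚ.≤-trans (d-triangle ρ (seq x i) r) (ℚₚ.≤-trans
      (ℚₚ.+-mono-≤ (subst (ℚ._≤ ε) (d-sym (seq x i) ρ) (h i (ℕₚ.m≤m⊔n M N))) (close i (ℕₚ.m≤n⊔m M N)))
      (ℚₚ.≤-reflexive (ℚₚ.+-comm ε c)))

  module _ (x : ℝ) (approximate : ∀ n B → 0 ℕ.< B → Approximation x n B) where

    -- If x were ρ with denominator B, then ρ - r would be a nonzero multiple of 1/(BD) of size at
    -- most D^-2, whence D ≤ B. The choice n = B+2 ensures both an exponent of at least 2 and D > B.
    approximable-irrational : Irrational x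
    approximable-irrational ρ x≃ρ = ℕₚ.<⇒≱ B<D (ℕₚ.*-cancelʳ-≤ D B D {{ℕ.>-nonZero 0<D}} DD≤BD)
      where
      B = ↧ₙ ρ
      open Approximation (approximate (suc (suc B)) B (0<↧ₙ ρ)) renaming (denominator to D; value to r)
      B<D : B ℕ.< D
      B<D = ℕₚ.≤-trans (ℕₚ.≤-trans (ℕₚ.n≤1+n (suc B)) (ℕₚ.n≤1+n (suc (suc B)))) large
      0<D : 0 ℕ.< D
      0<D = ℕₚ.≤-<-trans z≤n B<D
      ρ≢r : ρ ≢ r
      ρ≢r ρ≡r = non-integral (subst (λ t → Integral (ι B ℚ.* t)) ρ≡r (↧-*-integral ρ))
      BD-integral : Integral (ι (B ℕ.* D) ℚ.* (ρ ℚ.- r))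
      BD-integral = subst Integral
        (trans (solve 4 (λ b d p r → d :* (b :* p) :+ (:- (b :* (d :* r))) := b :* d :* (p :- r)) refl (ι B) (ι D) ρ r)
          (cong (ℚ._* (ρ ℚ.- r)) (sym (ι-* B D))))
        (Integral-+ (Integral-* (Integral-ι D) (↧-*-integral ρ)) (Integral-neg (Integral-* (Integral-ι B) integral)))
      d≤ : dℚ ρ r ℚ.≤ recip (D ℕ.* D)
      d≤ = ℚₚ.≤-trans (limit-close x ρ x≃ρ close) (recip-anti-≤ (ℕₚ.*-mono-≤ 0<D 0<D)
        (subst (ℕ._≤ D ℕ.^ suc (suc B)) (cong (D ℕ.*_) (ℕₚ.*-identityʳ D))
          (ℕₚ.^-monoʳ-≤ D {{ℕ.>-nonZero 0<D}} {2} {suc (suc B)} (s≤s (s≤s z≤n)))))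
      DD≤BD : D ℕ.* D ℕ.≤ B ℕ.* D
      DD≤BD = ι-cancel-≤ (subst₂ ℚ._≤_ (ℚₚ.*-identityˡ (ι (D ℕ.* D)))
        (trans (ℚₚ.*-assoc (ι (B ℕ.* D)) (recip (D ℕ.* D)) (ι (D ℕ.* D)))
          (trans (cong (ι (B ℕ.* D) ℚ.*_) (recip-inverse (ℕₚ.*-mono-≤ 0<D 0<D))) (ℚₚ.*-identityʳ _)))
        (*-monoʳ (ι (D ℕ.* D)) (0≤ι (D ℕ.* D)) (ℚₚ.≤-trans
          (integral-apart (B ℕ.* D) (ℕₚ.*-mono-≤ (0<↧ₙ ρ) 0<D) BD-integral (minus-≢0 ρ≢r))
          (*-monoˡ (ι (B ℕ.* D)) (0≤ι (B ℕ.* D)) d≤))))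

    -- A real exponent η is eventually bounded by a natural m, and a/b < η then gives a ≤ m b. So
    -- one approximation of exponent m meets the condition for all a/b at once.
    approximable-liouville : 𝓛 x
    approximable-liouville = approximable-irrational , λ η _ ps →
      let A , _ , M , η≤A = cauchy-bounded (seq η) (cauchy η)
          m , A≤m = ι-unbounded A
          B = commonDenominator ps
      in approximation η ps M m (λ i M≤i → ℚₚ.≤-trans (≤∣∣ (seq η i)) (ℚₚ.≤-trans (η≤A i M≤i) A≤m))
           (approximate m B (commonDenominator-pos ps))
      where
      approximation : ∀ η ps M m → (∀ i → M ℕ.≤ i → seq η i ℚ.≤ ι m) → Approximation x m (commonDenominator ps) →
        ∃[ r ] r ∉ ps × ∃₂ λ (y : ℤ) (k : ℕ) → (r ≡ y ℚ./ suc k) × (∣ x - ℚ→ℝ r ∣ ≤ suc k ^- η)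
      approximation η ps M m η≤m record { denominator = suc k ; value = r ; integral = y , Dr≡y ; close = N , close ; non-integral = non-integral } =
        r , (λ r∈ps → non-integral (commonDenominator-integral ps r∈ps)) , y , k , r≡y/D , bound
        where
        D = suc k
        r≡y/D : r ≡ y ℚ./ suc k
        r≡y/D = begin
          r                              ≡⟨ sym (ℚₚ.*-identityˡ r) ⟩
          1ℚ ℚ.* r                       ≡⟨ cong (ℚ._* r) (sym (recip-inverse {D} (s≤s z≤n))) ⟩
          recip D ℚ.* ι D ℚ.* r          ≡⟨ solve 3 (λ a b c → a :* b :* c := b :* c :* a) refl (recip D) (ι D) r ⟩
          ι D ℚ.* r ℚ.* recip D          ≡⟨ cong (ℚ._* recip D) Dr≡y ⟩
          y ℚ./ 1 ℚ.* recip D            ≡⟨ sym (/-≡-* y k) ⟩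
          y ℚ./ suc k                    ∎
          where open ≡-Reasoning
        exponent : ∀ a b → ℚ→ℝ (+ a ℚ./ suc b) < η → a ℕ.≤ m ℕ.* suc b
        exponent a b a/b<η = let ε , 0<ε , L , h = un< a/b<η ; i = L ℕ.⊔ M in ι-cancel-≤ (subst₂ ℚ._≤_
          (trans (cong (ℚ._* ι (suc b)) (/-≡-* (+ a) b)) (trans (ℚₚ.*-assoc (ι a) (recip (suc b)) (ι (suc b)))
            (trans (cong (ι a ℚ.*_) (recip-inverse {suc b} (s≤s z≤n))) (ℚₚ.*-identityʳ (ι a)))))
          (sym (ι-* m (suc b)))
          (*-monoʳ (ι (suc b)) {+ a ℚ./ suc b} {ι m} (0≤ι (suc b)) (ℚₚ.≤-trans (≤-by-slack {+ a ℚ./ suc b} (ℚₚ.<⇒≤ 0<ε) refl)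
            (ℚₚ.≤-trans (h i (ℕₚ.m≤m⊔n L M)) (η≤m i (ℕₚ.m≤n⊔m L M))))))
        bound : ∣ x - ℚ→ℝ r ∣ ≤ suc k ^- η
        bound a b a/b<η = mk≤ λ ε 0<ε → N , λ i N≤i → begin
          seq (∣ x - ℚ→ℝ r ∣ Defs.^ suc b) i  ≡⟨ seq-^ (∣ x - ℚ→ℝ r ∣) (suc b) i ⟩
          dℚ (seq x i) r ^ℚ suc b             ≤⟨ ^-mono-≤ (suc b) (ℚₚ.0≤∣p∣ (seq x i ℚ.- r)) (close i N≤i) ⟩
          recip (D ℕ.^ m) ^ℚ suc b            ≡⟨ sym (recip-^ (D ℕ.^ m) (suc b)) ⟩
          recip ((D ℕ.^ m) ℕ.^ suc b)         ≡⟨ cong recip (ℕₚ.^-*-assoc D m (suc b)) ⟩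
          recip (D ℕ.^ (m ℕ.* suc b))         ≤⟨ recip-anti-≤ (ℕₚ.m^n>0 D a) (ℕₚ.^-monoʳ-≤ D (exponent a b a/b<η)) ⟩
          recip (D ℕ.^ a)                     ≤⟨ ≤-by-slack (ℚₚ.<⇒≤ 0<ε) refl ⟩
          recip (D ℕ.^ a) ℚ.+ ε               ∎
          where open ℚₚ.≤-Reasoning

-- Distance of Liouville numbers from lattices; the rational root theorem

module RationalApproximation where

  open Rationals
  open GaussianRationals renaming (_^_ to _^ℚ_)
  open LiouvilleCriterion
  open import Defs hiding (_^_; -_; _+_; _*_; _≤_; _<_; ∣_∣)
  open RationalLemmas
  open +-*-Solver
  open import Data.Integer.Base as ℤ using (ℤ; +_; -[1+_])
  open import Data.List.Base using (List; []; _∷_)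
  open import Data.List.Membership.Propositional using (_∈_; _∉_)
  open import Data.List.Relation.Unary.Any using (here; there)

  ∣/1∣ : ∀ i → ℚ.∣ i ℚ./ 1 ∣ ≡ ι ℤ.∣ i ∣
  ∣/1∣ i = trans (cong ℚ.∣_∣ (/1-≡-mkℚ i)) (sym (/1-≡-mkℚ (+ ℤ.∣ i ∣)))

  cancel-recip : ∀ F r → 0 ℕ.< F → ι F ℚ.* r ℚ.* recip F ≡ r
  cancel-recip F r 0<F = trans (solve 3 (λ f r i → f :* r :* i := r :* (i :* f)) refl (ι F) r (recip F))
    (trans (cong (r ℚ.*_) (recip-inverse 0<F)) (ℚₚ.*-identityʳ r))

  -- `Infinite` avoids finite lists only, so the lattice (1/F)ℤ is cut off at K/F. Approximations of
  -- a bounded number stay inside the cut-off.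
  grid : ℕ → ℕ → List ℚ
  grid F zero    = 0ℚ ∷ []
  grid F (suc K) = + suc K ℚ./ 1 ℚ.* recip F ∷ -[1+ K ] ℚ./ 1 ℚ.* recip F ∷ grid F K

  grid-complete : ∀ F K i → ℤ.∣ i ∣ ℕ.≤ K → i ℚ./ 1 ℚ.* recip F ∈ grid F K
  grid-complete F zero    (+ zero) _  = here (ℚₚ.*-zeroˡ (recip F))
  grid-complete F (suc K) i le with ℤ.∣ i ∣ ℕₚ.≤? K
  ... | yes ≤K = there (there (grid-complete F K i ≤K))
  ... | no  ≰K = extreme i (ℕₚ.≤-antisym le (ℕₚ.≰⇒> ≰K))
    where
    extreme : ∀ i → ℤ.∣ i ∣ ≡ suc K → i ℚ./ 1 ℚ.* recip F ∈ grid F (suc K)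
    extreme (+ _)    refl = here refl
    extreme -[1+ _ ] refl = there (here refl)

  ∈-grid : ∀ F K r → 0 ℕ.< F → Integral (ι F ℚ.* r) → ι F ℚ.* ℚ.∣ r ∣ ℚ.≤ ι K → r ∈ grid F K
  ∈-grid F K r 0<F (i , eq) le = subst (_∈ grid F K)
    (trans (cong (ℚ._* recip F) (sym eq)) (cancel-recip F r 0<F))
    (grid-complete F K i (ι-cancel-≤ (subst (ℚ._≤ ι K) (begin
      ι F ℚ.* ℚ.∣ r ∣        ≡⟨ cong (ℚ._* ℚ.∣ r ∣) (sym (ℚₚ.0≤p⇒∣p∣≡p (0≤ι F))) ⟩
      ℚ.∣ ι F ∣ ℚ.* ℚ.∣ r ∣  ≡⟨ sym (ℚₚ.∣p*q∣≡∣p∣*∣q∣ (ι F) r) ⟩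
      ℚ.∣ ι F ℚ.* r ∣        ≡⟨ cong ℚ.∣_∣ eq ⟩
      ℚ.∣ i ℚ./ 1 ∣          ≡⟨ ∣/1∣ i ⟩
      ι ℤ.∣ i ∣              ∎) le)))
    where open ≡-Reasoning

  ∣-factorial : ∀ {m n} → 0 ℕ.< m → m ℕ.≤ n → m ℕ∣.∣ n ℕ.!
  ∣-factorial {suc m} {n} _ m≤n = ℕ∣.∣-trans (ℕ∣.m∣m*n (m ℕ.!)) (ℕ∣.m≤n⇒m!∣n! m≤n)

  ∣∣-≤-+d : ∀ p q → ℚ.∣ p ∣ ℚ.≤ ℚ.∣ q ∣ ℚ.+ dℚ q p
  ∣∣-≤-+d p q = subst (λ t → ℚ.∣ t ∣ ℚ.≤ ℚ.∣ q ∣ ℚ.+ dℚ q p) (solve 2 (λ p q → q :- (q :- p) := p) refl p q)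
    (ℚₚ.∣p-q∣≤∣p∣+∣q∣ q (q ℚ.- p))

  recip-absorb : ∀ m n → 0 ℕ.< n → recip m ≡ ι n ℚ.* recip (m ℕ.* n)
  recip-absorb m n 0<n = sym (trans (cong (ι n ℚ.*_) (recip-* m n))
    (trans (solve 3 (λ n p q → n :* (p :* q) := p :* (q :* n)) refl (ι n) (recip m) (recip n))
      (trans (cong (recip m ℚ.*_) (recip-inverse 0<n)) (ℚₚ.*-identityʳ (recip m)))))

  -- An approximation r = y/x of quality x⁻² off the grid (1/B!)ℤ has x > B, and
  -- then differs from every i/B by at least 1/(xB), more than its error.
  liouville-apart : ∀ ζ → 𝓛 ζ → ∀ B → 0 ℕ.< B →
    ∃[ δ ] (0ℚ ℚ.< δ) × ∃[ M ] ∀ i → M ℕ.≤ i → ∀ p → Integral (ι B ℚ.* p) → δ ℚ.≤ dℚ (seq ζ i) p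
  liouville-apart ζ (_ , infinite) B 0<B =
    let A₀ , _ , M₀ , ζ≤A₀ = cauchy-bounded (seq ζ) (cauchy ζ)
        A , A₀≤A = ι-unbounded A₀
        -- A real exponent is tested at rationals strictly below it, so 3 is asked for in order to
        -- use 2. The cut-off is A+2 because |r| ≤ |ζ| + x^-2 + 1, where the last 1 is the slack of
        -- a real inequality.
        r , r∉ , y , k , r≡ , close = infinite (ℕ→ℝ 3) (mk< (1ℚ , 0<1 , 0 , λ _ _ → ι-mono-≤ {1} {3} (s≤s z≤n))) (grid F ((A ℕ.+ 2) ℕ.* F))
    in apart A M₀ (λ i p → ℚₚ.≤-trans (ζ≤A₀ i p) A₀≤A) r r∉ y k r≡
         (close 2 0 (mk< (1ℚ , 0<1 , 0 , λ _ _ → ℚₚ.≤-refl {ι 3})))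
    where
    open CauchyLemmas
    F : ℕ
    F = B ℕ.!
    0<F : 0 ℕ.< F
    0<F = ℕₚ.1≤n! B
    apart : ∀ A M₀ → (∀ i → M₀ ℕ.≤ i → ℚ.∣ seq ζ i ∣ ℚ.≤ ι A) → ∀ r → r ∉ grid F ((A ℕ.+ 2) ℕ.* F) →
      ∀ y k → r ≡ y ℚ./ suc k → ((Defs.∣ ζ - ℚ→ℝ r ∣) Defs.^ 1) Defs.≤ ℚ→ℝ (suc k ^⁻ 2) →
      ∃[ δ ] (0ℚ ℚ.< δ) × ∃[ M ] ∀ i → M ℕ.≤ i → ∀ p → Integral (ι B ℚ.* p) → δ ℚ.≤ dℚ (seq ζ i) p
    apart A M₀ ζ≤A r r∉ y k r≡ close = δ , 0<δ , M₀ ℕ.⊔ M₂ , λ i M≤i p int →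
        δ-bound i (ℕₚ.m⊔n≤o⇒n≤o M₀ M₂ M≤i) p int
      where
      x : ℕ
      x = suc k
      0<x : 0 ℕ.< x
      0<x = s≤s z≤n
      xr-integral : Integral (ι x ℚ.* r)
      xr-integral = y , (begin
        ι x ℚ.* r                        ≡⟨ cong (ι x ℚ.*_) (trans r≡ (/-≡-* y k)) ⟩
        ι x ℚ.* (y ℚ./ 1 ℚ.* recip x)    ≡⟨ sym (ℚₚ.*-assoc (ι x) (y ℚ./ 1) (recip x)) ⟩
        ι x ℚ.* (y ℚ./ 1) ℚ.* recip x    ≡⟨ cancel-recip x (y ℚ./ 1) 0<x ⟩
        y ℚ./ 1                          ∎)
        where open ≡-Reasoning
      near : ∀ ε → 0ℚ ℚ.< ε → ∃[ M ] ∀ i → M ℕ.≤ i → dℚ (seq ζ i) r ℚ.≤ recip (x ℕ.* x) ℚ.+ ε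
      near ε 0<ε = let M , h = un≤ close ε 0<ε in M , λ i M≤i → subst₂ ℚ._≤_
        (ℚₚ.*-identityʳ (dℚ (seq ζ i) r)) (cong (λ t → recip (x ℕ.* t) ℚ.+ ε) (ℕₚ.*-identityʳ x)) (h i M≤i)
      M₁ : ℕ
      M₁ = proj₁ (near 1ℚ 0<1)
      r≤ : ℚ.∣ r ∣ ℚ.≤ ι (A ℕ.+ 2)
      r≤ = let i = M₀ ℕ.⊔ M₁ in ℚₚ.≤-trans (∣∣-≤-+d r (seq ζ i)) (subst (ℚ.∣ seq ζ i ∣ ℚ.+ dℚ (seq ζ i) r ℚ.≤_) (sym (ι-+ A 2))
        (ℚₚ.+-mono-≤ (ζ≤A i (ℕₚ.m≤m⊔n M₀ M₁)) (ℚₚ.≤-trans (proj₂ (near 1ℚ 0<1) i (ℕₚ.m≤n⊔m M₀ M₁))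
          (ℚₚ.+-monoˡ-≤ 1ℚ (recip-≤-1 (x ℕ.* x))))))
      off-grid : ¬ Integral (ι F ℚ.* r)
      off-grid int = r∉ (∈-grid F ((A ℕ.+ 2) ℕ.* F) r 0<F int (subst (ι F ℚ.* ℚ.∣ r ∣ ℚ.≤_)
        (trans (ℚₚ.*-comm (ι F) (ι (A ℕ.+ 2))) (sym (ι-* (A ℕ.+ 2) F))) (*-monoˡ (ι F) (0≤ι F) r≤)))
      B<x : B ℕ.< x
      B<x = ℕₚ.≰⇒> λ x≤B → off-grid (Integral-∣ {x} {F} (∣-factorial 0<x x≤B) xr-integral)
      D : ℕ
      D = x ℕ.* x ℕ.* B
      0<D : 0 ℕ.< D
      0<D = ℕₚ.*-mono-≤ (ℕₚ.*-mono-≤ 0<x 0<x) 0<B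
      δ : ℚ
      -- In units of 1/D the separation 1/(xB) of r from p is x and the error x^-2 is B. Since x ≥
      -- B+1, one unit is left; half of it is spent on the slack in `near`.
      δ = ½ ℚ.* recip D
      0<δ : 0ℚ ℚ.< δ
      0<δ = ½-pos (recip-pos 0<D)
      M₂ : ℕ
      M₂ = proj₁ (near δ 0<δ)
      recip-xx : recip (x ℕ.* x) ≡ ι B ℚ.* recip D
      recip-xx = recip-absorb (x ℕ.* x) B 0<B
      recip-xB : recip (x ℕ.* B) ≡ ι x ℚ.* recip D
      recip-xB = trans (recip-absorb (x ℕ.* B) x 0<x) (cong (λ t → ι x ℚ.* recip t)
        (trans (ℕₚ.*-assoc x B x) (trans (cong (x ℕ.*_) (ℕₚ.*-comm B x)) (sym (ℕₚ.*-assoc x x B)))))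
      δ-bound : ∀ i → M₂ ℕ.≤ i → ∀ p → Integral (ι B ℚ.* p) → δ ℚ.≤ dℚ (seq ζ i) p
      δ-bound i M≤i p int = combine-≤ {x₁ = (1ℚ ℚ.+ ι B) ℚ.* recip D}
        (*-monoʳ (recip D) (recip-nonNeg D) (subst (ℚ._≤ ι x) (ι-suc B) (ι-mono-≤ B<x)))
        (subst₂ ℚ._≤_ recip-xB (cong (λ t → t ℚ.+ δ ℚ.+ dℚ (seq ζ i) p) recip-xx)
          (ℚₚ.≤-trans separated (ℚₚ.≤-trans (d-triangle r (seq ζ i) p)
            (ℚₚ.+-monoˡ-≤ (dℚ (seq ζ i) p) (subst (ℚ._≤ recip (x ℕ.* x) ℚ.+ δ) (d-sym (seq ζ i) r) (proj₂ (near δ 0<δ) i M≤i))))))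
        (solve 4 (λ d u b x → d :+ ((con 1ℚ :+ b) :* u :+ x :* u) := con ½ :* u :+ (x :* u :+ (b :* u :+ con ½ :* u :+ d))) refl
          (dℚ (seq ζ i) p) (recip D) (ι B) (ι x))
        where
        r≢p : r ≢ p
        r≢p refl = off-grid (Integral-∣ {B} {F} (∣-factorial 0<B ℕₚ.≤-refl) int)
        xB-integral : Integral (ι (x ℕ.* B) ℚ.* (r ℚ.- p))
        xB-integral = subst Integral
          (trans (solve 4 (λ b x p r → b :* (x :* r) :+ (:- (x :* (b :* p))) := x :* b :* (r :- p)) refl (ι B) (ι x) p r)
            (cong (ℚ._* (r ℚ.- p)) (sym (ι-* x B))))
          (Integral-+ (Integral-* (Integral-ι B) xr-integral) (Integral-neg (Integral-* (Integral-ι x) int)))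
        separated : recip (x ℕ.* B) ℚ.≤ dℚ r p
        separated = *-cancelʳ-≤ (ι (x ℕ.* B)) (0<ι 0<xB) (subst₂ ℚ._≤_ (sym (recip-inverse 0<xB)) (ℚₚ.*-comm (ι (x ℕ.* B)) (dℚ r p))
          (integral-apart (x ℕ.* B) 0<xB xB-integral (minus-≢0 r≢p)))
          where
          0<xB : 0 ℕ.< x ℕ.* B
          0<xB = ℕₚ.*-mono-≤ 0<x 0<B

  -- The integer nearest to q ζ_i may change with i, so it is read off at one late index `M` and
  -- kept. The two slacks of c/2 raise the error to 2c, and division by q ≥ 2 brings it back to c.
  nearest-fraction : ∀ ζ q N → 2 ℕ.≤ q → (‖ ℕ→ℝ q Defs.* ζ ‖ Defs.≤ ℚ→ℝ (q ^⁻ N)) →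
    ∃[ p ] Integral (ι q ℚ.* p) × ∃[ M ] ∀ i → M ℕ.≤ i → dℚ (seq ζ i) p ℚ.≤ recip (q ℕ.^ N)
  nearest-fraction ζ q N 2≤q le = y ℚ./ 1 ℚ.* recip q ,
      (y , trans (sym (ℚₚ.*-assoc (ι q) (y ℚ./ 1) (recip q))) (cancel-recip q (y ℚ./ 1) 0<q)) , M , bound
    where
    0<q : 0 ℕ.< q
    0<q = ℕₚ.≤-trans (s≤s z≤n) 2≤q
    c : ℚ
    c = recip (q ℕ.^ N)
    0<c : 0ℚ ℚ.< c
    0<c = recip-pos (ℕₚ.m^n>0 q {{ℕ.>-nonZero 0<q}} N)
    M₁ M₂ M : ℕ
    M₁ = proj₁ (un≤ le (½ ℚ.* c) (½-pos 0<c))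
    M₂ = proj₁ (cauchy (ℕ→ℝ q Defs.* ζ) (½ ℚ.* c) (½-pos 0<c))
    M = M₁ ℕ.⊔ M₂
    y : ℤ
    y = proj₁ (distℤℚ-attained (ι q ℚ.* seq ζ M))
    far : dℚ (ι q ℚ.* seq ζ M) (y ℚ./ 1) ℚ.≤ c ℚ.+ ½ ℚ.* c
    far = subst (ℚ._≤ c ℚ.+ ½ ℚ.* c) (proj₂ (distℤℚ-attained (ι q ℚ.* seq ζ M)))
      (proj₂ (un≤ le (½ ℚ.* c) (½-pos 0<c)) M (ℕₚ.m≤m⊔n M₁ M₂))
    bound : ∀ i → M ℕ.≤ i → dℚ (seq ζ i) (y ℚ./ 1 ℚ.* recip q) ℚ.≤ c
    bound i M≤i = *-cancelʳ-≤ (ι q) (0<ι 0<q) (begin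
      dℚ (seq ζ i) (y ℚ./ 1 ℚ.* recip q) ℚ.* ι q              ≡⟨ cong (dℚ (seq ζ i) (y ℚ./ 1 ℚ.* recip q) ℚ.*_) (sym (ℚₚ.0≤p⇒∣p∣≡p (0≤ι q))) ⟩
      dℚ (seq ζ i) (y ℚ./ 1 ℚ.* recip q) ℚ.* ℚ.∣ ι q ∣        ≡⟨ sym (ℚₚ.∣p*q∣≡∣p∣*∣q∣ (seq ζ i ℚ.- y ℚ./ 1 ℚ.* recip q) (ι q)) ⟩
      ℚ.∣ (seq ζ i ℚ.- y ℚ./ 1 ℚ.* recip q) ℚ.* ι q ∣         ≡⟨ cong ℚ.∣_∣ (trans
        (solve 4 (λ z y r q → (z :- y :* r) :* q := q :* z :- q :* y :* r) refl (seq ζ i) (y ℚ./ 1) (recip q) (ι q))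
        (cong (λ t → ι q ℚ.* seq ζ i ℚ.- t) (cancel-recip q (y ℚ./ 1) 0<q))) ⟩
      dℚ (ι q ℚ.* seq ζ i) (y ℚ./ 1)                          ≤⟨ d-triangle (ι q ℚ.* seq ζ i) (ι q ℚ.* seq ζ M) (y ℚ./ 1) ⟩
      dℚ (ι q ℚ.* seq ζ i) (ι q ℚ.* seq ζ M) ℚ.+ dℚ (ι q ℚ.* seq ζ M) (y ℚ./ 1)
        ≤⟨ ℚₚ.+-mono-≤ (proj₂ (cauchy (ℕ→ℝ q Defs.* ζ) (½ ℚ.* c) (½-pos 0<c)) i M (ℕₚ.≤-trans (ℕₚ.m≤n⊔m M₁ M₂) M≤i) (ℕₚ.m≤n⊔m M₁ M₂)) far ⟩
      ½ ℚ.* c ℚ.+ (c ℚ.+ ½ ℚ.* c)                             ≡⟨ solve 1 (λ c → con ½ :* c :+ (c :+ con ½ :* c) := c :* con (ι 2)) refl c ⟩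
      c ℚ.* ι 2                                               ≤⟨ *-monoˡ c (ℚₚ.<⇒≤ 0<c) (ι-mono-≤ 2≤q) ⟩
      c ℚ.* ι q                                               ∎)
      where open ℚₚ.≤-Reasoning

  psumℚ-integral : ∀ a E x q n → Integral (ι q ℚ.* x) → (∀ j → j ℕ.≤ n → Integral (ι E ℚ.* a j)) →
    Integral (ι E ℚ.* psumℚ a (suc n) x ℚ.* ι q ^ℚ n)
  psumℚ-integral a E x q₀ zero    qx int = subst Integral
    (solve 2 (λ e a → e :* a := e :* (con 0ℚ :+ a :* con 1ℚ) :* con 1ℚ) refl (ι E) (a 0)) (int 0 z≤n)
  psumℚ-integral a E x q₀ (suc n) qx int = subst Integral eq (Integral-+
    (Integral-* (psumℚ-integral a E x q₀ n qx (λ j j≤n → int j (ℕₚ.m≤n⇒m≤1+n j≤n))) (Integral-ι q₀))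
    (Integral-* (int (suc n) ℕₚ.≤-refl) (Integral-^ (suc n) qx)))
    where
    Integral-^ : ∀ {p} n → Integral p → Integral (p ^ℚ n)
    Integral-^ zero    int = Integral-ι 1
    Integral-^ (suc n) int = Integral-* int (Integral-^ n int)
    q = ι q₀
    eq : ι E ℚ.* psumℚ a (suc n) x ℚ.* q ^ℚ n ℚ.* q ℚ.+ ι E ℚ.* a (suc n) ℚ.* (q ℚ.* x) ^ℚ suc n
      ≡ ι E ℚ.* (psumℚ a (suc n) x ℚ.+ a (suc n) ℚ.* x ^ℚ suc n) ℚ.* q ^ℚ suc n
    eq = trans (cong (λ t → ι E ℚ.* psumℚ a (suc n) x ℚ.* q ^ℚ n ℚ.* q ℚ.+ ι E ℚ.* a (suc n) ℚ.* t) (^-distrib-* q x (suc n)))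
      (solve 6 (λ e s a q Q X → e :* s :* Q :* q :+ e :* a :* (q :* Q :* X) := e :* (s :+ a :* X) :* (q :* Q)) refl
        (ι E) (psumℚ a (suc n) x) (a (suc n)) q (q ^ℚ n) (x ^ℚ suc n))

  coprime-power-divisor : ∀ {q p B} n → Coprimality.Coprime q p → q ℕ∣.∣ p ℕ.^ n ℕ.* B → q ℕ∣.∣ B
  coprime-power-divisor {q} {p} {B} zero    c q∣ = subst (q ℕ∣.∣_) (ℕₚ.*-identityˡ B) q∣
  coprime-power-divisor {q} {p} {B} (suc n) c q∣ = coprime-power-divisor n c
    (Coprimality.coprime-divisor c (subst (q ℕ∣.∣_) (ℕₚ.*-assoc p (p ℕ.^ n) B) q∣))

  -- Clearing denominators, ↧ x divides B (↥ x)ⁿ⁺¹, hence B.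
  rational-root : ∀ a n E x B → 0 ℕ.< E → a (suc n) ≡ recip E → (∀ j → j ℕ.≤ n → Integral (ι E ℚ.* a j)) →
    Integral (ι B ℚ.* psumℚ a (suc (suc n)) x) → Integral (ι B ℚ.* x)
  rational-root a n E x@(ℚ.mkℚ p k c) B 0<E leading int value-int =
    Integral-∣ {q} {B} (coprime-power-divisor (suc n) (Coprimality.sym (Coprimality.recompute c)) q∣) (↧-*-integral x)
    where
    q : ℕ
    q = suc k
    S = psumℚ a (suc n) x
    t-integral : Integral (ι E ℚ.* ι q ^ℚ n ℚ.* (ι B ℚ.* (S ℚ.+ a (suc n) ℚ.* x ^ℚ suc n)) ℚ.+ ℚ.- (ι B ℚ.* (ι E ℚ.* S ℚ.* ι q ^ℚ n)))
    t-integral = Integral-+ (Integral-* (Integral-* (Integral-ι E) (subst Integral (ι-^ q n) (Integral-ι (q ℕ.^ n)))) value-int)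
      (Integral-neg (Integral-* (Integral-ι B) (psumℚ-integral a E x q n (↧-*-integral x) int)))
    t : ℤ
    t = proj₁ t-integral
    qx : ι q ℚ.* x ≡ p ℚ./ 1
    qx = proj₂ (↧-*-integral x)
    key : ι q ℚ.* (t ℚ./ 1) ≡ (p ℚ./ 1) ^ℚ suc n ℚ.* ι B
    key = begin
      ι q ℚ.* (t ℚ./ 1)
        ≡⟨ cong (ι q ℚ.*_) (sym (proj₂ t-integral)) ⟩
      ι q ℚ.* (ι E ℚ.* ι q ^ℚ n ℚ.* (ι B ℚ.* (S ℚ.+ a (suc n) ℚ.* x ^ℚ suc n)) ℚ.+ ℚ.- (ι B ℚ.* (ι E ℚ.* S ℚ.* ι q ^ℚ n)))
        ≡⟨ cong (λ l → ι q ℚ.* (ι E ℚ.* ι q ^ℚ n ℚ.* (ι B ℚ.* (S ℚ.+ l ℚ.* x ^ℚ suc n)) ℚ.+ ℚ.- (ι B ℚ.* (ι E ℚ.* S ℚ.* ι q ^ℚ n)))) leading ⟩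
      ι q ℚ.* (ι E ℚ.* ι q ^ℚ n ℚ.* (ι B ℚ.* (S ℚ.+ recip E ℚ.* x ^ℚ suc n)) ℚ.+ ℚ.- (ι B ℚ.* (ι E ℚ.* S ℚ.* ι q ^ℚ n)))
        ≡⟨ solve 7 (λ q e Q b s r X → q :* (e :* Q :* (b :* (s :+ r :* X)) :+ (:- (b :* (e :* s :* Q)))) := r :* e :* (q :* Q :* X :* b)) refl
            (ι q) (ι E) (ι q ^ℚ n) (ι B) S (recip E) (x ^ℚ suc n) ⟩
      recip E ℚ.* ι E ℚ.* (ι q ^ℚ suc n ℚ.* x ^ℚ suc n ℚ.* ι B)
        ≡⟨ cong (ℚ._* (ι q ^ℚ suc n ℚ.* x ^ℚ suc n ℚ.* ι B)) (recip-inverse 0<E) ⟩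
      1ℚ ℚ.* (ι q ^ℚ suc n ℚ.* x ^ℚ suc n ℚ.* ι B)
        ≡⟨ ℚₚ.*-identityˡ _ ⟩
      ι q ^ℚ suc n ℚ.* x ^ℚ suc n ℚ.* ι B
        ≡⟨ cong (ℚ._* ι B) (trans (sym (^-distrib-* (ι q) x (suc n))) (cong (_^ℚ suc n) qx)) ⟩
      (p ℚ./ 1) ^ℚ suc n ℚ.* ι B ∎
      where open ≡-Reasoning
    absolute : q ℕ.* ℤ.∣ t ∣ ≡ ℤ.∣ p ∣ ℕ.^ suc n ℕ.* B
    absolute = ℤₚ.+-injective (/1-injective (begin
      ι (q ℕ.* ℤ.∣ t ∣)                            ≡⟨ ι-* q ℤ.∣ t ∣ ⟩
      ι q ℚ.* ι ℤ.∣ t ∣                            ≡⟨ sym (cong₂ ℚ._*_ (∣/1∣ (+ q)) (∣/1∣ t)) ⟩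
      ℚ.∣ ι q ∣ ℚ.* ℚ.∣ t ℚ./ 1 ∣                  ≡⟨ sym (ℚₚ.∣p*q∣≡∣p∣*∣q∣ (ι q) (t ℚ./ 1)) ⟩
      ℚ.∣ ι q ℚ.* (t ℚ./ 1) ∣                      ≡⟨ cong ℚ.∣_∣ key ⟩
      ℚ.∣ (p ℚ./ 1) ^ℚ suc n ℚ.* ι B ∣             ≡⟨ ℚₚ.∣p*q∣≡∣p∣*∣q∣ ((p ℚ./ 1) ^ℚ suc n) (ι B) ⟩
      ℚ.∣ (p ℚ./ 1) ^ℚ suc n ∣ ℚ.* ℚ.∣ ι B ∣       ≡⟨ cong₂ ℚ._*_ (trans (∣∣-^ (p ℚ./ 1) (suc n)) (trans (cong (_^ℚ suc n) (∣/1∣ p)) (sym (ι-^ ℤ.∣ p ∣ (suc n))))) (∣/1∣ (+ B)) ⟩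
      ι (ℤ.∣ p ∣ ℕ.^ suc n) ℚ.* ι B                ≡⟨ sym (ι-* (ℤ.∣ p ∣ ℕ.^ suc n) B) ⟩
      ι (ℤ.∣ p ∣ ℕ.^ suc n ℕ.* B)                  ∎))
      where open ≡-Reasoning
    q∣ : q ℕ∣.∣ ℤ.∣ p ∣ ℕ.^ suc n ℕ.* B
    q∣ = ℕ∣.divides ℤ.∣ t ∣ (trans (sym absolute) (ℕₚ.*-comm q ℤ.∣ t ∣))

-- Construction of the denominators and growth of the coefficients

module Denominators where

  open Rationals
  open GaussianRationals renaming (_^_ to _^ℚ_)
  open PowerSeries
  open EntireFunctions
  open RationalApproximation
  open import Data.Rational.Base using (_+_; _*_; _-_; -_; _≤_; _<_; ∣_∣; _/_)
  open +-*-Solver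

  _*>_ : ∀ {m n} → 0 ℕ.< m → 0 ℕ.< n → 0 ℕ.< m ℕ.* n
  _*>_ = ℕₚ.*-mono-≤

  ^>0 : ∀ {m} n → 0 ℕ.< m → 0 ℕ.< m ℕ.^ n
  ^>0 {m} n 0<m = ℕₚ.m^n>0 m {{ℕ.>-nonZero 0<m}} n

  ≤-*ˡ : ∀ {m n} → 0 ℕ.< m → n ℕ.≤ m ℕ.* n
  ≤-*ˡ {m} {n} 0<m = ℕₚ.m≤n*m n m {{ℕ.>-nonZero 0<m}}

  ≤-*ʳ : ∀ {m n} → 0 ℕ.< n → m ℕ.≤ m ℕ.* n
  ≤-*ʳ {m} {n} 0<n = ℕₚ.m≤m*n m n {{ℕ.>-nonZero 0<n}}

  ≤-^ : ∀ {m} n → 0 ℕ.< m → 0 ℕ.< n → m ℕ.≤ m ℕ.^ n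
  ≤-^ {m} (suc n) 0<m _ = ≤-*ʳ (^>0 n 0<m)

  -- The product (j+1)(j+2)...(j+s), which s differentiations put in front of the coefficient of
  -- index j+s.
  rising : ℕ → ℕ → ℕ
  rising zero    j = 1
  rising (suc s) j = suc j ℕ.* rising s (suc j)

  rising-! : ∀ s j → rising s j ℕ.* j ℕ.! ≡ (j ℕ.+ s) ℕ.!
  rising-! zero    j = trans (ℕₚ.*-identityˡ (j ℕ.!)) (cong ℕ._! (sym (ℕₚ.+-identityʳ j)))
  rising-! (suc s) j = trans (cong (ℕ._* j ℕ.!) (ℕₚ.*-comm (suc j) (rising s (suc j))))
    (trans (ℕₚ.*-assoc (rising s (suc j)) (suc j) (j ℕ.!)) (trans (rising-! s (suc j)) (cong ℕ._! (sym (ℕₚ.+-suc j s)))))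

  rising-pos : ∀ s j → 0 ℕ.< rising s j
  rising-pos zero    j = s≤s z≤n
  rising-pos (suc s) j = _*>_ {suc j} (s≤s z≤n) (rising-pos s (suc j))

  -- φ̂ bounds φ on the integers; the multipliers t m = choice m _ _ are left free
  -- for the diagonalisation.
  module Construction (φ̂ : ℕ → ℕ) (choice : ℕ → ℕ → ℚ → ℕ) (choice-pos : ∀ m A P → 0 ℕ.< choice m A P) where

    -- At this exponent N, q^N exceeds 2m (d qᵐ)ᵐ for all q ≥ 2.
    exponent : ℕ → ℕ → ℕ
    exponent m d = m ℕ.* m ℕ.+ (2 ℕ.+ 2 ℕ.* m ℕ.* d ℕ.^ m)

    height : ℕ → ℕ → ℕ
    height m d = φ̂ (exponent m d) ℕ.+ suc m

    precision : ℕ → ℕ → ℕ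
    precision m d = (d ℕ.* height m d ℕ.^ m) ℕ.^ m

    -- The power (m+1)^(m+1) outgrows those of any radius R ≤ m+1, and 2^m makes the tail geometric.
    -- With the 4, the tail sums to at most half of the permitted error; the other half is for
    -- replacing ζ by a fraction.
    growth : ℕ → ℕ → ℕ
    growth m d = 4 ℕ.* 2 ℕ.^ m ℕ.* suc m ℕ.^ suc m ℕ.* precision m d

    -- The rising factorial produced by s ≤ m differentiations in the numerator over d_(m+1) divides
    -- (m+1)!. Hence for all these s at once the coefficient remains the reciprocal of a multiple of
    -- d_m.
    candidate : ℕ → ℕ → ℕ
    candidate m d = suc m ℕ.! ℕ.* (d ℕ.* growth m d)

    opaque
      -- The partial sum at 1 is carried along because the multiplier is chosen by comparing it with
      -- the value to be avoided.
      state : ℕ → ℕ × ℚ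
      state zero    = 1 , 1ℚ
      state (suc m) = let d , P = state m ; d′ = choice m (candidate m d) P ℕ.* candidate m d in d′ , P + recip d′

    d : ℕ → ℕ
    d m = proj₁ (state m)

    P : ℕ → ℚ
    P m = proj₂ (state m)

    A M T Q t : ℕ → ℕ
    A m = candidate m (d m)
    M m = growth m (d m)
    T m = precision m (d m)
    Q m = height m (d m)
    t m = choice m (A m) (P m)

    opaque
      unfolding state

      d-zero : d 0 ≡ 1
      d-zero = refl

      d-suc : ∀ m → d (suc m) ≡ t m ℕ.* A m
      d-suc m = refl

      P-zero : P 0 ≡ 1ℚ
      P-zero = refl

      P-suc : ∀ m → P (suc m) ≡ P m + recip (d (suc m))
      P-suc m = refl

    t-pos : ∀ m → 0 ℕ.< t m
    t-pos m = choice-pos m (A m) (P m)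

    Q-pos : ∀ m → 0 ℕ.< Q m
    Q-pos m = ℕₚ.≤-trans (s≤s z≤n) (ℕₚ.m≤n+m (suc m) (φ̂ (exponent m (d m))))

    module _ (m : ℕ) (0<d : 0 ℕ.< d m) where

      T-pos′ : 0 ℕ.< T m
      T-pos′ = ^>0 m (0<d *> ^>0 m (Q-pos m))

      M-pos′ : 0 ℕ.< M m
      M-pos′ = _*>_ {4 ℕ.* 2 ℕ.^ m ℕ.* suc m ℕ.^ suc m} (_*>_ {4 ℕ.* 2 ℕ.^ m} (_*>_ {4} (s≤s z≤n) (^>0 {2} m (s≤s z≤n))) (^>0 {suc m} (suc m) (s≤s z≤n))) T-pos′

      A-pos′ : 0 ℕ.< A m
      A-pos′ = _*>_ {suc m ℕ.!} (ℕₚ.1≤n! (suc m)) (0<d *> M-pos′)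

    d-pos : ∀ m → 0 ℕ.< d m
    d-pos zero    = subst (0 ℕ.<_) (sym d-zero) (s≤s z≤n)
    d-pos (suc m) = subst (0 ℕ.<_) (sym (d-suc m)) (t-pos m *> A-pos′ m (d-pos m))

    T-pos : ∀ m → 0 ℕ.< T m
    T-pos m = T-pos′ m (d-pos m)

    M-pos : ∀ m → 0 ℕ.< M m
    M-pos m = M-pos′ m (d-pos m)

    A-pos : ∀ m → 0 ℕ.< A m
    A-pos m = A-pos′ m (d-pos m)

    M≤A : ∀ m → M m ℕ.≤ A m
    M≤A m = ℕₚ.≤-trans (≤-*ˡ (d-pos m)) (≤-*ˡ {suc m ℕ.!} (ℕₚ.1≤n! (suc m)))

    M≤d : ∀ m → M m ℕ.≤ d (suc m)
    M≤d m = subst (M m ℕ.≤_) (sym (d-suc m)) (ℕₚ.≤-trans (M≤A m) (≤-*ˡ (t-pos m)))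

    T≤M : ∀ m → T m ℕ.≤ M m
    T≤M m = ≤-*ˡ {4 ℕ.* 2 ℕ.^ m ℕ.* suc m ℕ.^ suc m} (_*>_ {4 ℕ.* 2 ℕ.^ m} (_*>_ {4} (s≤s z≤n) (^>0 {2} m (s≤s z≤n))) (^>0 {suc m} (suc m) (s≤s z≤n)))

    d≤T : ∀ m → 0 ℕ.< m → d m ℕ.≤ T m
    d≤T m 0<m = ℕₚ.≤-trans (≤-*ʳ (^>0 m (Q-pos m))) (≤-^ m (d-pos m *> ^>0 m (Q-pos m)) 0<m)

    T-mono-suc : ∀ m → T m ℕ.≤ T (suc m)
    T-mono-suc m = ℕₚ.≤-trans (T≤M m) (ℕₚ.≤-trans (M≤d m) (d≤T (suc m) (s≤s z≤n)))

    T-mono : ∀ i m → T m ℕ.≤ T (i ℕ.+ m)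
    T-mono zero    m = ℕₚ.≤-refl
    T-mono (suc i) m = ℕₚ.≤-trans (T-mono i m) (T-mono-suc (i ℕ.+ m))

    m^m≤d : ∀ m → m ℕ.^ m ℕ.≤ d m
    m^m≤d zero    = d-pos 0
    m^m≤d (suc m) = ℕₚ.≤-trans (ℕₚ.≤-trans (≤-*ˡ {4 ℕ.* 2 ℕ.^ m} (_*>_ {4} (s≤s z≤n) (^>0 {2} m (s≤s z≤n)))) (≤-*ʳ (T-pos m))) (M≤d m)

    m≤d : ∀ m → m ℕ.≤ d m
    m≤d zero    = z≤n
    m≤d (suc m) = ℕₚ.≤-trans (≤-^ {suc m} (suc m) (s≤s z≤n) (s≤s z≤n)) (m^m≤d (suc m))

    d-∣ : ∀ i m → d m ℕ∣.∣ d (i ℕ.+ m)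
    d-∣ zero    m = ℕ∣.∣-refl
    d-∣ (suc i) m = ℕ∣.∣-trans (d-∣ i m) (subst (d (i ℕ.+ m) ℕ∣.∣_) (sym (d-suc (i ℕ.+ m)))
      (ℕ∣.∣n⇒∣m*n (t (i ℕ.+ m)) (ℕ∣.∣n⇒∣m*n (suc (i ℕ.+ m) ℕ.!) (ℕ∣.m∣m*n (M (i ℕ.+ m))))))

    c : ℕ → ℚ
    c j = recip (d j)

    -- R^j ≤ R^R d_j in either case: for j ≥ R because R^j ≤ j^j ≤ d_j, and for j ≤ R because R^j ≤
    -- R^R.
    c-decay : Decay c
    c-decay R = R ℕ.^ R , λ j → subst₂ _≤_ (lhs j) (rhs j)
      (*-monoʳ (recip (d j)) (recip-nonNeg (d j)) (ι-mono-≤ (R^j≤ j)))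
      where
      lhs : ∀ j → ι (R ℕ.^ j) * recip (d j) ≡ ∣ c j ∣ * ι R ^ℚ j
      lhs j = trans (ℚₚ.*-comm (ι (R ℕ.^ j)) (recip (d j)))
        (cong₂ _*_ (sym (ℚₚ.0≤p⇒∣p∣≡p (recip-nonNeg (d j)))) (ι-^ R j))
      rhs : ∀ j → ι (R ℕ.^ R ℕ.* d j) * recip (d j) ≡ ι (R ℕ.^ R)
      rhs j = trans (cong (_* recip (d j)) (ι-* (R ℕ.^ R) (d j))) (trans (ℚₚ.*-assoc (ι (R ℕ.^ R)) (ι (d j)) (recip (d j)))
        (trans (cong (ι (R ℕ.^ R) *_) (trans (ℚₚ.*-comm (ι (d j)) (recip (d j))) (recip-inverse (d-pos j)))) (ℚₚ.*-identityʳ _)))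
      R^R-pos : ∀ R → 0 ℕ.< R ℕ.^ R
      R^R-pos zero    = s≤s z≤n
      R^R-pos (suc R) = ^>0 {suc R} (suc R) (s≤s z≤n)
      R^j≤ : ∀ j → R ℕ.^ j ℕ.≤ R ℕ.^ R ℕ.* d j
      R^j≤ j with ℕₚ.≤-total R j
      ... | inj₁ R≤j = ℕₚ.≤-trans (ℕₚ.≤-trans (ℕₚ.^-monoˡ-≤ j R≤j) (m^m≤d j)) (≤-*ˡ (R^R-pos R))
      ... | inj₂ j≤R = ℕₚ.≤-trans (R^j≤R^R R j≤R) (≤-*ʳ (d-pos j))
        where
        R^j≤R^R : ∀ R → j ℕ.≤ R → R ℕ.^ j ℕ.≤ R ℕ.^ R
        R^j≤R^R zero    z≤n = ℕₚ.≤-refl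
        R^j≤R^R (suc R) j≤R = ℕₚ.^-monoʳ-≤ (suc R) j≤R

    coeff : ℕ → ℕ → ℚ
    coeff s = deriv^ s c

    coeff-≡ : ∀ s j → coeff s j ≡ ι (rising s j) * recip (d (j ℕ.+ s))
    coeff-≡ zero    j = trans (cong c (sym (ℕₚ.+-identityʳ j))) (sym (ℚₚ.*-identityˡ (recip (d (j ℕ.+ 0)))))
    coeff-≡ (suc s) j = trans (cong (ι (suc j) *_) (coeff-≡ s (suc j))) (trans
      (sym (ℚₚ.*-assoc (ι (suc j)) (ι (rising s (suc j))) (recip (d (suc j ℕ.+ s)))))
      (cong₂ _*_ (sym (ι-* (suc j) (rising s (suc j)))) (cong (λ k → recip (d k)) (sym (ℕₚ.+-suc j s)))))

    -- The quotient of d_(j+1+s) by the rising factorial in the coefficient of index j+1: the factor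
    -- (j+s+1)! is replaced by (j+1)!.
    E : ℕ → ℕ → ℕ
    E s j = t (j ℕ.+ s) ℕ.* (suc j ℕ.! ℕ.* (d (j ℕ.+ s) ℕ.* M (j ℕ.+ s)))

    E-pos : ∀ s j → 0 ℕ.< E s j
    E-pos s j = t-pos (j ℕ.+ s) *> (_*>_ {suc j ℕ.!} (ℕₚ.1≤n! (suc j)) (d-pos (j ℕ.+ s) *> M-pos (j ℕ.+ s)))

    M≤E : ∀ s j → M (j ℕ.+ s) ℕ.≤ E s j
    M≤E s j = ℕₚ.≤-trans (≤-*ˡ (d-pos (j ℕ.+ s))) (ℕₚ.≤-trans (≤-*ˡ {suc j ℕ.!} (ℕₚ.1≤n! (suc j))) (≤-*ˡ (t-pos (j ℕ.+ s))))

    coeff-suc : ∀ s j → coeff s (suc j) ≡ recip (E s j)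
    coeff-suc s j = trans (coeff-≡ s (suc j)) (trans (cong (λ k → ι (rising s (suc j)) * recip k) eq)
      (sym (recip-absorb (E s j) (rising s (suc j)) (rising-pos s (suc j)))))
      where
      m = j ℕ.+ s
      eq : d (suc m) ≡ E s j ℕ.* rising s (suc j)
      eq = begin
        d (suc m)                                                    ≡⟨ d-suc m ⟩
        t m ℕ.* (suc m ℕ.! ℕ.* (d m ℕ.* M m))                        ≡⟨ cong (λ k → t m ℕ.* (k ℕ.* (d m ℕ.* M m))) (sym (rising-! s (suc j))) ⟩
        t m ℕ.* (rising s (suc j) ℕ.* suc j ℕ.! ℕ.* (d m ℕ.* M m))   ≡⟨ reorder (t m) (rising s (suc j)) (suc j ℕ.!) (d m ℕ.* M m) ⟩
        E s j ℕ.* rising s (suc j)                                   ∎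
        where
        open ≡-Reasoning
        reorder : ∀ t r f x → t ℕ.* (r ℕ.* f ℕ.* x) ≡ t ℕ.* (f ℕ.* x) ℕ.* r
        reorder = ℕ-Solver.solve 4 (λ t r f x → t ℕ-Solver.:* (r ℕ-Solver.:* f ℕ-Solver.:* x)
          ℕ-Solver.:= t ℕ-Solver.:* (f ℕ-Solver.:* x) ℕ-Solver.:* r) refl

    d∣E : ∀ s j → d (j ℕ.+ s) ℕ∣.∣ E s j
    d∣E s j = ℕ∣.∣n⇒∣m*n (t (j ℕ.+ s)) (ℕ∣.∣n⇒∣m*n (suc j ℕ.!) (ℕ∣.m∣m*n (M (j ℕ.+ s))))

    coeff-integral : ∀ s n j → j ℕ.≤ n → Integral (ι (d (n ℕ.+ s)) * coeff s j)
    coeff-integral s n j j≤n = Integral-∣ {d (j ℕ.+ s)} {d (n ℕ.+ s)}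
      (subst (λ k → d (j ℕ.+ s) ℕ∣.∣ d k) (trans (sym (ℕₚ.+-assoc (n ℕ.∸ j) j s)) (cong (ℕ._+ s) (ℕₚ.m∸n+n≡m j≤n))) (d-∣ (n ℕ.∸ j) (j ℕ.+ s)))
      (subst Integral (sym (begin
        ι (d (j ℕ.+ s)) * coeff s j                                   ≡⟨ cong (ι (d (j ℕ.+ s)) *_) (coeff-≡ s j) ⟩
        ι (d (j ℕ.+ s)) * (ι (rising s j) * recip (d (j ℕ.+ s)))      ≡⟨ solve 3 (λ a b c → a :* (b :* c) := b :* (c :* a)) refl (ι (d (j ℕ.+ s))) (ι (rising s j)) (recip (d (j ℕ.+ s))) ⟩
        ι (rising s j) * (recip (d (j ℕ.+ s)) * ι (d (j ℕ.+ s)))      ≡⟨ cong (ι (rising s j) *_) (recip-inverse (d-pos (j ℕ.+ s))) ⟩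
        ι (rising s j) * 1ℚ                                           ≡⟨ ℚₚ.*-identityʳ _ ⟩
        ι (rising s j)                                                ∎)) (Integral-ι (rising s j)))
      where open ≡-Reasoning

    coeff-bound : ∀ s n i R D → R ℕ.≤ suc (n ℕ.+ s) → 0 ℕ.< D → D ℕ.≤ T (n ℕ.+ s) →
      ∣ coeff s (i ℕ.+ suc n) ∣ * ι R ^ℚ (i ℕ.+ suc n) ≤ recip (4 ℕ.* D) * ½ ^ℚ i
    coeff-bound s n i R D R≤ 0<D D≤T = subst₂ _≤_ lhs rhs
      (frac-≤ {R ℕ.^ suc (i ℕ.+ n)} (E-pos s (i ℕ.+ n)) (_*>_ {4 ℕ.* D} (_*>_ {4} (s≤s z≤n) 0<D) (^>0 {2} i (s≤s z≤n))) (ℕₚ.≤-trans bound (M≤E s (i ℕ.+ n))))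
      where
      m = n ℕ.+ s
      lhs : ι (R ℕ.^ suc (i ℕ.+ n)) * recip (E s (i ℕ.+ n)) ≡ ∣ coeff s (i ℕ.+ suc n) ∣ * ι R ^ℚ (i ℕ.+ suc n)
      lhs = trans (ℚₚ.*-comm (ι (R ℕ.^ suc (i ℕ.+ n))) (recip (E s (i ℕ.+ n)))) (trans
        (cong₂ _*_ (trans (sym (ℚₚ.0≤p⇒∣p∣≡p (recip-nonNeg (E s (i ℕ.+ n))))) (cong ∣_∣ (sym (coeff-suc s (i ℕ.+ n))))) (ι-^ R (suc (i ℕ.+ n))))
        (cong (λ k → ∣ coeff s k ∣ * ι R ^ℚ k) (sym (ℕₚ.+-suc i n))))
      rhs : recip (4 ℕ.* D ℕ.* 2 ℕ.^ i) ≡ recip (4 ℕ.* D) * ½ ^ℚ i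
      rhs = trans (recip-* (4 ℕ.* D) (2 ℕ.^ i)) (cong (recip (4 ℕ.* D) *_) (sym (½^≡recip i)))
      reorder : ∀ r f D p → r ℕ.* (f ℕ.* D ℕ.* p) ≡ f ℕ.* p ℕ.* r ℕ.* D
      reorder = ℕ-Solver.solve 4 (λ r f D p → r ℕ-Solver.:* (f ℕ-Solver.:* D ℕ-Solver.:* p)
        ℕ-Solver.:= f ℕ-Solver.:* p ℕ-Solver.:* r ℕ-Solver.:* D) refl
      bound : R ℕ.^ suc (i ℕ.+ n) ℕ.* (4 ℕ.* D ℕ.* 2 ℕ.^ i) ℕ.≤ M (i ℕ.+ n ℕ.+ s)
      bound = subst (R ℕ.^ suc (i ℕ.+ n) ℕ.* (4 ℕ.* D ℕ.* 2 ℕ.^ i) ℕ.≤_) (cong M (sym (ℕₚ.+-assoc i n s)))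
        (subst (ℕ._≤ M (i ℕ.+ m)) (sym (reorder (R ℕ.^ suc (i ℕ.+ n)) 4 D (2 ℕ.^ i)))
          (ℕₚ.*-mono-≤ {4 ℕ.* 2 ℕ.^ i ℕ.* R ℕ.^ suc (i ℕ.+ n)} {4 ℕ.* 2 ℕ.^ (i ℕ.+ m) ℕ.* suc (i ℕ.+ m) ℕ.^ suc (i ℕ.+ m)}
            (ℕₚ.*-mono-≤ {4 ℕ.* 2 ℕ.^ i} {4 ℕ.* 2 ℕ.^ (i ℕ.+ m)} (ℕₚ.*-monoʳ-≤ 4 (ℕₚ.^-monoʳ-≤ 2 (ℕₚ.m≤m+n i m)))
              (ℕₚ.≤-trans (ℕₚ.^-monoˡ-≤ (suc (i ℕ.+ n)) (ℕₚ.≤-trans R≤ (s≤s (ℕₚ.m≤n+m m i))))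
                (ℕₚ.^-monoʳ-≤ (suc (i ℕ.+ m)) (s≤s (ℕₚ.+-monoʳ-≤ i (ℕₚ.m≤m+n n s))))))
            (ℕₚ.≤-trans D≤T (T-mono i m))))

    tail-bound : ∀ s n R D x → R ℕ.≤ suc (n ℕ.+ s) → 0 ℕ.< D → D ℕ.≤ T (n ℕ.+ s) → ∣ x ∣ ≤ ι R →
      ∀ l → suc n ℕ.≤ l → dℚ (psumℚ (coeff s) l x) (psumℚ (coeff s) (suc n) x) ≤ ½ * recip D
    tail-bound s n R D x R≤ 0<D D≤T x≤R l n<l = subst₂ _≤_ lhs rhs
      (psum-tail (coeff s) (suc n) {real x} {ι R} {recip (4 ℕ.* D)} (subst (_≤ ι R) (sym (‖real‖ x)) x≤R) (recip-nonNeg (4 ℕ.* D))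
        (λ i → coeff-bound s n i R D R≤ 0<D D≤T) (l ℕ.∸ suc n))
      where
      lhs : ‖ psum (coeff s) (l ℕ.∸ suc n ℕ.+ suc n) (real x) ⊖ psum (coeff s) (suc n) (real x) ‖₁
          ≡ dℚ (psumℚ (coeff s) l x) (psumℚ (coeff s) (suc n) x)
      lhs = trans (cong₂ (λ u v → ‖ u ⊖ v ‖₁)
          (trans (cong (λ k → psum (coeff s) k (real x)) (ℕₚ.m∸n+n≡m n<l)) (psum-real (coeff s) l x)) (psum-real (coeff s) (suc n) x))
        (ℚₚ.+-identityʳ _)
      rhs : ι 2 * recip (4 ℕ.* D) ≡ ½ * recip D
      rhs = trans (cong (ι 2 *_) (recip-* 4 D)) (sym (ℚₚ.*-assoc (ι 2) (recip 4) (recip D)))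

-- Values at rationals and at Liouville numbers; transcendence

module LiouvilleValues where

  open Rationals
  open GaussianRationals renaming (_^_ to _^ℚ_)
  open PowerSeries
  open EntireFunctions
  open LiouvilleCriterion
  open RationalApproximation
  open Denominators
  open import Defs hiding (_^_; -_; _+_; _*_; _≤_; _<_; ∣_∣; _-_)
  open RationalLemmas
  open CauchyLemmas
  open +-*-Solver
  open import Data.List.Base using (List; []; _∷_; length)
  open import Function.Bundles using (_⟨$⟩_)

  ∣∣-pos : ∀ {p} → p ≢ 0ℚ → 0ℚ ℚ.< ℚ.∣ p ∣
  ∣∣-pos {p} p≢0 = ℚₚ.≰⇒> λ le → p≢0 (ℚₚ.∣p∣≡0⇒p≡0 p (ℚₚ.≤-antisym le (ℚₚ.0≤∣p∣ p)))

  ^ℕ-distrib-* : ∀ m n k → (m ℕ.* n) ℕ.^ k ≡ m ℕ.^ k ℕ.* n ℕ.^ k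
  ^ℕ-distrib-* m n zero    = refl
  ^ℕ-distrib-* m n (suc k) = trans (cong (m ℕ.* n ℕ.*_) (^ℕ-distrib-* m n k)) (ℕₚ.[m*n]*[o*p]≡[m*o]*[n*p] m n (m ℕ.^ k) (n ℕ.^ k))

  m≤m*m : ∀ m → m ℕ.≤ m ℕ.* m
  m≤m*m zero    = z≤n
  m≤m*m (suc m) = ≤-*ʳ {suc m} {suc m} (s≤s z≤n)

  d-upper : ∀ p q {ε} → dℚ p q ℚ.≤ ε → p ℚ.≤ q ℚ.+ ε
  d-upper p q {ε} le = subst (ℚ._≤ q ℚ.+ ε) (solve 2 (λ p q → q :+ (p :- q) := p) refl p q)
    (ℚₚ.+-monoʳ-≤ q (ℚₚ.≤-trans (≤∣∣ (p ℚ.- q)) le))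

  d-lower : ∀ p q {ε} → dℚ p q ℚ.≤ ε → q ℚ.≤ p ℚ.+ ε
  d-lower p q {ε} le = d-upper q p (subst (ℚ._≤ ε) (d-sym p q) le)

  psumℚ-nonNeg : ∀ {a x} → (∀ j → 0ℚ ℚ.≤ a j) → 0ℚ ℚ.≤ x → ∀ n → 0ℚ ℚ.≤ psumℚ a n x
  psumℚ-nonNeg 0≤a 0≤x zero    = ℚₚ.≤-refl
  psumℚ-nonNeg 0≤a 0≤x (suc n) = +-nonNeg (psumℚ-nonNeg 0≤a 0≤x n) (*-nonNeg (0≤a n) (0≤^ n 0≤x))

  psumℚ-≥-term : ∀ {a x} → (∀ j → 0ℚ ℚ.≤ a j) → 0ℚ ℚ.≤ x → ∀ j k → a j ℚ.* x ^ℚ j ℚ.≤ psumℚ a (k ℕ.+ suc j) x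
  psumℚ-≥-term {a} {x} 0≤a 0≤x j zero    = ≤-by-slack (psumℚ-nonNeg 0≤a 0≤x j) (ℚₚ.+-comm (psumℚ a j x) (a j ℚ.* x ^ℚ j))
  psumℚ-≥-term {a} {x} 0≤a 0≤x j (suc k) = ℚₚ.≤-trans (psumℚ-≥-term 0≤a 0≤x j k)
    (≤-by-slack (*-nonNeg (0≤a (k ℕ.+ suc j)) (0≤^ (k ℕ.+ suc j) 0≤x)) refl)

  1≤^ : ∀ {p} n → 1ℚ ℚ.≤ p → 1ℚ ℚ.≤ p ^ℚ n
  1≤^ zero    1≤p = ℚₚ.≤-refl
  1≤^ {p} (suc n) 1≤p = subst (ℚ._≤ p ℚ.* p ^ℚ n) (ℚₚ.*-identityˡ 1ℚ) (*-mono (ℚₚ.<⇒≤ 0<1) (ℚₚ.≤-trans (ℚₚ.<⇒≤ 0<1) 1≤p) 1≤p (1≤^ n 1≤p))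

  -- `B` is independent of k, so k can be chosen after it. Using the number of coefficients as
  -- exponent keeps the induction uniform; constants are absorbed by x ≥ 1.
  evalPoly-bound : ∀ as → ∃[ B ] ∃[ N ] ∀ i k → N ℕ.≤ i → 0 ℕ.< k →
    ‖ at (evalPoly as (ℚ→ℂ (ι k))) i ‖₁ ℚ.≤ ι B ℚ.* ι k ^ℚ length as
  evalPoly-bound []       = 0 , 0 , λ _ _ _ _ → ℚₚ.≤-refl
  evalPoly-bound (a ∷ as) =
    let R , _ , N₁ , a≤R = at-bounded a
        B , N₂ , h = evalPoly-bound as
    in R ℕ.+ B , N₁ ℕ.⊔ N₂ , λ i k N≤i 0<k →
      let x = ι k
          x^ = x ^ℚ length as
          0≤x = 0≤ι k
          1≤x = ι-mono-≤ {1} {k} 0<k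
          v = at (evalPoly as (ℚ→ℂ x)) i
      in ℚₚ.≤-trans (‖⊕‖-≤ {at a i} {real x ⊗ v}
          (ℚₚ.≤-trans (p≤p+1 (‖ at a i ‖₁)) (a≤R i (ℕₚ.m⊔n≤o⇒m≤o N₁ N₂ N≤i)))
          (‖⊗‖-≤ {real x} {v} (ℚₚ.≤-reflexive (trans (‖real‖ x) (ℚₚ.0≤p⇒∣p∣≡p 0≤x))) (h i k (ℕₚ.m⊔n≤o⇒n≤o N₁ N₂ N≤i) 0<k)))
        (subst (ι R ℚ.+ x ℚ.* (ι B ℚ.* x^) ℚ.≤_)
          (trans (solve 4 (λ r b x p → r :* (x :* p) :+ x :* (b :* p) := (r :+ b) :* (x :* p)) refl (ι R) (ι B) x x^)
            (cong (ℚ._* (x ℚ.* x^)) (sym (ι-+ R B))))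
          (ℚₚ.+-monoˡ-≤ (x ℚ.* (ι B ℚ.* x^))
            (subst (ℚ._≤ ι R ℚ.* (x ℚ.* x^)) (ℚₚ.*-identityʳ (ι R)) (*-monoˡ (ι R) (0≤ι R) (1≤^ (suc (length as)) 1≤x)))))

  TranscendentalWithLiouvilleValues : Φ → ℂ⟶ℂ → Set
  TranscendentalWithLiouvilleValues φ f =
    EntireTranscendental f ×
    (Σ[ c ∈ (ℕ → ℚ) ] (∀ j → c j ≢ 0ℚ) × HasPowerSeries f (λ j → ℚ→ℂ (c j))) ×
    (∀ (s : ℕ) → Σ[ g ∈ ℂ⟶ℂ ] IsDerivative s f g ×
    IsRational (g ⟨$⟩ ℚ→ℂ 0ℚ) ×
    (∀ (r : ℚ) → r ≢ 0ℚ → IsLiouville (g ⟨$⟩ ℚ→ℂ r)) ×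
    (∀ (ζ : ℝ) → 𝓛* φ ζ → IsLiouville (g ⟨$⟩ ℝ→ℂ ζ)))

  module Values (φ̂ : ℕ → ℕ) (choice : ℕ → ℕ → ℚ → ℕ) (choice-pos : ∀ m A P → 0 ℕ.< choice m A P) where
    open Construction φ̂ choice choice-pos hiding (c; c-decay)

    -- Fixes one form of c: types over ℝ that mention two convertible forms of it
    -- would be compared by unfolding the Cauchy proofs.
    c : ℕ → ℚ
    c = Construction.c φ̂ choice choice-pos

    c-decay : Decay c
    c-decay = Construction.c-decay φ̂ choice choice-pos

    value : ℕ → ℝ → ℝ
    value s ζ = re (derivative c c-decay s ⟨$⟩ ℝ→ℂ ζ)

    seq-value : ∀ s ζ i → seq (value s ζ) i ≡ psumℚ (coeff s) (i ℕ.∸ s) (seq ζ i)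
    seq-value s ζ i = cong Re (derivative-real c c-decay s ζ i)

    value-isLiouville : ∀ s ζ → 𝓛 (value s ζ) → IsLiouville (derivative c c-decay s ⟨$⟩ ℝ→ℂ ζ)
    value-isLiouville s ζ liouville = value s ζ , liouville , ≃-refl {value s ζ} , mk≃ λ ε 0<ε →
      0 , λ n _ → subst (λ t → dℚ t 0ℚ ℚ.≤ ε) (sym (cong Im (derivative-real c c-decay s ζ n))) (ℚₚ.<⇒≤ 0<ε)

    -- The summand m m of the exponent pays for (q^n)^m. The rest e is at least 2 C d^m, and e ≤ 2^e
    -- ≤ q^e.
    power-≤ : ∀ {C n m q} → C ℕ.≤ m → n ℕ.≤ m → 2 ℕ.≤ q →
      C ℕ.* (2 ℕ.* (d m ℕ.* q ℕ.^ n) ℕ.^ m) ℕ.≤ q ℕ.^ exponent m (d m)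
    power-≤ {C} {n} {m} {q} C≤m n≤m 2≤q = begin
      C ℕ.* (2 ℕ.* (d m ℕ.* q ℕ.^ n) ℕ.^ m)               ≡⟨ cong (λ u → C ℕ.* (2 ℕ.* u)) (^ℕ-distrib-* (d m) (q ℕ.^ n) m) ⟩
      C ℕ.* (2 ℕ.* (d m ℕ.^ m ℕ.* (q ℕ.^ n) ℕ.^ m))       ≡⟨ reorder C (d m ℕ.^ m) ((q ℕ.^ n) ℕ.^ m) ⟩
      (q ℕ.^ n) ℕ.^ m ℕ.* (2 ℕ.* C ℕ.* d m ℕ.^ m)         ≤⟨ ℕₚ.*-mono-≤ q-power e-power ⟩
      q ℕ.^ (m ℕ.* m) ℕ.* q ℕ.^ e                         ≡⟨ sym (ℕₚ.^-distribˡ-+-* q (m ℕ.* m) e) ⟩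
      q ℕ.^ exponent m (d m)                              ∎
      where
      open ℕₚ.≤-Reasoning
      reorder : ∀ C x y → C ℕ.* (2 ℕ.* (x ℕ.* y)) ≡ y ℕ.* (2 ℕ.* C ℕ.* x)
      reorder = ℕ-Solver.solve 3 (λ C x y → C ℕ-Solver.:* (ℕ-Solver.con 2 ℕ-Solver.:* (x ℕ-Solver.:* y))
        ℕ-Solver.:= y ℕ-Solver.:* (ℕ-Solver.con 2 ℕ-Solver.:* C ℕ-Solver.:* x)) refl
      0<q : 0 ℕ.< q
      0<q = ℕₚ.≤-trans (s≤s z≤n) 2≤q
      e = 2 ℕ.+ 2 ℕ.* m ℕ.* d m ℕ.^ m
      q-power : (q ℕ.^ n) ℕ.^ m ℕ.≤ q ℕ.^ (m ℕ.* m)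
      q-power = ℕₚ.≤-trans (ℕₚ.≤-reflexive (ℕₚ.^-*-assoc q n m)) (ℕₚ.^-monoʳ-≤ q {{ℕ.>-nonZero 0<q}} (ℕₚ.*-monoˡ-≤ m n≤m))
      e-power : 2 ℕ.* C ℕ.* d m ℕ.^ m ℕ.≤ q ℕ.^ e
      e-power = ℕₚ.≤-trans (ℕₚ.*-monoˡ-≤ (d m ℕ.^ m) (ℕₚ.*-monoʳ-≤ 2 C≤m)) (ℕₚ.≤-trans (ℕₚ.m≤n+m (2 ℕ.* m ℕ.* d m ℕ.^ m) 2)
        (ℕₚ.≤-trans (n≤2^n e) (ℕₚ.^-monoˡ-≤ e 2≤q)))

    module _ (s : ℕ) (ζ : ℝ) {R C N₀ : ℕ} (ζ≤R : ∀ i → N₀ ℕ.≤ i → ℚ.∣ seq ζ i ∣ ℚ.≤ ι R)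
             (estimates : UniformEstimates (coeff s) (ι R) (ι C)) where

      -- Shared by both kinds of argument. Half of the error D^-m comes from the tail at ζ, half
      -- from moving ζ to x inside the truncation, and m > n₀ weakens D^-m to D^-n₀.
      approximation : ∀ {n₀ B} n x q → n₀ ℕ.< n ℕ.+ s → R ℕ.≤ suc (n ℕ.+ s) → 0 ℕ.< q → q ℕ.≤ Q (n ℕ.+ s) →
        Integral (ι q ℚ.* x) → ℚ.∣ x ∣ ℚ.≤ ι R →
        (∃[ M ] ∀ i → M ℕ.≤ i → ι C ℚ.* dℚ (seq ζ i) x ℚ.≤ ½ ℚ.* recip ((d (n ℕ.+ s) ℕ.* q ℕ.^ n) ℕ.^ (n ℕ.+ s))) →
        ¬ Integral (ι B ℚ.* psumℚ (coeff s) (suc n) x) → Approximation (value s ζ) n₀ B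
      approximation {n₀} {B} n x q n₀<m R≤ 0<q q≤Q qx x≤R (M₁ , near) non-integral = record
        { denominator  = D
        ; value        = psumℚ (coeff s) (suc n) x
        ; large        = ℕₚ.<-≤-trans n₀<m (ℕₚ.≤-trans (m≤d m) (≤-*ʳ (^>0 n 0<q)))
        ; integral     = subst Integral
            (trans (solve 3 (λ e p q → e :* p :* q := e :* q :* p) refl (ι (d m)) (psumℚ (coeff s) (suc n) x) (ι q ^ℚ n))
              (cong (ℚ._* psumℚ (coeff s) (suc n) x) (sym (trans (ι-* (d m) (q ℕ.^ n)) (cong (ι (d m) ℚ.*_) (ι-^ q n))))))
            (psumℚ-integral (coeff s) (d m) x q n qx (coeff-integral s n))
        ; close        = N₀ ℕ.⊔ M₁ ℕ.⊔ (suc n ℕ.+ s) , λ i N≤i → close i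
            (ℕₚ.m⊔n≤o⇒m≤o N₀ M₁ (ℕₚ.m⊔n≤o⇒m≤o (N₀ ℕ.⊔ M₁) (suc n ℕ.+ s) N≤i))
            (ℕₚ.m⊔n≤o⇒n≤o N₀ M₁ (ℕₚ.m⊔n≤o⇒m≤o (N₀ ℕ.⊔ M₁) (suc n ℕ.+ s) N≤i))
            (ℕₚ.m⊔n≤o⇒n≤o (N₀ ℕ.⊔ M₁) (suc n ℕ.+ s) N≤i)
        ; non-integral = non-integral
        }
        where
        m = n ℕ.+ s
        D = d m ℕ.* q ℕ.^ n
        0<D : 0 ℕ.< D
        0<D = d-pos m *> ^>0 n 0<q
        D^m≤T : D ℕ.^ m ℕ.≤ T m
        D^m≤T = ℕₚ.^-monoˡ-≤ m (ℕₚ.*-monoʳ-≤ (d m) (ℕₚ.≤-trans (ℕₚ.^-monoˡ-≤ n q≤Q)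
          (ℕₚ.^-monoʳ-≤ (Q m) {{ℕ.>-nonZero (Q-pos m)}} (ℕₚ.m≤m+n n s))))
        close : ∀ i → N₀ ℕ.≤ i → M₁ ℕ.≤ i → suc n ℕ.+ s ℕ.≤ i →
          dℚ (seq (value s ζ) i) (psumℚ (coeff s) (suc n) x) ℚ.≤ recip (D ℕ.^ n₀)
        close i N₀≤i M₁≤i n≤i = begin
          dℚ (seq (value s ζ) i) (psumℚ (coeff s) (suc n) x)
            ≡⟨ cong (λ u → dℚ u (psumℚ (coeff s) (suc n) x)) (seq-value s ζ i) ⟩
          dℚ (psumℚ (coeff s) (i ℕ.∸ s) (seq ζ i)) (psumℚ (coeff s) (suc n) x)
            ≤⟨ d-triangle (psumℚ (coeff s) (i ℕ.∸ s) (seq ζ i)) (psumℚ (coeff s) (suc n) (seq ζ i)) (psumℚ (coeff s) (suc n) x) ⟩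
          dℚ (psumℚ (coeff s) (i ℕ.∸ s) (seq ζ i)) (psumℚ (coeff s) (suc n) (seq ζ i)) ℚ.+
            dℚ (psumℚ (coeff s) (suc n) (seq ζ i)) (psumℚ (coeff s) (suc n) x)
            ≤⟨ ℚₚ.+-mono-≤
                (tail-bound s n R (D ℕ.^ m) (seq ζ i) R≤ (^>0 m 0<D) D^m≤T (ζ≤R i N₀≤i) (i ℕ.∸ s)
                  (subst (ℕ._≤ i ℕ.∸ s) (ℕₚ.m+n∸n≡m (suc n) s) (ℕₚ.∸-monoˡ-≤ s n≤i)))
                (ℚₚ.≤-trans lipschitz (near i M₁≤i)) ⟩
          ½ ℚ.* recip (D ℕ.^ m) ℚ.+ ½ ℚ.* recip (D ℕ.^ m)
            ≡⟨ halves (recip (D ℕ.^ m)) ⟩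
          recip (D ℕ.^ m)
            ≤⟨ recip-anti-≤ (^>0 n₀ 0<D) (ℕₚ.^-monoʳ-≤ D {{ℕ.>-nonZero 0<D}} (ℕₚ.<⇒≤ n₀<m)) ⟩
          recip (D ℕ.^ n₀) ∎
          where
          open ℚₚ.≤-Reasoning
          lipschitz : dℚ (psumℚ (coeff s) (suc n) (seq ζ i)) (psumℚ (coeff s) (suc n) x) ℚ.≤ ι C ℚ.* dℚ (seq ζ i) x
          lipschitz = subst₂ ℚ._≤_
            (trans (cong₂ (λ u v → ‖ u ⊖ v ‖₁) (psum-real (coeff s) (suc n) (seq ζ i)) (psum-real (coeff s) (suc n) x)) (ℚₚ.+-identityʳ _))
            (cong (ι C ℚ.*_) (ℚₚ.+-identityʳ (dℚ (seq ζ i) x)))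
            (UniformEstimates.lipschitz estimates (suc n) {real x} {real (seq ζ i)}
              (subst (ℚ._≤ ι R) (sym (‖real‖ x)) x≤R) (subst (ℚ._≤ ι R) (sym (‖real‖ (seq ζ i))) (ζ≤R i N₀≤i)))

    -- The fraction is r itself, so the tail is the only error. The rational root theorem gives no
    -- contradiction, since r does lie in (1/B)ℤ for suitable B; instead one of two consecutive
    -- truncations is selected.
    rational-value : ∀ s r → r ≢ 0ℚ → 𝓛 (value s (ℚ→ℝ r))
    rational-value s r r≢0 = approximable-liouville (value s (ℚ→ℝ r)) approximate
      where
      R₀ R C q : ℕ
      R₀ = proj₁ (ι-unbounded (ℚ.∣ r ∣))
      R = suc R₀
      r≤R : ℚ.∣ r ∣ ℚ.≤ ι R
      r≤R = ℚₚ.≤-trans (proj₂ (ι-unbounded (ℚ.∣ r ∣))) (ι-mono-≤ (ℕₚ.n≤1+n R₀))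
      C = proj₁ (uniformEstimates (coeff s) (decay-deriv^ s c c-decay) R (s≤s z≤n))
      estimates : UniformEstimates (coeff s) (ι R) (ι C)
      estimates = proj₂ (uniformEstimates (coeff s) (decay-deriv^ s c c-decay) R (s≤s z≤n))
      q = ↧ₙ r
      module _ (n₀ B : ℕ) (0<B : 0 ℕ.< B) where
        n₁ : ℕ
        -- A sum in place of a maximum: the summands ensure the exponent, the radius condition, the
        -- admission of q and B < 4T.
        n₁ = suc (n₀ ℕ.+ (R ℕ.+ (q ℕ.+ B)))
        at-degree : ∀ n → n₁ ℕ.≤ n → ¬ Integral (ι B ℚ.* psumℚ (coeff s) (suc n) r) → Approximation (value s (ℚ→ℝ r)) n₀ B
        at-degree n n₁≤n = approximation s (ℚ→ℝ r) {R} {C} {0} (λ _ _ → r≤R) estimates n r q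
          (ℕₚ.≤-trans (s≤s (ℕₚ.m≤m+n n₀ _)) n₁≤m)
          (ℕₚ.≤-trans (ℕₚ.≤-trans (ℕₚ.≤-trans (ℕₚ.m≤m+n R (q ℕ.+ B)) (ℕₚ.m≤n+m _ n₀)) (ℕₚ.n≤1+n _)) (ℕₚ.≤-trans n₁≤m (ℕₚ.n≤1+n _)))
          (0<↧ₙ r)
          (ℕₚ.≤-trans (ℕₚ.≤-trans (ℕₚ.m≤m+n q B) (ℕₚ.≤-trans (ℕₚ.m≤n+m (q ℕ.+ B) R) (ℕₚ.≤-trans (ℕₚ.m≤n+m _ n₀) (ℕₚ.n≤1+n _))))
            (ℕₚ.≤-trans n₁≤m (ℕₚ.≤-trans (ℕₚ.n≤1+n _) (ℕₚ.m≤n+m (suc (n ℕ.+ s)) _))))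
          (↧-*-integral r) r≤R
          (0 , λ _ _ → subst (ℚ._≤ ½ ℚ.* recip ((d (n ℕ.+ s) ℕ.* q ℕ.^ n) ℕ.^ (n ℕ.+ s)))
            (sym (trans (cong (ι C ℚ.*_) (d-refl r)) (ℚₚ.*-zeroʳ (ι C)))) (*-nonNeg 0≤½ (recip-nonNeg ((d (n ℕ.+ s) ℕ.* q ℕ.^ n) ℕ.^ (n ℕ.+ s)))))
          where
          n₁≤m : n₁ ℕ.≤ n ℕ.+ s
          n₁≤m = ℕₚ.≤-trans n₁≤n (ℕₚ.m≤m+n n s)
        -- The last term of the longer sum is nonzero but too small for both sums
        -- to lie in (1/B)ℤ.
        not-both : Integral (ι B ℚ.* psumℚ (coeff s) (suc n₁) r) → Integral (ι B ℚ.* psumℚ (coeff s) (suc (suc n₁)) r) → ⊥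
        not-both int₁ int₂ = ℕₚ.<⇒≱ B<4T (ι-cancel-≤ (subst₂ ℚ._≤_ (ℚₚ.*-identityˡ (ι (4 ℕ.* T m)))
            (trans (ℚₚ.*-assoc (ι B) (recip (4 ℕ.* T m)) (ι (4 ℕ.* T m)))
              (trans (cong (ι B ℚ.*_) (recip-inverse 0<4T)) (ℚₚ.*-identityʳ (ι B))))
            (*-monoʳ (ι (4 ℕ.* T m)) (0≤ι (4 ℕ.* T m)) (ℚₚ.≤-trans (integral-apart {term} B 0<B term-integral term≢0)
              (*-monoˡ (ι B) (0≤ι B) term≤)))))
          where
          m = n₁ ℕ.+ s
          term = coeff s (suc n₁) ℚ.* r ^ℚ suc n₁
          0<4T : 0 ℕ.< 4 ℕ.* T m
          0<4T = _*>_ {4} (s≤s z≤n) (T-pos m)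
          B<4T : B ℕ.< 4 ℕ.* T m
          B<4T = ℕₚ.≤-trans (s≤s (ℕₚ.≤-trans (ℕₚ.m≤n+m B q) (ℕₚ.≤-trans (ℕₚ.m≤n+m (q ℕ.+ B) R) (ℕₚ.m≤n+m _ n₀))))
            (ℕₚ.≤-trans (ℕₚ.m≤m+n n₁ s) (ℕₚ.≤-trans (m≤d m) (ℕₚ.≤-trans (d≤T m (s≤s z≤n)) (≤-*ˡ {4} (s≤s z≤n)))))
          term-integral : Integral (ι B ℚ.* term)
          term-integral = subst Integral
            (solve 3 (λ b p t → b :* (p :+ t) :+ (:- (b :* p)) := b :* t) refl (ι B) (psumℚ (coeff s) (suc n₁) r) term)
            (Integral-+ int₂ (Integral-neg int₁))
          ∣term∣ : ℚ.∣ term ∣ ≡ ℚ.∣ coeff s (suc n₁) ∣ ℚ.* ℚ.∣ r ∣ ^ℚ suc n₁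
          ∣term∣ = trans (ℚₚ.∣p*q∣≡∣p∣*∣q∣ (coeff s (suc n₁)) (r ^ℚ suc n₁)) (cong (ℚ.∣ coeff s (suc n₁) ∣ ℚ.*_) (∣∣-^ r (suc n₁)))
          term≤ : ℚ.∣ term ∣ ℚ.≤ recip (4 ℕ.* T m)
          term≤ = subst₂ ℚ._≤_ (sym ∣term∣) (ℚₚ.*-identityʳ (recip (4 ℕ.* T m))) (ℚₚ.≤-trans
            (*-monoˡ (ℚ.∣ coeff s (suc n₁) ∣) (ℚₚ.0≤∣p∣ (coeff s (suc n₁))) (^-mono-≤ (suc n₁) (ℚₚ.0≤∣p∣ r) r≤R))
            (coeff-bound s n₁ 0 R (T m) (ℕₚ.≤-trans (ℕₚ.≤-trans (ℕₚ.≤-trans (ℕₚ.m≤m+n R (q ℕ.+ B)) (ℕₚ.m≤n+m _ n₀)) (ℕₚ.n≤1+n _))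
              (ℕₚ.≤-trans (ℕₚ.m≤m+n n₁ s) (ℕₚ.n≤1+n m))) (T-pos m) ℕₚ.≤-refl))
          term≢0 : term ≢ 0ℚ
          term≢0 eq = ℚₚ.<-irrefl (sym (trans (sym ∣term∣) (cong ℚ.∣_∣ eq))) (*-pos
            (∣∣-pos λ eq → ℚₚ.<-irrefl (trans (sym eq) (coeff-suc s n₁)) (recip-pos (E-pos s n₁))) (0<^ (suc n₁) (∣∣-pos r≢0)))
        approximate : Approximation (value s (ℚ→ℝ r)) n₀ B
        approximate = by-cases (integral? (ι B ℚ.* psumℚ (coeff s) (suc n₁) r))
          where
          by-cases : Dec (Integral (ι B ℚ.* psumℚ (coeff s) (suc n₁) r)) → Approximation (value s (ℚ→ℝ r)) n₀ B
          by-cases (no ¬int)  = at-degree n₁ ℕₚ.≤-refl ¬int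
          by-cases (yes int₁) = at-degree (suc n₁) (ℕₚ.n≤1+n n₁) (not-both int₁)

    liouville-value : ∀ (φ : Φ) → (∀ N 2≤N q → ℕ→ℝ q Defs.≤ Φ.fun φ (ℕ→ℝ N) 2≤N → q ℕ.≤ φ̂ N) → ∀ s ζ → 𝓛* φ ζ → 𝓛 (value s ζ)
    liouville-value φ φ≤φ̂ s ζ (ζ∈𝓛 , K , fractions) = approximable-liouville (value s ζ) approximate
      where
      R C N₀ : ℕ
      R = proj₁ (at-bounded (ℝ→ℂ ζ))
      0<R : 0 ℕ.< R
      0<R = proj₁ (proj₂ (at-bounded (ℝ→ℂ ζ)))
      N₀ = proj₁ (proj₂ (proj₂ (at-bounded (ℝ→ℂ ζ))))
      ζ+1≤R : ∀ i → N₀ ℕ.≤ i → ℚ.∣ seq ζ i ∣ ℚ.+ 1ℚ ℚ.≤ ι R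
      ζ+1≤R i N₀≤i = subst (λ u → u ℚ.+ 1ℚ ℚ.≤ ι R) (‖real‖ (seq ζ i)) (proj₂ (proj₂ (proj₂ (at-bounded (ℝ→ℂ ζ)))) i N₀≤i)
      C = proj₁ (uniformEstimates (coeff s) (decay-deriv^ s c c-decay) R 0<R)
      estimates : UniformEstimates (coeff s) (ι R) (ι C)
      estimates = proj₂ (uniformEstimates (coeff s) (decay-deriv^ s c c-decay) R 0<R)
      module _ (n₀ B : ℕ) (0<B : 0 ℕ.< B) where
        δ : ℚ
        δ = proj₁ (liouville-apart ζ ζ∈𝓛 B 0<B)
        0<δ : 0ℚ ℚ.< δ
        0<δ = proj₁ (proj₂ (liouville-apart ζ ζ∈𝓛 B 0<B))
        M₁ : ℕ
        M₁ = proj₁ (proj₂ (proj₂ (liouville-apart ζ ζ∈𝓛 B 0<B)))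
        apart : ∀ i → M₁ ℕ.≤ i → ∀ p → Integral (ι B ℚ.* p) → δ ℚ.≤ dℚ (seq ζ i) p
        apart = proj₂ (proj₂ (proj₂ (liouville-apart ζ ζ∈𝓛 B 0<B)))
        k : ℕ
        k = proj₁ (archimedean-recip 1ℚ (½-pos 0<δ))
        k-small : ∀ l → k ℕ.≤ l → 0 ℕ.< l × 1ℚ ℚ.* recip l ℚ.≤ ½ ℚ.* δ
        k-small = proj₂ (archimedean-recip 1ℚ (½-pos 0<δ))
        n′ n m N : ℕ
        -- `C` is for `power-≤`, `K` makes N large enough for a fraction to exist, and `k` makes
        -- q^-N at most δ/2, against `apart`. The degree n is n′+1 because only coefficients of
        -- positive index are known to be reciprocals, as `rational-root` demands of the leading
        -- one.
        n′ = n₀ ℕ.+ (R ℕ.+ (C ℕ.+ (K ℕ.+ k)))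
        n = suc n′
        m = n ℕ.+ s
        N = exponent m (d m)
        n′≤m : n′ ℕ.≤ m
        n′≤m = ℕₚ.≤-trans (ℕₚ.n≤1+n n′) (ℕₚ.m≤m+n n s)
        R≤n′ : R ℕ.≤ n′
        R≤n′ = ℕₚ.≤-trans (ℕₚ.m≤m+n R _) (ℕₚ.m≤n+m _ n₀)
        C≤n′ : C ℕ.≤ n′
        C≤n′ = ℕₚ.≤-trans (ℕₚ.≤-trans (ℕₚ.m≤m+n C _) (ℕₚ.m≤n+m _ R)) (ℕₚ.m≤n+m _ n₀)
        K+k≤n′ : K ℕ.+ k ℕ.≤ n′
        K+k≤n′ = ℕₚ.≤-trans (ℕₚ.≤-trans (ℕₚ.m≤n+m _ C) (ℕₚ.m≤n+m _ R)) (ℕₚ.m≤n+m _ n₀)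
        m≤N : m ℕ.≤ N
        m≤N = ℕₚ.≤-trans (m≤m*m m) (ℕₚ.m≤m+n (m ℕ.* m) _)
        2≤N : 2 ℕ.≤ N
        2≤N = ℕₚ.≤-trans (ℕₚ.m≤m+n 2 (2 ℕ.* m ℕ.* d m ℕ.^ m)) (ℕₚ.m≤n+m _ (m ℕ.* m))
        2≤Nℝ : ℕ→ℝ 2 Defs.≤ ℕ→ℝ N
        2≤Nℝ = mk≤ λ ε 0<ε → 0 , λ _ _ → ℚₚ.≤-trans (ι-mono-≤ 2≤N) (≤-by-slack (ℚₚ.<⇒≤ 0<ε) refl)
        from-fraction : ∀ q → 2 ℕ.≤ q → q ℕ.≤ φ̂ N → ∀ x → Integral (ι q ℚ.* x) →
          ∀ M₂ → (∀ i → M₂ ℕ.≤ i → dℚ (seq ζ i) x ℚ.≤ recip (q ℕ.^ N)) → Approximation (value s ζ) n₀ B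
        from-fraction q 2≤q q≤φ̂ x qx M₂ near = approximation s ζ {R} {C} {N₀} (λ i N₀≤i → ℚₚ.≤-trans (p≤p+1 (ℚ.∣ seq ζ i ∣)) (ζ+1≤R i N₀≤i)) estimates
            n x q (ℕₚ.≤-trans (s≤s (ℕₚ.m≤m+n n₀ _)) (ℕₚ.m≤m+n n s)) (ℕₚ.≤-trans R≤n′ (ℕₚ.≤-trans n′≤m (ℕₚ.n≤1+n m))) 0<q
            (ℕₚ.≤-trans q≤φ̂ (ℕₚ.m≤m+n (φ̂ N) (suc m))) qx x≤R
            (M₂ , λ i M₂≤i → ℚₚ.≤-trans (*-monoˡ (ι C) (0≤ι C) (near i M₂≤i)) scaled)
            non-integral
          where
          0<q : 0 ℕ.< q
          0<q = ℕₚ.≤-trans (s≤s z≤n) 2≤q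
          D = d m ℕ.* q ℕ.^ n
          i₀ = N₀ ℕ.⊔ M₂ ℕ.⊔ M₁
          N₀≤i₀ : N₀ ℕ.≤ i₀
          N₀≤i₀ = ℕₚ.≤-trans (ℕₚ.m≤m⊔n N₀ M₂) (ℕₚ.m≤m⊔n (N₀ ℕ.⊔ M₂) M₁)
          M₂≤i₀ : M₂ ℕ.≤ i₀
          M₂≤i₀ = ℕₚ.≤-trans (ℕₚ.m≤n⊔m N₀ M₂) (ℕₚ.m≤m⊔n (N₀ ℕ.⊔ M₂) M₁)
          x≤R : ℚ.∣ x ∣ ℚ.≤ ι R
          x≤R = ℚₚ.≤-trans (∣∣-≤-+d x (seq ζ i₀)) (ℚₚ.≤-trans
            (ℚₚ.+-monoʳ-≤ (ℚ.∣ seq ζ i₀ ∣) (ℚₚ.≤-trans (near i₀ M₂≤i₀) (recip-≤-1 (q ℕ.^ N)))) (ζ+1≤R i₀ N₀≤i₀))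
          scaled : ι C ℚ.* recip (q ℕ.^ N) ℚ.≤ ½ ℚ.* recip (D ℕ.^ m)
          scaled = subst (ι C ℚ.* recip (q ℕ.^ N) ℚ.≤_) (recip-* 2 (D ℕ.^ m))
            (frac-≤ {C} (^>0 N 0<q) (_*>_ {2} (s≤s z≤n) (^>0 m (d-pos m *> ^>0 n 0<q)))
              (power-≤ {C} {n} {m} {q} (ℕₚ.≤-trans C≤n′ n′≤m) (ℕₚ.m≤m+n n s) 2≤q))
          N≤q^N : N ℕ.≤ q ℕ.^ N
          N≤q^N = ℕₚ.≤-trans (n≤2^n N) (ℕₚ.^-monoˡ-≤ N 2≤q)
          q^N-small : recip (q ℕ.^ N) ℚ.≤ ½ ℚ.* δ
          q^N-small = subst (ℚ._≤ ½ ℚ.* δ) (ℚₚ.*-identityˡ (recip (q ℕ.^ N)))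
            (proj₂ (k-small (q ℕ.^ N) (ℕₚ.≤-trans (ℕₚ.≤-trans (ℕₚ.m≤n+m k K) K+k≤n′) (ℕₚ.≤-trans n′≤m (ℕₚ.≤-trans m≤N N≤q^N)))))
          ½δ<δ : ½ ℚ.* δ ℚ.< δ
          ½δ<δ = subst₂ ℚ._<_ (ℚₚ.+-identityʳ (½ ℚ.* δ)) (halves δ) (ℚₚ.+-monoʳ-< (½ ℚ.* δ) (½-pos 0<δ))
          non-integral : ¬ Integral (ι B ℚ.* psumℚ (coeff s) (suc n) x)
          non-integral int = ℚₚ.<-irrefl refl (ℚₚ.≤-<-trans
            (apart i₀ (ℕₚ.m≤n⊔m (N₀ ℕ.⊔ M₂) M₁) x
              (rational-root (coeff s) n′ (E s n′) x B (E-pos s n′) (coeff-suc s n′)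
                (λ j j≤n′ → Integral-∣ {d (n′ ℕ.+ s)} {E s n′} (d∣E s n′) (coeff-integral s n′ j j≤n′)) int))
            (ℚₚ.≤-<-trans (near i₀ M₂≤i₀) (ℚₚ.≤-<-trans q^N-small ½δ<δ)))
        approximate : Approximation (value s ζ) n₀ B
        approximate = let q , 2≤q , q≤φ , near-integer = fractions N (ℕₚ.≤-trans (ℕₚ.≤-trans (ℕₚ.m≤m+n K k) K+k≤n′) (ℕₚ.≤-trans n′≤m m≤N)) 2≤Nℝ
                          x , qx , M₂ , near = nearest-fraction ζ q N 2≤q near-integer
                      in from-fraction q 2≤q (φ≤φ̂ N 2≤Nℝ q q≤φ) x qx M₂ near

    -- All coefficients are positive, so for x ≥ 1 a single term gives c_j x^j ≤ (B+1) x^L with j =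
    -- L+1. Then x ≤ (B+1) d_j, and x is chosen one larger than that.
    not-polynomial : ¬ IsPolynomial (derivative c c-decay 0)
    not-polynomial (as , f≃p) = ℕₚ.<⇒≱ (ℕₚ.n<1+n (suc B ℕ.* d j)) k≤
      where
      L j B N k : ℕ
      L = length as
      j = suc L
      B = proj₁ (evalPoly-bound as)
      N = proj₁ (proj₂ (evalPoly-bound as))
      k = suc (suc B ℕ.* d j)
      x : ℚ
      x = ι k
      1≤x : 1ℚ ℚ.≤ x
      1≤x = ι-mono-≤ {1} {k} (s≤s z≤n)
      K i : ℕ
      K = proj₁ (un≃ (proj₁ (f≃p (ℚ→ℂ x))) 1ℚ 0<1)
      -- The summand j+1 guarantees that the partial sum contains the term of index j.
      i = N ℕ.⊔ K ℕ.+ suc j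
      N≤i : N ℕ.≤ i
      N≤i = ℕₚ.≤-trans (ℕₚ.m≤m⊔n N K) (ℕₚ.m≤m+n (N ℕ.⊔ K) (suc j))
      K≤i : K ℕ.≤ i
      K≤i = ℕₚ.≤-trans (ℕₚ.m≤n⊔m N K) (ℕₚ.m≤m+n (N ℕ.⊔ K) (suc j))
      p = at (evalPoly as (ℚ→ℂ x)) i
      upper : psumℚ c i x ℚ.≤ ι (suc B) ℚ.* x ^ℚ L
      upper = ℚₚ.≤-trans (d-upper (psumℚ c i x) (Re p) (subst (λ t → dℚ t (Re p) ℚ.≤ 1ℚ) (seq-value 0 (ℚ→ℝ x) i) (proj₂ (un≃ (proj₁ (f≃p (ℚ→ℂ x))) 1ℚ 0<1) i K≤i)))
        (subst (Re p ℚ.+ 1ℚ ℚ.≤_) (trans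
            (solve 2 (λ b y → b :* y :+ y := (con 1ℚ :+ b) :* y) refl (ι B) (x ^ℚ L)) (cong (ℚ._* x ^ℚ L) (sym (ι-suc B))))
          (ℚₚ.+-mono-≤ (ℚₚ.≤-trans (≤∣∣ (Re p)) (ℚₚ.≤-trans (∣Re∣≤‖‖ p) (proj₂ (proj₂ (evalPoly-bound as)) i k N≤i (s≤s z≤n)))) (1≤^ L 1≤x)))
      cx≤ : c j ℚ.* x ℚ.≤ ι (suc B)
      cx≤ = *-cancelʳ-≤ (x ^ℚ L) (0<^ L (ℚₚ.<-≤-trans 0<1 1≤x)) (subst (ℚ._≤ ι (suc B) ℚ.* x ^ℚ L) (sym (ℚₚ.*-assoc (c j) x (x ^ℚ L)))
        (ℚₚ.≤-trans (psumℚ-≥-term {c} {x} (λ j → recip-nonNeg (d j)) (0≤ι k) j (N ℕ.⊔ K)) upper))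
      k≤ : k ℕ.≤ suc B ℕ.* d j
      k≤ = ι-cancel-≤ (subst₂ ℚ._≤_
        (trans (solve 3 (λ r x d → r :* x :* d := x :* (r :* d)) refl (c j) x (ι (d j)))
          (trans (cong (x ℚ.*_) (recip-inverse (d-pos j))) (ℚₚ.*-identityʳ x)))
        (sym (ι-* (suc B) (d j)))
        (*-monoʳ (ι (d j)) (0≤ι (d j)) cx≤))

    derivative-property : ∀ φ → (∀ N 2≤N q → ℕ→ℝ q Defs.≤ Φ.fun φ (ℕ→ℝ N) 2≤N → q ℕ.≤ φ̂ N) →
      TranscendentalWithLiouvilleValues φ (derivative c c-decay 0)
    derivative-property φ φ≤φ̂ =
        (derivative-entire c c-decay , not-polynomial)
      , (c , (λ j c≡0 → ℚₚ.<-irrefl (sym c≡0) (recip-pos (d-pos j))) , derivative-hasPowerSeries c c-decay)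
      , λ s → derivative c c-decay s
            , derivative-isDerivative c c-decay s
            , derivative-at-0 c c-decay s
            , (λ r r≢0 → value-isLiouville s (ℚ→ℝ r) (rational-value s r r≢0))
            , (λ ζ ζ∈𝓛* → value-isLiouville s ζ (liouville-value φ φ≤φ̂ s ζ ζ∈𝓛*))

-- Integer bounds for φ, and avoiding an enumeration

module Diagonalisation where

  open Rationals
  open GaussianRationals renaming (_^_ to _^ℚ_)
  open EntireFunctions
  open Denominators
  open LiouvilleValues
  open import Defs hiding (_^_; -_; _+_; _*_; _≤_; _<_; ∣_∣; _-_)
  open RationalLemmas
  open CauchyLemmas
  open +-*-Solver
  open import Function.Bundles using (_⟨$⟩_)
  open import Relation.Binary.Bundles using (Setoid)

  <⇒≱ : ∀ {p q} → p ℚ.< q → q ℚ.≤ p → ⊥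
  <⇒≱ p<q q≤p = ℚₚ.<-irrefl refl (ℚₚ.<-≤-trans p<q q≤p)

  ℕ→ℝ-mono : ∀ m n → m ℕ.≤ n → ℕ→ℝ m Defs.≤ ℕ→ℝ n
  ℕ→ℝ-mono m n m≤n = mk≤ λ ε 0<ε → 0 , λ _ _ → ℚₚ.≤-trans (ι-mono-≤ m≤n) (≤-by-slack (ℚₚ.<⇒≤ 0<ε) refl)

  module _ (φ : Φ) where
    open Φ φ

    private
      upper : ∀ N → Dec (2 ℕ.≤ N) → ℕ
      upper N (yes 2≤N) = let x = fun (ℕ→ℝ N) (ℕ→ℝ-mono 2 N 2≤N) in proj₁ (ι-unbounded (proj₁ (cauchy-bounded (seq x) (cauchy x))))
      -- A default value: φ starts at 2, and `integer-bound-≥` refutes this case.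
      upper N (no _)    = 0

    integer-bound : ℕ → ℕ
    integer-bound N = upper N (2 ℕₚ.≤? N)

    integer-bound-≥ : ∀ N 2≤N q → ℕ→ℝ q Defs.≤ fun (ℕ→ℝ N) 2≤N → q ℕ.≤ integer-bound N
    integer-bound-≥ N 2≤N q q≤φ = below (2 ℕₚ.≤? N)
      where
      below : ∀ dec → q ℕ.≤ upper N dec
      below (no 2≰N)   = contradiction (ι-cancel-≤ (≤-by-ε λ ε 0<ε → let M , h = un≤ 2≤N ε 0<ε in h M ℕₚ.≤-refl)) 2≰N
      below (yes 2≤N′) = ι-cancel-≤ (≤-by-ε λ ε 0<ε →
        let M₁ , h₁ = un≤ q≤φ (½ ℚ.* ε) (½-pos 0<ε)
            -- The bound was computed with one particular proof of 2 ≤ N; monotonicity from N to N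
            -- transfers it to the given proof.
            M₂ , h₂ = un≤ (mono (ℕ→ℝ N) (ℕ→ℝ N) 2≤N (ℕ→ℝ-mono 2 N 2≤N′) (ℕ→ℝ-mono N N ℕₚ.≤-refl)) (½ ℚ.* ε) (½-pos 0<ε)
            i = M₁ ℕ.⊔ M₂ ℕ.⊔ M₃
            M₁≤i = ℕₚ.≤-trans (ℕₚ.m≤m⊔n M₁ M₂) (ℕₚ.m≤m⊔n (M₁ ℕ.⊔ M₂) M₃)
            M₂≤i = ℕₚ.≤-trans (ℕₚ.m≤n⊔m M₁ M₂) (ℕₚ.m≤m⊔n (M₁ ℕ.⊔ M₂) M₃)
            x≤A = ℚₚ.≤-trans (≤∣∣ (seq x i)) (ℚₚ.≤-trans (x≤ i (ℕₚ.m≤n⊔m (M₁ ℕ.⊔ M₂) M₃)) (proj₂ (ι-unbounded A)))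
        in ℚₚ.≤-trans (h₁ i M₁≤i) (ℚₚ.≤-trans (ℚₚ.+-monoˡ-≤ (½ ℚ.* ε) (ℚₚ.≤-trans (h₂ i M₂≤i) (ℚₚ.+-monoˡ-≤ (½ ℚ.* ε) x≤A)))
             (ℚₚ.≤-reflexive (trans (ℚₚ.+-assoc (ι (upper N (yes 2≤N′))) (½ ℚ.* ε) (½ ℚ.* ε)) (cong (ι (upper N (yes 2≤N′)) ℚ.+_) (halves ε))))))
        where
        x : ℝ
        x = fun (ℕ→ℝ N) (ℕ→ℝ-mono 2 N 2≤N′)
        A : ℚ
        A = proj₁ (cauchy-bounded (seq x) (cauchy x))
        M₃ : ℕ
        M₃ = proj₁ (proj₂ (proj₂ (cauchy-bounded (seq x) (cauchy x))))
        x≤ : ∀ i → M₃ ℕ.≤ i → ℚ.∣ seq x i ∣ ℚ.≤ A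
        x≤ = proj₂ (proj₂ (proj₂ (cauchy-bounded (seq x) (cauchy x))))

  ⅛ : ℚ
  ⅛ = recip 8

  ⅜ : ℚ
  ⅜ = ι 3 ℚ.* recip 8

  -- With t = 1 the next partial sum is about P + u, with t = 8 about P + u/8;
  -- a rational y within u/16 of the target decides which one the target avoids.
  pick : ∀ {y v : ℚ} → Dec (v ℚ.≤ y) → ℕ
  pick (yes _) = 8
  pick (no  _) = 1

  pick-pos : ∀ {y v} (dec : Dec (v ℚ.≤ y)) → 0 ℕ.< pick dec
  pick-pos (yes _) = s≤s z≤n
  pick-pos (no  _) = s≤s z≤n

  -- Measure from P in units of u/32. With an error of half the last term, f lies in [2, 6] for the
  -- multiplier 8 and in [16, 48] for 1. The threshold is 12, and y is within 3 of f. So y ≥ 12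
  -- contradicts f ≤ 6, and y < 12 contradicts f ≥ 16.
  pick-avoids : ∀ {y u P f z} (dec : Dec (P ℚ.+ ⅜ ℚ.* u ℚ.≤ y)) → 0ℚ ℚ.< u →
    dℚ f (P ℚ.+ recip (pick dec) ℚ.* u) ℚ.≤ ½ ℚ.* (recip (pick dec) ℚ.* u) →
    dℚ f z ℚ.≤ recip 32 ℚ.* u → dℚ z y ℚ.≤ recip 16 ℚ.* u → ⊥
  pick-avoids {y} {u} {P} {f} {z} (yes P+⅜u≤y) 0<u f≈ f≈z z≈y =
    <⇒≱ (*-pos {ι 3 ℚ.* recip 32} {u} (*-pos (0<ι {3} (s≤s z≤n)) (recip-pos {32} (s≤s z≤n))) 0<u)
      (combine-≤ {ι 3 ℚ.* recip 32 ℚ.* u} {0ℚ} {x₂ = 0ℚ} {y₂ = 0ℚ} gap ℚₚ.≤-refl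
        (solve 2 (λ P u → con 0ℚ :+ (P :+ con ⅜ :* u :+ con 0ℚ) := con (ι 3) :* con (recip 32) :* u
          :+ (P :+ con ⅛ :* u :+ con ½ :* (con ⅛ :* u) :+ con (recip 32) :* u :+ con (recip 16) :* u :+ con 0ℚ)) refl P u))
    where
    gap : P ℚ.+ ⅜ ℚ.* u ℚ.≤ P ℚ.+ ⅛ ℚ.* u ℚ.+ ½ ℚ.* (⅛ ℚ.* u) ℚ.+ recip 32 ℚ.* u ℚ.+ recip 16 ℚ.* u
    gap = begin
      P ℚ.+ ⅜ ℚ.* u                              ≤⟨ P+⅜u≤y ⟩
      y                                          ≤⟨ d-lower z y z≈y ⟩
      z ℚ.+ recip 16 ℚ.* u                       ≤⟨ ℚₚ.+-monoˡ-≤ (recip 16 ℚ.* u) (d-lower f z f≈z) ⟩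
      f ℚ.+ recip 32 ℚ.* u ℚ.+ recip 16 ℚ.* u    ≤⟨ ℚₚ.+-monoˡ-≤ (recip 16 ℚ.* u) (ℚₚ.+-monoˡ-≤ (recip 32 ℚ.* u) (d-upper f (P ℚ.+ ⅛ ℚ.* u) f≈)) ⟩
      P ℚ.+ ⅛ ℚ.* u ℚ.+ ½ ℚ.* (⅛ ℚ.* u) ℚ.+ recip 32 ℚ.* u ℚ.+ recip 16 ℚ.* u ∎
      where open ℚₚ.≤-Reasoning
  pick-avoids {y} {u} {P} {f} {z} (no P+⅜u≰y) 0<u f≈ f≈z z≈y =
    <⇒≱ (*-pos {recip 32} {u} (recip-pos {32} (s≤s z≤n)) 0<u)
      (combine-≤ {recip 32 ℚ.* u} {0ℚ} {x₂ = 0ℚ} {y₂ = 0ℚ} gap ℚₚ.≤-refl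
        (solve 2 (λ P u → con 0ℚ :+ (P :+ con (recip 1) :* u :+ con 0ℚ) := con (recip 32) :* u
          :+ (P :+ con ⅜ :* u :+ con (recip 16) :* u :+ con (recip 32) :* u :+ con ½ :* (con (recip 1) :* u) :+ con 0ℚ)) refl P u))
    where
    gap : P ℚ.+ recip 1 ℚ.* u ℚ.≤ P ℚ.+ ⅜ ℚ.* u ℚ.+ recip 16 ℚ.* u ℚ.+ recip 32 ℚ.* u ℚ.+ ½ ℚ.* (recip 1 ℚ.* u)
    gap = begin
      P ℚ.+ recip 1 ℚ.* u  ≤⟨ d-lower f (P ℚ.+ recip 1 ℚ.* u) f≈ ⟩
      f ℚ.+ h              ≤⟨ ℚₚ.+-monoˡ-≤ h (d-upper f z f≈z) ⟩
      z ℚ.+ recip 32 ℚ.* u ℚ.+ h ≤⟨ ℚₚ.+-monoˡ-≤ h (ℚₚ.+-monoˡ-≤ (recip 32 ℚ.* u) (d-upper z y z≈y)) ⟩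
      y ℚ.+ recip 16 ℚ.* u ℚ.+ recip 32 ℚ.* u ℚ.+ h
        ≤⟨ ℚₚ.+-monoˡ-≤ h (ℚₚ.+-monoˡ-≤ (recip 32 ℚ.* u) (ℚₚ.+-monoˡ-≤ (recip 16 ℚ.* u) (ℚₚ.<⇒≤ (ℚₚ.≰⇒> P+⅜u≰y)))) ⟩
      P ℚ.+ ⅜ ℚ.* u ℚ.+ recip 16 ℚ.* u ℚ.+ recip 32 ℚ.* u ℚ.+ h ∎
      where
      open ℚₚ.≤-Reasoning
      h = ½ ℚ.* (recip 1 ℚ.* u)

  module Target (e : ℕ → ℂ⟶ℂ) where

    target : ℕ → ℝ
    target k = re (e k ⟨$⟩ ℚ→ℂ 1ℚ)

    -- `choice` has to be defined for every A, before A is known to be positive; A+1 keeps the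
    -- tolerance positive.
    tolerance : ℕ → ℚ
    tolerance A = recip (16 ℕ.* suc A)

    tolerance-pos : ∀ A → 0ℚ ℚ.< tolerance A
    tolerance-pos A = recip-pos {16 ℕ.* suc A} (_*>_ {16} {suc A} (s≤s z≤n) (s≤s z≤n))

    index : ℕ → ℕ → ℕ
    index k A = proj₁ (cauchy (target k) (tolerance A) (tolerance-pos A))

    sample : ℕ → ℕ → ℚ
    sample k A = seq (target k) (index k A)

    threshold : ∀ k A P → Dec (P ℚ.+ ⅜ ℚ.* recip A ℚ.≤ sample k A)
    threshold k A P = P ℚ.+ ⅜ ℚ.* recip A ℚₚ.≤? sample k A

    opaque
      choice : ℕ → ℕ → ℚ → ℕ
      choice k A P = pick (threshold k A P)

      choice-pick : ∀ k A P → choice k A P ≡ pick (threshold k A P)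
      choice-pick k A P = refl

      choice-pos : ∀ k A P → 0 ℕ.< choice k A P
      choice-pos k A P = pick-pos (threshold k A P)

    sample-close : ∀ k A i → 0 ℕ.< A → index k A ℕ.≤ i → dℚ (seq (target k) i) (sample k A) ℚ.≤ recip 16 ℚ.* recip A
    sample-close k A i 0<A N≤i = ℚₚ.≤-trans (proj₂ (cauchy (target k) (tolerance A) (tolerance-pos A)) i (index k A) N≤i ℕₚ.≤-refl)
      (subst (tolerance A ℚ.≤_) (recip-* 16 A) (recip-anti-≤ (_*>_ {16} (s≤s z≤n) 0<A) (ℕₚ.*-monoʳ-≤ 16 (ℕₚ.n≤1+n A))))

  module Enumeration (φ̂ : ℕ → ℕ) (e : ℕ → ℂ⟶ℂ) where
    open Target e
    open Construction φ̂ choice choice-pos hiding (c; c-decay)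
    open Values φ̂ choice choice-pos

    P-psum : ∀ m → P m ≡ psumℚ c (suc m) 1ℚ
    P-psum zero    = trans P-zero (sym (cong (λ u → 0ℚ ℚ.+ recip u ℚ.* 1ℚ) d-zero))
    P-psum (suc m) = trans (P-suc m) (cong₂ ℚ._+_ (P-psum m) (sym (trans (cong (recip (d (suc m)) ℚ.*_) (1^ (suc m))) (ℚₚ.*-identityʳ _))))
      where
      1^ : ∀ n → 1ℚ ^ℚ n ≡ 1ℚ
      1^ zero    = refl
      1^ (suc n) = trans (ℚₚ.*-identityˡ (1ℚ ^ℚ n)) (1^ n)

    not-enumerated : ∀ k → ¬ Setoid._≈_ ℂ-functions (derivative c c-decay 0) (e k)
    not-enumerated k f≈e = pick-avoids {sample k (A k)} {u} {P k} {psumℚ c i 1ℚ} {seq (target k) i} (threshold k (A k) (P k)) 0<u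
        (subst₂ ℚ._≤_ (cong (dℚ (psumℚ c i 1ℚ)) (trans (sym (P-psum (suc k))) (trans (P-suc k) (cong (P k ℚ.+_) recip-d))))
          (cong (½ ℚ.*_) recip-d)
          -- With D = d_(k+1) the tail is at most half of the last included term, so later choices
          -- cannot undo the one at stage k.
          (tail-bound 0 (suc k) 1 (d (suc k)) 1ℚ (s≤s z≤n) (d-pos (suc k))
            (subst (λ m → d (suc k) ℕ.≤ T m) (sym (ℕₚ.+-identityʳ (suc k))) (d≤T (suc k) (s≤s z≤n))) ℚₚ.≤-refl i (ℕₚ.m≤n+m (suc (suc k)) _)))
        (subst (λ v → dℚ v (seq (target k) i) ℚ.≤ ε) (seq-value 0 (ℚ→ℝ 1ℚ) i)
          (proj₂ (un≃ (proj₁ (f≈e (ℚ→ℂ 1ℚ))) ε 0<ε) i (ℕₚ.≤-trans (ℕₚ.m≤m⊔n N (index k (A k))) (ℕₚ.m≤m+n _ (suc (suc k))))))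
        (sample-close k (A k) i (A-pos k) (ℕₚ.≤-trans (ℕₚ.m≤n⊔m N (index k (A k))) (ℕₚ.m≤m+n _ (suc (suc k)))))
      where
      u ε : ℚ
      u = recip (A k)
      0<u : 0ℚ ℚ.< u
      0<u = recip-pos (A-pos k)
      ε = recip 32 ℚ.* u
      0<ε : 0ℚ ℚ.< ε
      0<ε = *-pos (recip-pos {32} (s≤s z≤n)) 0<u
      N i : ℕ
      N = proj₁ (un≃ (proj₁ (f≈e (ℚ→ℂ 1ℚ))) ε 0<ε)
      i = N ℕ.⊔ index k (A k) ℕ.+ suc (suc k)
      recip-d : recip (d (suc k)) ≡ recip (pick (threshold k (A k) (P k))) ℚ.* u
      recip-d = trans (cong recip (d-suc k)) (trans (recip-* (t k) (A k))
        (cong (λ v → recip v ℚ.* recip (A k)) (choice-pick k (A k) (P k))))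

open import Defs
open import Function.Bundles using (_⟨$⟩_)
open import Relation.Unary using (_∈_)

open EntireFunctions using (derivative)
open LiouvilleValues using (module Values)
open Diagonalisation

theorem4p3 : ∀ (φ : Φ) → Uncountable ℂ-functions λ f →
    EntireTranscendental f ×
    (Σ[ c ∈ (ℕ → ℚ) ] (∀ j → c j ≢ 0ℚ) × HasPowerSeries f (λ j → ℚ→ℂ (c j))) ×
    (∀ (s : ℕ) → Σ[ g ∈ ℂ⟶ℂ ] IsDerivative s f g ×
    IsRational (g ⟨$⟩ ℚ→ℂ 0ℚ) ×
    (∀ (r : ℚ) → r ≢ 0ℚ → IsLiouville (g ⟨$⟩ ℚ→ℂ r)) ×
    (∀ (ζ : ℝ) → ζ ∈ 𝓛* φ → IsLiouville (g ⟨$⟩ ℝ→ℂ ζ)))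
theorem4p3 φ e = derivative (Values.c φ̂ choice choice-pos) (Values.c-decay φ̂ choice choice-pos) 0
               , Values.derivative-property φ̂ choice choice-pos φ (integer-bound-≥ φ)
               , Enumeration.not-enumerated φ̂ e
  where
  open Target e using (choice; choice-pos)
  φ̂ : ℕ → ℕ
  φ̂ = integer-bound φ
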